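{- As power series in $q$, \[ \sum_{n=0}^\infty \mathcal{EO}_u(10n+4)q^n =3\,\frac{ f_2^4f_5^6}{f_1^8 f_{10}^2}+8q\,\frac{f_2^3 f_5f_{10}^3}{f_1^7}. \]
   Context: For a positive integer $k$, let $f_k:=(q^k;q^k)_\infty=\prod_{i=1}^\infty(1-q^{ki})$. The integers $\mathcal{EO}_u(n)$, $n\ge 0$, are defined by $\sum_{n=0}^\infty \mathcal{EO}_u(n)q^n=\dfrac{f_4^2}{f_2^2}$. -}

module Defs where

open import Algebra.Bundles.Raw using (RawRing)
open import Data.Fin.Base as Fin using (Fin; toℕ)
open import Data.Fin.Properties using (toℕ<n)
open import Data.Integer.Base as ℤ using (ℤ; 0ℤ; 1ℤ)
import Data.Integer.Properties as ℤ
open import Data.Nat.Base as ℕ using (ℕ; zero; suc; NonZero; _≤_; _<_; _≤′_; ≤′-refl; ≤′-step; z≤n; s≤s; s<s)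
import Data.Nat.Properties as ℕ
open import Data.Vec.Base using (Vec; []; _∷_; head; lookup)
open import Level using (0ℓ)
open import Relation.Binary.PropositionalEquality

open import Algebra.Properties.Semiring.Sum ℤ.+-*-semiring using (sum; sum-cong-≗; sum-replicate-zero)

-- A sequence of integers and its generating function are the same object:
-- a stands for ∑ₙ a(n) qⁿ.
PowerSeries : Set
PowerSeries = ℕ → ℤ

infix 4 _≈_
_≈_ : PowerSeries → PowerSeries → Set
a ≈ b = ∀ n → a n ≡ b n

q^_ : ℕ → PowerSeries
(q^ zero)  zero    = 1ℤ
(q^ zero)  (suc n) = 0ℤ
(q^ suc m) zero    = 0ℤ
(q^ suc m) (suc n) = (q^ m) n

q : PowerSeries
q = q^ 1

infix  8 -_
infixl 7 _*_ _/_
infixl 6 _+_ _-_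

0# 1# : PowerSeries
0# _ = 0ℤ
1# = q^ 0

-_ : PowerSeries → PowerSeries
(- a) n = ℤ.- a n

_+_ _-_ _*_ : PowerSeries → PowerSeries → PowerSeries
(a + b) n = a n ℤ.+ b n
a - b     = a + (- b)
(a * b) n = sum {suc n} λ i → a (toℕ i) ℤ.* b (n ℕ.∸ toℕ i)

rawRing : RawRing 0ℓ 0ℓ
rawRing = record
  { Carrier = PowerSeries ; _≈_ = _≈_
  ; _+_ = _+_ ; _*_ = _*_ ; -_ = -_ ; 0# = 0# ; 1# = 1# }

-- Here n × a is the n-fold sum of a, not a product type.
open import Algebra.Definitions.RawSemiring (RawRing.rawSemiring rawRing) public using (_^_; _×_)

-- The coefficients n, n-1, …, 0 of 1/a, where a has constant term 1, from
-- the recurrence (1/a)(n+1) = - ∑_{i ≤ n} a(i+1) (1/a)(n-i).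
inverses : PowerSeries → (n : ℕ) → Vec ℤ (suc n)
inverses a zero    = 1ℤ ∷ []
inverses a (suc n) = ℤ.- sum (λ i → a (suc (toℕ i)) ℤ.* lookup (inverses a n) i) ∷ inverses a n

-- Only meaningful when a has constant term 1; see *-inverseʳ.
_⁻¹ : PowerSeries → PowerSeries
(a ⁻¹) n = head (inverses a n)

_/_ : PowerSeries → PowerSeries → PowerSeries
a / b = a * b ⁻¹

∏< : ℕ → (ℕ → PowerSeries) → PowerSeries
∏< zero    a = 1#
∏< (suc N) a = a N * ∏< N a

-- ∏_{i ≥ 0} a(i), for factors with a(i) ≡ 1 modulo q^{i+1}: the factors
-- with i ≥ n do not affect the coefficient of qⁿ; see ∏<-stable.
∏∞ : (ℕ → PowerSeries) → PowerSeries
∏∞ a n = ∏< n a n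

-- (q^k; q^k)_∞; the product index is shifted to start at 0.
f : (k : ℕ) → .{{NonZero k}} → PowerSeries
f k = ∏∞ λ i → 1# - q^ (k ℕ.* suc i)

EOᵤ : ℕ → ℤ
EOᵤ = f 4 ^ 2 / f 2 ^ 2

lookup-inverses : ∀ a n (i : Fin (suc n)) → lookup (inverses a n) i ≡ (a ⁻¹) (n ℕ.∸ toℕ i)
lookup-inverses a zero    Fin.zero    = refl
lookup-inverses a (suc n) Fin.zero    = refl
lookup-inverses a (suc n) (Fin.suc i) = lookup-inverses a n i

*-inverseʳ : ∀ a → a 0 ≡ 1ℤ → a * a ⁻¹ ≈ 1#
*-inverseʳ a a₀≡1 zero    rewrite a₀≡1 = refl
*-inverseʳ a a₀≡1 (suc n) = begin
  a 0 ℤ.* (ℤ.- s) ℤ.+ s′  ≡⟨ cong₂ (λ x y → x ℤ.* (ℤ.- s) ℤ.+ y) a₀≡1 s′≡s ⟩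
  1ℤ ℤ.* (ℤ.- s) ℤ.+ s    ≡⟨ cong (ℤ._+ s) (ℤ.*-identityˡ (ℤ.- s)) ⟩
  (ℤ.- s) ℤ.+ s           ≡⟨ ℤ.+-inverseˡ s ⟩
  0ℤ                      ∎
  where
  open ≡-Reasoning
  s s′ : ℤ
  s  = sum λ i → a (suc (toℕ i)) ℤ.* lookup (inverses a n) i
  s′ = sum {suc n} λ i → a (suc (toℕ i)) ℤ.* (a ⁻¹) (n ℕ.∸ toℕ i)
  s′≡s : s′ ≡ s
  s′≡s = sum-cong-≗ λ i → cong (a (suc (toℕ i)) ℤ.*_) (sym (lookup-inverses a n i))

-- Hence every product of powers of the f k is invertible.
f-constant : ∀ k → .{{_ : NonZero k}} → f k 0 ≡ 1ℤ
f-constant k = refl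

*-constant : ∀ a b → a 0 ≡ 1ℤ → b 0 ≡ 1ℤ → (a * b) 0 ≡ 1ℤ
*-constant a b a₀≡1 b₀≡1 rewrite a₀≡1 | b₀≡1 = refl

^-constant : ∀ a n → a 0 ≡ 1ℤ → (a ^ n) 0 ≡ 1ℤ
^-constant a zero    a₀≡1 = refl
^-constant a (suc n) a₀≡1 = *-constant a (a ^ n) a₀≡1 (^-constant a n a₀≡1)

infix 4 _≈1mod-q^1+_
_≈1mod-q^1+_ : PowerSeries → ℕ → Set
a ≈1mod-q^1+ n = ∀ j → j ≤ n → a j ≡ 1# j

*-identityˡ-upTo : ∀ a b n → a ≈1mod-q^1+ n → (a * b) n ≡ b n
*-identityˡ-upTo a b n a≈1 = begin
  (a * b) n           ≡⟨ cong₂ ℤ._+_ (cong (ℤ._* b n) (a≈1 0 z≤n)) tail≡0 ⟩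
  1ℤ ℤ.* b n ℤ.+ 0ℤ   ≡⟨ ℤ.+-identityʳ _ ⟩
  1ℤ ℤ.* b n          ≡⟨ ℤ.*-identityˡ _ ⟩
  b n                 ∎
  where
  open ≡-Reasoning
  tail≡0 : sum {n} (λ i → a (suc (toℕ i)) ℤ.* b (n ℕ.∸ suc (toℕ i))) ≡ 0ℤ
  tail≡0 = trans
    (sum-cong-≗ λ i → cong (ℤ._* b (n ℕ.∸ suc (toℕ i))) (a≈1 (suc (toℕ i)) (toℕ<n i)))
    (sum-replicate-zero n)

∏<-stable : ∀ a → (∀ i → a i ≈1mod-q^1+ i) → ∀ {n N} → n ≤ N → ∏< N a n ≡ ∏∞ a n
∏<-stable a a≈1 n≤N = go (ℕ.≤⇒≤′ n≤N)
  where
  go : ∀ {n N} → n ≤′ N → ∏< N a n ≡ ∏∞ a n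
  go ≤′-refl             = refl
  go {n} {suc N} (≤′-step n≤′N) = trans
    (*-identityˡ-upTo (a N) (∏< N a) n λ j j≤n → a≈1 N j (ℕ.≤-trans j≤n (ℕ.≤′⇒≤ n≤′N)))
    (go n≤′N)

q^-below : ∀ {m j} → j < m → (q^ m) j ≡ 0ℤ
q^-below {suc m} {zero}  _         = refl
q^-below {suc m} {suc j} (s<s j<m) = q^-below j<m

f-stable : ∀ k → .{{_ : NonZero k}} → ∀ {n N} → n ≤ N →
           ∏< N (λ i → 1# - q^ (k ℕ.* suc i)) n ≡ f k n
f-stable k = ∏<-stable _ λ i j j≤i → trans
  (cong (λ x → 1# j ℤ.+ ℤ.- x) (q^-below (ℕ.≤-trans (s≤s j≤i) (ℕ.m≤n*m (suc i) k))))
  (ℤ.+-identityʳ (1# j))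

{-# OPTIONS --safe #-}
module Submission where

-- Put φ = φ(-q) = f₁²/f₂ and H = f₂²/f₁².  Then f₄²/f₂² = H(q²) and φ H = f₂,
-- so the claim concerns the exponents 5n+2 in H.  The Jacobi triple product
-- turns f₁, f₂ and φ into theta series, hence gives their 5-dissections
--   f₁ = A + q B + q² C,  f₂ = α + q² β + q⁴ γ,  φ = a + q b + q⁴ c
-- (all sections evaluated at q⁵) with B = - f₅, β = - f₁₀, a = φ(-q⁵).
-- Comparing sections in φ f₂ = f₁² yields enough relations to see that, with
-- t = q b c, the norm of φ is (a² + t)³ / a and that Cramer's rule applied to
-- φ H = f₂ gives H₂ = - β a (3a² - 2t) / (a² + t)².  Finally b c is an eta
-- quotient by the triple product, and a² + t = φ² because the vectors of norm
-- divisible by 5 in ℤ[i] are the multiples of 2 + i and of 2 - i.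

open import Defs
open import Algebra.Bundles using (CommutativeRing)
open import Algebra.Solver.Ring.AlmostCommutativeRing using (fromCommutativeRing; _-Raw-AlmostCommutative⟶_)
import Algebra.Solver.Ring as RingSolver
open import Data.Fin.Base using (toℕ)
open import Data.Fin.Properties using (toℕ<n)
open import Data.Integer.Base as ℤ using (ℤ; +_; -[1+_]; 0ℤ; 1ℤ)
import Data.Integer.Properties as ℤ
import Data.Integer.Solver as ℤ-Solver
open import Data.Maybe.Base using (Maybe; just; nothing)
open import Data.Nat.Base as ℕ using (ℕ; zero; suc; NonZero; _≤_; _<_; z≤n; s≤s)
open import Data.Nat.Divisibility using (∣-refl)
open import Data.Nat.DivMod using (m<n⇒m%n≡m; [m+n]%n≡m%n; [m+kn]%n≡m%n; +-distrib-/-∣ˡ; m%n<n; m≡m%n+[m/n]*n; m/n≤m; n/n≡1; m*n%n≡0; m*n/n≡m)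
open import Data.Nat.Induction using (<-rec)
import Data.Nat.Properties as ℕ
import Data.Nat.Solver as ℕ-Solver
open import Data.Product.Base as Product using (∃; _,_)
open import Function.Base using (_∘_; _$_)
open import Level using (0ℓ)
open import Relation.Binary.PropositionalEquality hiding (setoid)
import Relation.Binary.Reasoning.Setoid as SetoidReasoning
open import Relation.Nullary using (yes; no; ¬_; Dec)
open import Relation.Nullary.Negation using (contradiction)
open import Algebra.Properties.Semiring.Sum ℤ.+-*-semiring using (sum-cong-≗)

-- Power series as a commutative ring

-- Up to sign, `x` and `y` are reciprocals of the Rogers-Ramanujan continued fraction at q² and at
-- q. Their product formulas are avoided: both series stay unknowns, and the sections of φ f₂ = f₁²
-- are combined so that they disappear. What survives is expressed in a, V = c x² and V′ = q b x⁻²,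
-- which satisfy a single quadratic relation, (V - a)(a - V′) = a². The norm and the numerator are
-- then polynomials in a, V, V′ to be reduced modulo that relation, and each reduction is one
-- explicit cofactor. Fifth roots of unity and fractional powers of q do not occur either: the
-- conjugates of φ are replaced by the cofactors of multiplication by φ on the five sections. Two
-- facts lie outside this elimination. One is a² + t = φ², which makes the denominator invertible
-- and turns it into an eta quotient. The other is the product formula for b c. Since t = - 4 q
-- f(-q³,-q⁷) f(-q,-q⁹), the term - 2t is the origin of the coefficient 8.

infixl 7 _⊗_
infixl 6 _⊕_
infix  8 ⊖_

-- The ring operations are made opaque so that Agda compares power series
-- expressions symbolically instead of unfolding Cauchy products.
opaque
  _⊕_ _⊗_ : PowerSeries → PowerSeries → PowerSeries
  _⊕_ = _+_
  _⊗_ = _*_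

  ⊖_ : PowerSeries → PowerSeries
  ⊖_ = -_

tail : PowerSeries → PowerSeries
tail a n = a (suc n)

constant : ℤ → PowerSeries
constant z zero    = z
constant z (suc n) = 0ℤ

infix 4 _≈[_]_
-- Agreement modulo q^M. Convergence of theta series and infinite products is expressed only through
-- these congruences.
_≈[_]_ : PowerSeries → ℕ → PowerSeries → Set
a ≈[ M ] b = ∀ n → n < M → a n ≡ b n

opaque
  unfolding _⊕_

  ⊕-coeff : ∀ a b n → (a ⊕ b) n ≡ a n ℤ.+ b n
  ⊕-coeff a b n = refl

  ⊖-coeff : ∀ a n → (⊖ a) n ≡ ℤ.- a n
  ⊖-coeff a n = refl

  ⊗-coeff-0 : ∀ a b → (a ⊗ b) 0 ≡ a 0 ℤ.* b 0
  ⊗-coeff-0 a b = ℤ.+-identityʳ _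

  -- Peeling off the constant term of the left factor turns the Cauchy sum into a recursion;
  -- commutativity, distributivity and associativity are inductions along it.
  ⊗-coeff-suc : ∀ a b n → (a ⊗ b) (suc n) ≡ a 0 ℤ.* b (suc n) ℤ.+ (tail a ⊗ b) n
  ⊗-coeff-suc a b n = refl

  ⊕-≈[] : ∀ {a a′ b b′ M} → a ≈[ M ] a′ → b ≈[ M ] b′ → a ⊕ b ≈[ M ] a′ ⊕ b′
  ⊕-≈[] p r n n<M = cong₂ ℤ._+_ (p n n<M) (r n n<M)

  ⊗-≈[] : ∀ {a a′ b b′ M} → a ≈[ M ] a′ → b ≈[ M ] b′ → a ⊗ b ≈[ M ] a′ ⊗ b′
  ⊗-≈[] p r n n<M = sum-cong-≗ {suc n} λ i → cong₂ ℤ._*_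
    (p (toℕ i) (ℕ.≤-<-trans (ℕ.≤-pred (toℕ<n i)) n<M))
    (r (n ℕ.∸ toℕ i) (ℕ.≤-<-trans (ℕ.m∸n≤m n (toℕ i)) n<M))

  tail-⊕ : ∀ a b → tail (a ⊕ b) ≈ tail a ⊕ tail b
  tail-⊕ a b n = refl

≈[]-all : ∀ {a b} → a ≈ b → ∀ {M} → a ≈[ M ] b
≈[]-all p n _ = p n

≈[]-limit : ∀ {a b} → (∀ M → a ≈[ M ] b) → a ≈ b
≈[]-limit p n = p (suc n) n ℕ.≤-refl

⊕-cong : ∀ {a a′ b b′} → a ≈ a′ → b ≈ b′ → a ⊕ b ≈ a′ ⊕ b′
⊕-cong p r = ≈[]-limit λ M → ⊕-≈[] (≈[]-all p) (≈[]-all r)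

⊗-cong : ∀ {a a′ b b′} → a ≈ a′ → b ≈ b′ → a ⊗ b ≈ a′ ⊗ b′
⊗-cong p r = ≈[]-limit λ M → ⊗-≈[] (≈[]-all p) (≈[]-all r)

⊗-zeroˡ : ∀ a → 0# ⊗ a ≈ 0#
⊗-zeroˡ a zero    = trans (⊗-coeff-0 0# a) refl
⊗-zeroˡ a (suc n) = trans (⊗-coeff-suc 0# a n) (trans (ℤ.+-identityˡ _) (⊗-zeroˡ a n))

constant-⊗ : ∀ z a n → (constant z ⊗ a) n ≡ z ℤ.* a n
constant-⊗ z a zero    = ⊗-coeff-0 (constant z) a
constant-⊗ z a (suc n) = trans (⊗-coeff-suc (constant z) a n)
  (trans (cong (λ u → z ℤ.* a (suc n) ℤ.+ u) (⊗-zeroˡ a n)) (ℤ.+-identityʳ _))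

1#≈constant : 1# ≈ constant 1ℤ
1#≈constant zero    = refl
1#≈constant (suc n) = refl

⊗-identityˡ : ∀ a → 1# ⊗ a ≈ a
⊗-identityˡ a n = trans (⊗-cong {b = a} 1#≈constant (λ _ → refl) n)
  (trans (constant-⊗ 1ℤ a n) (ℤ.*-identityˡ _))

-- The mirror image of `⊗-coeff-suc`. Having both makes commutativity a direct induction.
⊗-coeff-sucʳ : ∀ a b n → (a ⊗ b) (suc n) ≡ a (suc n) ℤ.* b 0 ℤ.+ (a ⊗ tail b) n
⊗-coeff-sucʳ a b zero = begin
  (a ⊗ b) 1                                ≡⟨ ⊗-coeff-suc a b 0 ⟩
  a 0 ℤ.* b 1 ℤ.+ (tail a ⊗ b) 0           ≡⟨ cong (λ u → a 0 ℤ.* b 1 ℤ.+ u) (⊗-coeff-0 (tail a) b) ⟩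
  a 0 ℤ.* b 1 ℤ.+ a 1 ℤ.* b 0              ≡⟨ ℤ.+-comm (a 0 ℤ.* b 1) _ ⟩
  a 1 ℤ.* b 0 ℤ.+ a 0 ℤ.* b 1              ≡⟨ cong (λ u → a 1 ℤ.* b 0 ℤ.+ u) (⊗-coeff-0 a (tail b)) ⟨
  a 1 ℤ.* b 0 ℤ.+ (a ⊗ tail b) 0           ∎
  where open ≡-Reasoning
⊗-coeff-sucʳ a b (suc n) = begin
  (a ⊗ b) (2 ℕ.+ n)
    ≡⟨ ⊗-coeff-suc a b (suc n) ⟩
  a 0 ℤ.* b (2 ℕ.+ n) ℤ.+ (tail a ⊗ b) (suc n)
    ≡⟨ cong (λ u → a 0 ℤ.* b (2 ℕ.+ n) ℤ.+ u) (⊗-coeff-sucʳ (tail a) b n) ⟩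
  a 0 ℤ.* b (2 ℕ.+ n) ℤ.+ (a (2 ℕ.+ n) ℤ.* b 0 ℤ.+ (tail a ⊗ tail b) n)
    ≡⟨ solve 3 (λ x y z → x :+ (y :+ z) := y :+ (x :+ z)) refl (a 0 ℤ.* b (2 ℕ.+ n)) (a (2 ℕ.+ n) ℤ.* b 0) _ ⟩
  a (2 ℕ.+ n) ℤ.* b 0 ℤ.+ (a 0 ℤ.* b (2 ℕ.+ n) ℤ.+ (tail a ⊗ tail b) n)
    ≡⟨ cong (λ u → a (2 ℕ.+ n) ℤ.* b 0 ℤ.+ u) (⊗-coeff-suc a (tail b) n) ⟨
  a (2 ℕ.+ n) ℤ.* b 0 ℤ.+ (a ⊗ tail b) (suc n) ∎
  where open ≡-Reasoning
        open ℤ-Solver.+-*-Solver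

⊗-comm : ∀ a b → a ⊗ b ≈ b ⊗ a
⊗-comm a b zero    = trans (⊗-coeff-0 a b) (trans (ℤ.*-comm (a 0) (b 0)) (sym (⊗-coeff-0 b a)))
⊗-comm a b (suc n) = trans (⊗-coeff-suc a b n) (trans
  (cong₂ ℤ._+_ (ℤ.*-comm (a 0) (b (suc n))) (⊗-comm (tail a) b n))
  (sym (⊗-coeff-sucʳ b a n)))

⊗-distribʳ-⊕ : ∀ c a b → (a ⊕ b) ⊗ c ≈ a ⊗ c ⊕ b ⊗ c
⊗-distribʳ-⊕ c a b zero = begin
  ((a ⊕ b) ⊗ c) 0                    ≡⟨ ⊗-coeff-0 (a ⊕ b) c ⟩
  (a ⊕ b) 0 ℤ.* c 0                  ≡⟨ cong (ℤ._* c 0) (⊕-coeff a b 0) ⟩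
  (a 0 ℤ.+ b 0) ℤ.* c 0              ≡⟨ ℤ.*-distribʳ-+ (c 0) (a 0) (b 0) ⟩
  a 0 ℤ.* c 0 ℤ.+ b 0 ℤ.* c 0        ≡⟨ cong₂ ℤ._+_ (⊗-coeff-0 a c) (⊗-coeff-0 b c) ⟨
  (a ⊗ c) 0 ℤ.+ (b ⊗ c) 0            ≡⟨ ⊕-coeff (a ⊗ c) (b ⊗ c) 0 ⟨
  (a ⊗ c ⊕ b ⊗ c) 0                  ∎
  where open ≡-Reasoning
⊗-distribʳ-⊕ c a b (suc n) = begin
  ((a ⊕ b) ⊗ c) (suc n)
    ≡⟨ ⊗-coeff-suc (a ⊕ b) c n ⟩
  (a ⊕ b) 0 ℤ.* c (suc n) ℤ.+ (tail (a ⊕ b) ⊗ c) n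
    ≡⟨ cong₂ (λ x y → x ℤ.* c (suc n) ℤ.+ y) (⊕-coeff a b 0)
         (trans (⊗-cong {b = c} (tail-⊕ a b) (λ _ → refl) n)
           (trans (⊗-distribʳ-⊕ c (tail a) (tail b) n) (⊕-coeff (tail a ⊗ c) (tail b ⊗ c) n))) ⟩
  (a 0 ℤ.+ b 0) ℤ.* c (suc n) ℤ.+ ((tail a ⊗ c) n ℤ.+ (tail b ⊗ c) n)
    ≡⟨ solve 5 (λ x y z u v → (x :+ y) :* z :+ (u :+ v) := (x :* z :+ u) :+ (y :* z :+ v)) refl
         (a 0) (b 0) (c (suc n)) _ _ ⟩
  (a 0 ℤ.* c (suc n) ℤ.+ (tail a ⊗ c) n) ℤ.+ (b 0 ℤ.* c (suc n) ℤ.+ (tail b ⊗ c) n)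
    ≡⟨ cong₂ ℤ._+_ (⊗-coeff-suc a c n) (⊗-coeff-suc b c n) ⟨
  (a ⊗ c) (suc n) ℤ.+ (b ⊗ c) (suc n)
    ≡⟨ ⊕-coeff (a ⊗ c) (b ⊗ c) (suc n) ⟨
  (a ⊗ c ⊕ b ⊗ c) (suc n) ∎
  where open ≡-Reasoning
        open ℤ-Solver.+-*-Solver

-- The scalar case of associativity, proved beforehand because `tail-⊗` produces a scalar multiple
-- in the induction for the general case.
constant-⊗-assoc : ∀ z a b n → ((constant z ⊗ a) ⊗ b) n ≡ z ℤ.* (a ⊗ b) n
constant-⊗-assoc z a b zero = begin
  ((constant z ⊗ a) ⊗ b) 0    ≡⟨ ⊗-coeff-0 _ b ⟩
  (constant z ⊗ a) 0 ℤ.* b 0  ≡⟨ cong (ℤ._* b 0) (constant-⊗ z a 0) ⟩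
  z ℤ.* a 0 ℤ.* b 0           ≡⟨ ℤ.*-assoc z (a 0) (b 0) ⟩
  z ℤ.* (a 0 ℤ.* b 0)         ≡⟨ cong (z ℤ.*_) (⊗-coeff-0 a b) ⟨
  z ℤ.* (a ⊗ b) 0             ∎
  where open ≡-Reasoning
constant-⊗-assoc z a b (suc n) = begin
  ((constant z ⊗ a) ⊗ b) (suc n)
    ≡⟨ ⊗-coeff-suc _ b n ⟩
  (constant z ⊗ a) 0 ℤ.* b (suc n) ℤ.+ (tail (constant z ⊗ a) ⊗ b) n
    ≡⟨ cong₂ (λ x y → x ℤ.* b (suc n) ℤ.+ y) (constant-⊗ z a 0)
         (trans (⊗-cong {b = b} tail-constant-⊗ (λ _ → refl) n) (constant-⊗-assoc z (tail a) b n)) ⟩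
  z ℤ.* a 0 ℤ.* b (suc n) ℤ.+ z ℤ.* (tail a ⊗ b) n
    ≡⟨ solve 4 (λ x y w u → x :* y :* w :+ x :* u := x :* (y :* w :+ u)) refl z (a 0) (b (suc n)) _ ⟩
  z ℤ.* (a 0 ℤ.* b (suc n) ℤ.+ (tail a ⊗ b) n)
    ≡⟨ cong (z ℤ.*_) (⊗-coeff-suc a b n) ⟨
  z ℤ.* (a ⊗ b) (suc n) ∎
  where
  open ≡-Reasoning
  open ℤ-Solver.+-*-Solver
  tail-constant-⊗ : tail (constant z ⊗ a) ≈ constant z ⊗ tail a
  tail-constant-⊗ n = trans (constant-⊗ z a (suc n)) (sym (constant-⊗ z (tail a) n))

-- A Leibniz rule: `tail` is a ↦ (a - a(0))/q, a derivation twisted by evaluation at q = 0.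
tail-⊗ : ∀ a b → tail (a ⊗ b) ≈ constant (a 0) ⊗ tail b ⊕ tail a ⊗ b
tail-⊗ a b n = begin
  (a ⊗ b) (suc n)
    ≡⟨ ⊗-coeff-suc a b n ⟩
  a 0 ℤ.* b (suc n) ℤ.+ (tail a ⊗ b) n
    ≡⟨ cong (λ u → u ℤ.+ (tail a ⊗ b) n) (constant-⊗ (a 0) (tail b) n) ⟨
  (constant (a 0) ⊗ tail b) n ℤ.+ (tail a ⊗ b) n
    ≡⟨ ⊕-coeff (constant (a 0) ⊗ tail b) (tail a ⊗ b) n ⟨
  (constant (a 0) ⊗ tail b ⊕ tail a ⊗ b) n ∎
  where open ≡-Reasoning

⊗-assoc : ∀ a b c → (a ⊗ b) ⊗ c ≈ a ⊗ (b ⊗ c)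
⊗-assoc a b c zero = begin
  ((a ⊗ b) ⊗ c) 0            ≡⟨ ⊗-coeff-0 (a ⊗ b) c ⟩
  (a ⊗ b) 0 ℤ.* c 0          ≡⟨ cong (ℤ._* c 0) (⊗-coeff-0 a b) ⟩
  a 0 ℤ.* b 0 ℤ.* c 0        ≡⟨ ℤ.*-assoc (a 0) (b 0) (c 0) ⟩
  a 0 ℤ.* (b 0 ℤ.* c 0)      ≡⟨ cong (a 0 ℤ.*_) (⊗-coeff-0 b c) ⟨
  a 0 ℤ.* (b ⊗ c) 0          ≡⟨ ⊗-coeff-0 a (b ⊗ c) ⟨
  (a ⊗ (b ⊗ c)) 0            ∎
  where open ≡-Reasoning
⊗-assoc a b c (suc n) = begin
  ((a ⊗ b) ⊗ c) (suc n)
    ≡⟨ ⊗-coeff-suc (a ⊗ b) c n ⟩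
  (a ⊗ b) 0 ℤ.* c (suc n) ℤ.+ (tail (a ⊗ b) ⊗ c) n
    ≡⟨ cong₂ (λ x y → x ℤ.* c (suc n) ℤ.+ y) (⊗-coeff-0 a b) tail-part ⟩
  a 0 ℤ.* b 0 ℤ.* c (suc n) ℤ.+ (a 0 ℤ.* (tail b ⊗ c) n ℤ.+ (tail a ⊗ (b ⊗ c)) n)
    ≡⟨ solve 5 (λ x y z u v → x :* y :* z :+ (x :* u :+ v) := x :* (y :* z :+ u) :+ v) refl
         (a 0) (b 0) (c (suc n)) _ _ ⟩
  a 0 ℤ.* (b 0 ℤ.* c (suc n) ℤ.+ (tail b ⊗ c) n) ℤ.+ (tail a ⊗ (b ⊗ c)) n
    ≡⟨ cong (λ x → a 0 ℤ.* x ℤ.+ (tail a ⊗ (b ⊗ c)) n) (⊗-coeff-suc b c n) ⟨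
  a 0 ℤ.* (b ⊗ c) (suc n) ℤ.+ (tail a ⊗ (b ⊗ c)) n
    ≡⟨ ⊗-coeff-suc a (b ⊗ c) n ⟨
  (a ⊗ (b ⊗ c)) (suc n) ∎
  where
  open ≡-Reasoning
  open ℤ-Solver.+-*-Solver
  tail-part : (tail (a ⊗ b) ⊗ c) n ≡ a 0 ℤ.* (tail b ⊗ c) n ℤ.+ (tail a ⊗ (b ⊗ c)) n
  tail-part = begin
    (tail (a ⊗ b) ⊗ c) n
      ≡⟨ ⊗-cong {b = c} (tail-⊗ a b) (λ _ → refl) n ⟩
    ((constant (a 0) ⊗ tail b ⊕ tail a ⊗ b) ⊗ c) n
      ≡⟨ ⊗-distribʳ-⊕ c (constant (a 0) ⊗ tail b) (tail a ⊗ b) n ⟩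
    ((constant (a 0) ⊗ tail b) ⊗ c ⊕ (tail a ⊗ b) ⊗ c) n
      ≡⟨ ⊕-coeff ((constant (a 0) ⊗ tail b) ⊗ c) ((tail a ⊗ b) ⊗ c) n ⟩
    ((constant (a 0) ⊗ tail b) ⊗ c) n ℤ.+ ((tail a ⊗ b) ⊗ c) n
      ≡⟨ cong₂ ℤ._+_ (constant-⊗-assoc (a 0) (tail b) c n) (⊗-assoc (tail a) b c n) ⟩
    a 0 ℤ.* (tail b ⊗ c) n ℤ.+ (tail a ⊗ (b ⊗ c)) n ∎

opaque
  unfolding _⊕_

  ⊕-assoc : ∀ a b c → (a ⊕ b) ⊕ c ≈ a ⊕ (b ⊕ c)
  ⊕-assoc a b c n = ℤ.+-assoc (a n) (b n) (c n)

  ⊕-comm : ∀ a b → a ⊕ b ≈ b ⊕ a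
  ⊕-comm a b n = ℤ.+-comm (a n) (b n)

  ⊕-identityˡ : ∀ a → 0# ⊕ a ≈ a
  ⊕-identityˡ a n = ℤ.+-identityˡ (a n)

  ⊖-inverseˡ : ∀ a → ⊖ a ⊕ a ≈ 0#
  ⊖-inverseˡ a n = ℤ.+-inverseˡ (a n)

  ⊖-cong : ∀ {a b} → a ≈ b → ⊖ a ≈ ⊖ b
  ⊖-cong p n = cong ℤ.-_ (p n)

powerSeriesRing : CommutativeRing 0ℓ 0ℓ
powerSeriesRing = record
  { Carrier = PowerSeries ; _≈_ = _≈_ ; _+_ = _⊕_ ; _*_ = _⊗_ ; -_ = ⊖_ ; 0# = 0# ; 1# = 1#
  ; isCommutativeRing = record
    { isRing = record
      { +-isAbelianGroup = record
        { isGroup = record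
          { isMonoid = record
            { isSemigroup = record
              { isMagma = record
                { isEquivalence = record
                  { refl = λ _ → refl ; sym = λ p n → sym (p n) ; trans = λ p r n → trans (p n) (r n) }
                ; ∙-cong = ⊕-cong }
              ; assoc = ⊕-assoc }
            ; identity = ⊕-identityˡ , λ a n → trans (⊕-comm a 0# n) (⊕-identityˡ a n) }
          ; inverse = ⊖-inverseˡ , λ a n → trans (⊕-comm a (⊖ a) n) (⊖-inverseˡ a n)
          ; ⁻¹-cong = ⊖-cong }
        ; comm = ⊕-comm }
      ; *-cong = ⊗-cong
      ; *-assoc = ⊗-assoc
      ; *-identity = ⊗-identityˡ , λ a n → trans (⊗-comm a 1# n) (⊗-identityˡ a n)
      ; distrib = (λ a b c n → trans (⊗-comm a (b ⊕ c) n)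
                    (trans (⊗-distribʳ-⊕ a b c n) (⊕-cong (⊗-comm b a) (⊗-comm c a) n)))
                , ⊗-distribʳ-⊕ }
    ; *-comm = ⊗-comm } }

open CommutativeRing powerSeriesRing using ()
  renaming (setoid to ≈-setoid; refl to ≈-refl; sym to ≈-sym; trans to ≈-trans)
module ≈-Reasoning = SetoidReasoning ≈-setoid

-- With ℤ as coefficient ring the solver computes with numerals such as 2, 4, 5. This is why
-- `constant 0ℤ` and `constant 1ℤ` take the place of `0#` and `1#` from here on.
constant-homomorphism : ℤ.+-*-rawRing -Raw-AlmostCommutative⟶ fromCommutativeRing powerSeriesRing
constant-homomorphism = record
  { ⟦_⟧    = constant
  ; +-homo = λ x y → λ { zero → sym (⊕-coeff (constant x) (constant y) 0)
                       ; (suc n) → sym (⊕-coeff (constant x) (constant y) (suc n)) }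
  ; *-homo = λ x y → λ { zero → sym (⊗-coeff-0 (constant x) (constant y))
                       ; (suc n) → sym (trans (constant-⊗ x (constant y) (suc n)) (ℤ.*-zeroʳ x)) }
  ; -‿homo = λ x → λ { zero → sym (⊖-coeff (constant x) 0)
                     ; (suc n) → sym (⊖-coeff (constant x) (suc n)) }
  ; 0-homo = λ { zero → refl ; (suc n) → refl }
  ; 1-homo = ≈-sym 1#≈constant }

constant-≟ : ∀ x y → Maybe (constant x ≈ constant y)
constant-≟ x y with x ℤ.≟ y
... | yes refl = just ≈-refl
... | no _     = nothing

open ℤ-Solver.+-*-Solver using ()
  renaming (Polynomial to ℤPolynomial; solve to ℤsolve; _:=_ to _:=ᶻ_; _:+_ to _:+ᶻ_; _:*_ to _:*ᶻ_; :-_ to -ᶻ_; con to conᶻ)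
open RingSolver ℤ.+-*-rawRing (fromCommutativeRing powerSeriesRing) constant-homomorphism constant-≟
  using (solve; _:=_; _:+_; _:*_; :-_; con)

q-⊗-suc : ∀ a n → (q ⊗ a) (suc n) ≡ a n
q-⊗-suc a n = trans (⊗-coeff-suc q a n) (trans (ℤ.+-identityˡ _) (⊗-identityˡ a n))

q-cancelˡ : ∀ {a b} → q ⊗ a ≈ q ⊗ b → a ≈ b
q-cancelˡ {a} {b} p n = trans (sym (q-⊗-suc a n)) (trans (p (suc n)) (q-⊗-suc b n))

0#≈constant : 0# ≈ constant 0ℤ
0#≈constant zero    = refl
0#≈constant (suc n) = refl

-- The hypotheses g are the sections 0, 1, 3, 4 of φ f₂ = f₁² divided by - β,
-- where x = - α/β and y = A/B; section 2 gives A C = - B² and α γ = - β², so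
-- that x⁻¹ = γ/β and y⁻¹ = - C/B.  The e are the sections of φ H = f₂, again
-- divided by - β.
module Quintisection
  {a b c x x⁻¹ y y⁻¹ : PowerSeries}
  (x-inverse : x ⊗ x⁻¹ ≈ constant 1ℤ)
  (y-inverse : y ⊗ y⁻¹ ≈ constant 1ℤ)
  (g₀ : a ⊗ x ⊕ ⊖ (q ⊗ b ⊗ x⁻¹) ≈ a ⊗ y ⊗ y)
  (g₁ : b ⊗ x ⊕ ⊖ (q ⊗ c) ≈ constant (+ 2) ⊗ a ⊗ y)
  (g₃ : b ⊕ q ⊗ c ⊗ x⁻¹ ≈ constant (+ 2) ⊗ a ⊗ y⁻¹)
  (g₄ : c ⊗ x ⊕ ⊖ (a ⊗ x⁻¹) ≈ a ⊗ y⁻¹ ⊗ y⁻¹)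
  where

  open ≈-Reasoning

  private
    -- The scaling by powers of `x` is chosen so that U² V′ = q b⁵, U′² V = q⁴ c⁵ and V V′ = t: the
    -- norm of φ becomes a polynomial in these quantities and a.
    t V V′ U U′ d : PowerSeries
    t  = q ⊗ b ⊗ c
    V  = c ⊗ x ⊗ x
    V′ = q ⊗ b ⊗ x⁻¹ ⊗ x⁻¹
    U  = b ⊗ b ⊗ x
    U′ = q ⊗ q ⊗ c ⊗ c ⊗ x⁻¹
    d  = V ⊕ V′ ⊕ ⊖ (constant (+ 2) ⊗ a)

  V⊗V′ : V ⊗ V′ ≈ t
  V⊗V′ = begin
    V ⊗ V′
      ≈⟨ solve 5 (λ Q b c x z → c :* x :* x :* (Q :* b :* z :* z) := Q :* b :* c :* (x :* z) :* (x :* z)) ≈-refl q b c x x⁻¹ ⟩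
    t ⊗ (x ⊗ x⁻¹) ⊗ (x ⊗ x⁻¹)
      ≈⟨ ⊗-cong (⊗-cong (≈-refl {t}) x-inverse) x-inverse ⟩
    t ⊗ constant 1ℤ ⊗ constant 1ℤ
      ≈⟨ solve 1 (λ t → t :* con 1ℤ :* con 1ℤ := t) ≈-refl t ⟩
    t ∎

  -- Multiply `g₀` by `g₄`: on the right y cancels and a² remains, on the left stands a (V + V′) -
  -- a² - t.
  a⊗d : a ⊗ d ≈ t
  a⊗d = begin
    a ⊗ d
      ≈⟨ solve 6 (λ Q a b c x z →
           a :* (c :* x :* x :+ Q :* b :* z :* z :+ :- (con (+ 2) :* a)) :=
           (a :* x :+ :- (Q :* b :* z)) :* (c :* x :+ :- (a :* z)) :+ (a :* a :+ Q :* b :* c) :* (x :* z) :+ :- (con (+ 2) :* a :* a))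
           ≈-refl q a b c x x⁻¹ ⟩
    (a ⊗ x ⊕ ⊖ (q ⊗ b ⊗ x⁻¹)) ⊗ (c ⊗ x ⊕ ⊖ (a ⊗ x⁻¹)) ⊕ (a ⊗ a ⊕ t) ⊗ (x ⊗ x⁻¹) ⊕ ⊖ (constant (+ 2) ⊗ a ⊗ a)
      ≈⟨ ⊕-cong (⊕-cong (⊗-cong g₀ g₄) (⊗-cong (≈-refl {a ⊗ a ⊕ t}) x-inverse)) ≈-refl ⟩
    (a ⊗ y ⊗ y) ⊗ (a ⊗ y⁻¹ ⊗ y⁻¹) ⊕ (a ⊗ a ⊕ t) ⊗ constant 1ℤ ⊕ ⊖ (constant (+ 2) ⊗ a ⊗ a)
      ≈⟨ solve 4 (λ a t y w →
           (a :* y :* y) :* (a :* w :* w) :+ (a :* a :+ t) :* con 1ℤ :+ :- (con (+ 2) :* a :* a) :=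
           a :* a :* (y :* w) :* (y :* w) :+ t :+ :- (a :* a)) ≈-refl a t y y⁻¹ ⟩
    a ⊗ a ⊗ (y ⊗ y⁻¹) ⊗ (y ⊗ y⁻¹) ⊕ t ⊕ ⊖ (a ⊗ a)
      ≈⟨ ⊕-cong (⊕-cong (⊗-cong (⊗-cong (≈-refl {a ⊗ a}) y-inverse) y-inverse) ≈-refl) ≈-refl ⟩
    a ⊗ a ⊗ constant 1ℤ ⊗ constant 1ℤ ⊕ t ⊕ ⊖ (a ⊗ a)
      ≈⟨ solve 2 (λ a t → a :* a :* con 1ℤ :* con 1ℤ :+ t :+ :- (a :* a) := t) ≈-refl a t ⟩
    t ∎

  -- Multiplying `2ac` by x² gives 2aV = U + t, and t is then replaced by a d.
  U-linear : U ≈ constant (+ 2) ⊗ a ⊗ a ⊕ a ⊗ (V ⊕ ⊖ V′)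
  U-linear = begin
    U
      -- The solver knows no relation between `x` and `x⁻¹`. A factor 1 is therefore inserted and
      -- exchanged for x x⁻¹ wherever the two have to cancel.
      ≈⟨ solve 3 (λ b c x → b :* b :* x := b :* b :* con 1ℤ :* x) ≈-refl b c x ⟩
    b ⊗ b ⊗ constant 1ℤ ⊗ x
      ≈⟨ ⊗-cong (⊗-cong (≈-refl {b ⊗ b}) (≈-sym x-inverse)) ≈-refl ⟩
    b ⊗ b ⊗ (x ⊗ x⁻¹) ⊗ x
      ≈⟨ solve 5 (λ Q b c x z →
           b :* b :* (x :* z) :* x :=
           x :* x :* (b :* b :* z :+ Q :* b :* c :* z :* z) :+ :- (Q :* b :* c :* (x :* z) :* (x :* z))) ≈-refl q b c x x⁻¹ ⟩
    x ⊗ x ⊗ (b ⊗ b ⊗ x⁻¹ ⊕ q ⊗ b ⊗ c ⊗ x⁻¹ ⊗ x⁻¹) ⊕ ⊖ (q ⊗ b ⊗ c ⊗ (x ⊗ x⁻¹) ⊗ (x ⊗ x⁻¹))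
      ≈⟨ ⊕-cong (⊗-cong (≈-refl {x ⊗ x}) (≈-sym 2ac)) (⊖-cong (⊗-cong (⊗-cong (≈-refl {t}) x-inverse) x-inverse)) ⟩
    x ⊗ x ⊗ (constant (+ 2) ⊗ a ⊗ c) ⊕ ⊖ (t ⊗ constant 1ℤ ⊗ constant 1ℤ)
      ≈⟨ solve 4 (λ a c t x →
           x :* x :* (con (+ 2) :* a :* c) :+ :- (t :* con 1ℤ :* con 1ℤ) := con (+ 2) :* a :* (c :* x :* x) :+ :- t) ≈-refl a c t x ⟩
    constant (+ 2) ⊗ a ⊗ V ⊕ ⊖ t
      ≈⟨ ⊕-cong ≈-refl (⊖-cong (≈-sym a⊗d)) ⟩
    constant (+ 2) ⊗ a ⊗ V ⊕ ⊖ (a ⊗ d)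
      ≈⟨ solve 3 (λ a v w →
           con (+ 2) :* a :* v :+ :- (a :* (v :+ w :+ :- (con (+ 2) :* a))) :=
           con (+ 2) :* a :* a :+ a :* (v :+ :- w)) ≈-refl a V V′ ⟩
    constant (+ 2) ⊗ a ⊗ a ⊕ a ⊗ (V ⊕ ⊖ V′) ∎
    where
    -- The product of `g₀` and `g₃` and the product of a and `g₁` both equal 2a²y. Comparing the
    -- left sides eliminates y and leaves an equation divisible by q.
    2ac : constant (+ 2) ⊗ a ⊗ c ≈ b ⊗ b ⊗ x⁻¹ ⊕ q ⊗ b ⊗ c ⊗ x⁻¹ ⊗ x⁻¹
    2ac = q-cancelˡ $ begin
      q ⊗ (constant (+ 2) ⊗ a ⊗ c)
        ≈⟨ solve 6 (λ Q a b c x z →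
             Q :* (con (+ 2) :* a :* c) :=
             (a :* x :+ :- (Q :* b :* z)) :* (b :+ Q :* c :* z) :+ :- (a :* (b :* x :+ :- (Q :* c)))
               :+ a :* Q :* c :* (con 1ℤ :+ :- (x :* z)) :+ Q :* (b :* b :* z :+ Q :* b :* c :* z :* z)) ≈-refl q a b c x x⁻¹ ⟩
      (a ⊗ x ⊕ ⊖ (q ⊗ b ⊗ x⁻¹)) ⊗ (b ⊕ q ⊗ c ⊗ x⁻¹) ⊕ ⊖ (a ⊗ (b ⊗ x ⊕ ⊖ (q ⊗ c)))
        ⊕ a ⊗ q ⊗ c ⊗ (constant 1ℤ ⊕ ⊖ (x ⊗ x⁻¹)) ⊕ q ⊗ (b ⊗ b ⊗ x⁻¹ ⊕ q ⊗ b ⊗ c ⊗ x⁻¹ ⊗ x⁻¹)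
        ≈⟨ ⊕-cong (⊕-cong (⊕-cong (⊗-cong g₀ g₃) (⊖-cong (⊗-cong (≈-refl {a}) g₁)))
             (⊗-cong (≈-refl {a ⊗ q ⊗ c}) (⊕-cong (≈-refl {constant 1ℤ}) (⊖-cong x-inverse)))) ≈-refl ⟩
      (a ⊗ y ⊗ y) ⊗ (constant (+ 2) ⊗ a ⊗ y⁻¹) ⊕ ⊖ (a ⊗ (constant (+ 2) ⊗ a ⊗ y))
        ⊕ a ⊗ q ⊗ c ⊗ (constant 1ℤ ⊕ ⊖ constant 1ℤ) ⊕ q ⊗ (b ⊗ b ⊗ x⁻¹ ⊕ q ⊗ b ⊗ c ⊗ x⁻¹ ⊗ x⁻¹)
        ≈⟨ solve 6 (λ Q a c y w z →
             (a :* y :* y) :* (con (+ 2) :* a :* w) :+ :- (a :* (con (+ 2) :* a :* y))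
               :+ a :* Q :* c :* (con 1ℤ :+ :- con 1ℤ) :+ z :=
             con (+ 2) :* a :* a :* y :* (y :* w :+ :- con 1ℤ) :+ z) ≈-refl
             q a c y y⁻¹ (q ⊗ (b ⊗ b ⊗ x⁻¹ ⊕ q ⊗ b ⊗ c ⊗ x⁻¹ ⊗ x⁻¹)) ⟩
      constant (+ 2) ⊗ a ⊗ a ⊗ y ⊗ (y ⊗ y⁻¹ ⊕ ⊖ constant 1ℤ) ⊕ q ⊗ (b ⊗ b ⊗ x⁻¹ ⊕ q ⊗ b ⊗ c ⊗ x⁻¹ ⊗ x⁻¹)
        ≈⟨ ⊕-cong (⊗-cong (≈-refl {constant (+ 2) ⊗ a ⊗ a ⊗ y}) (⊕-cong y-inverse (≈-refl {⊖ constant 1ℤ}))) ≈-refl ⟩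
      constant (+ 2) ⊗ a ⊗ a ⊗ y ⊗ (constant 1ℤ ⊕ ⊖ constant 1ℤ) ⊕ q ⊗ (b ⊗ b ⊗ x⁻¹ ⊕ q ⊗ b ⊗ c ⊗ x⁻¹ ⊗ x⁻¹)
        ≈⟨ solve 3 (λ a y z → con (+ 2) :* a :* a :* y :* (con 1ℤ :+ :- con 1ℤ) :+ z := z) ≈-refl a y _ ⟩
      q ⊗ (b ⊗ b ⊗ x⁻¹ ⊕ q ⊗ b ⊗ c ⊗ x⁻¹ ⊗ x⁻¹) ∎

  -- The product of `g₁` and `g₃` is U - U′ = 4a², since y y⁻¹ = 1.
  U′-linear : U′ ≈ a ⊗ (V ⊕ ⊖ V′) ⊕ ⊖ (constant (+ 2) ⊗ a ⊗ a)
  U′-linear = begin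
    U′
      ≈⟨ solve 5 (λ Q b c x z →
           Q :* Q :* c :* c :* z :=
           b :* b :* x :+ :- ((b :* x :+ :- (Q :* c)) :* (b :+ Q :* c :* z)) :+ Q :* b :* c :* (x :* z :+ :- con 1ℤ)) ≈-refl q b c x x⁻¹ ⟩
    U ⊕ ⊖ ((b ⊗ x ⊕ ⊖ (q ⊗ c)) ⊗ (b ⊕ q ⊗ c ⊗ x⁻¹)) ⊕ t ⊗ (x ⊗ x⁻¹ ⊕ ⊖ constant 1ℤ)
      ≈⟨ ⊕-cong (⊕-cong U-linear (⊖-cong (⊗-cong g₁ g₃))) (⊗-cong (≈-refl {t}) (⊕-cong x-inverse (≈-refl {⊖ constant 1ℤ}))) ⟩
    constant (+ 2) ⊗ a ⊗ a ⊕ a ⊗ (V ⊕ ⊖ V′) ⊕ ⊖ ((constant (+ 2) ⊗ a ⊗ y) ⊗ (constant (+ 2) ⊗ a ⊗ y⁻¹)) ⊕ t ⊗ (constant 1ℤ ⊕ ⊖ constant 1ℤ)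
      ≈⟨ solve 5 (λ a s t y w →
           con (+ 2) :* a :* a :+ s :+ :- ((con (+ 2) :* a :* y) :* (con (+ 2) :* a :* w)) :+ t :* (con 1ℤ :+ :- con 1ℤ) :=
           s :+ con (+ 2) :* a :* a :+ :- (con (+ 4) :* a :* a :* (y :* w))) ≈-refl a (a ⊗ (V ⊕ ⊖ V′)) t y y⁻¹ ⟩
    a ⊗ (V ⊕ ⊖ V′) ⊕ constant (+ 2) ⊗ a ⊗ a ⊕ ⊖ (constant (+ 4) ⊗ a ⊗ a ⊗ (y ⊗ y⁻¹))
      ≈⟨ ⊕-cong ≈-refl (⊖-cong (⊗-cong (≈-refl {constant (+ 4) ⊗ a ⊗ a}) y-inverse)) ⟩
    a ⊗ (V ⊕ ⊖ V′) ⊕ constant (+ 2) ⊗ a ⊗ a ⊕ ⊖ (constant (+ 4) ⊗ a ⊗ a ⊗ constant 1ℤ)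
      ≈⟨ solve 2 (λ a s → s :+ con (+ 2) :* a :* a :+ :- (con (+ 4) :* a :* a :* con 1ℤ) := s :+ :- (con (+ 2) :* a :* a)) ≈-refl a (a ⊗ (V ⊕ ⊖ V′)) ⟩
    a ⊗ (V ⊕ ⊖ V′) ⊕ ⊖ (constant (+ 2) ⊗ a ⊗ a) ∎

  private
    N : PowerSeries
    N = a ⊗ a ⊗ a ⊗ a ⊗ a ⊕ U ⊗ U ⊗ V′ ⊕ U′ ⊗ U′ ⊗ V ⊕ ⊖ (constant (+ 5) ⊗ a ⊗ a ⊗ a ⊗ t) ⊕ constant (+ 5) ⊗ a ⊗ t ⊗ t

  -- Eliminating t between `a⊗d` and `V⊗V′` leaves this one relation between V and V′, modulo which
  -- the polynomial identities below hold.
  relation : (V ⊕ ⊖ a) ⊗ (a ⊕ ⊖ V′) ⊕ ⊖ (a ⊗ a) ≈ 0#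
  relation = begin
    (V ⊕ ⊖ a) ⊗ (a ⊕ ⊖ V′) ⊕ ⊖ (a ⊗ a)
      ≈⟨ solve 3 (λ a v w → (v :+ :- a) :* (a :+ :- w) :+ :- (a :* a) := a :* (v :+ w :+ :- (con (+ 2) :* a)) :+ :- (v :* w)) ≈-refl a V V′ ⟩
    a ⊗ d ⊕ ⊖ (V ⊗ V′)
      ≈⟨ ⊕-cong a⊗d (⊖-cong V⊗V′) ⟩
    t ⊕ ⊖ t
      ≈⟨ solve 1 (λ t → t :+ :- t := con 0ℤ) ≈-refl t ⟩
    constant 0ℤ
      ≈⟨ ≈-sym 0#≈constant ⟩
    0# ∎

  -- By N-raw this is the norm a⁵ + qb⁵ + q⁴c⁵ - 5a³t + 5at² of φ.
  N-factors : N ≈ a ⊗ a ⊗ (a ⊕ d) ⊗ (a ⊕ d) ⊗ (a ⊕ d)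
  N-factors = begin
    N
      ≈⟨ ⊕-cong (⊕-cong (⊕-cong (⊕-cong (≈-refl {a ⊗ a ⊗ a ⊗ a ⊗ a})
           (⊗-cong (⊗-cong U-linear U-linear) (≈-refl {V′}))) (⊗-cong (⊗-cong U′-linear U′-linear) (≈-refl {V})))
           (⊖-cong (⊗-cong (≈-refl {constant (+ 5) ⊗ a ⊗ a ⊗ a}) (≈-sym a⊗d))))
           (⊗-cong (⊗-cong (≈-refl {constant (+ 5) ⊗ a}) (≈-sym a⊗d)) (≈-sym a⊗d)) ⟩
    a ⊗ a ⊗ a ⊗ a ⊗ a ⊕ u ⊗ u ⊗ V′ ⊕ u′ ⊗ u′ ⊗ V ⊕ ⊖ (constant (+ 5) ⊗ a ⊗ a ⊗ a ⊗ (a ⊗ d)) ⊕ constant (+ 5) ⊗ a ⊗ (a ⊗ d) ⊗ (a ⊗ d)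
      -- After substitution everything is a polynomial in a, V, V′; 4a²(d - 2a) is the quotient of N
      -- - a²(a + d)³ by the left side of `relation`.
      ≈⟨ solve 3 (λ a v w →
           let s = a :* (v :+ :- w)
               d = v :+ w :+ :- (con (+ 2) :* a)
               u = con (+ 2) :* a :* a :+ s
               u′ = s :+ :- (con (+ 2) :* a :* a)
           in a :* a :* a :* a :* a :+ u :* u :* w :+ u′ :* u′ :* v :+ :- (con (+ 5) :* a :* a :* a :* (a :* d)) :+ con (+ 5) :* a :* (a :* d) :* (a :* d) :=
           a :* a :* (a :+ d) :* (a :+ d) :* (a :+ d)
             :+ con (+ 4) :* a :* a :* (d :+ :- (con (+ 2) :* a)) :* ((v :+ :- a) :* (a :+ :- w) :+ :- (a :* a)))
           ≈-refl a V V′ ⟩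
    a ⊗ a ⊗ (a ⊕ d) ⊗ (a ⊕ d) ⊗ (a ⊕ d)
      ⊕ constant (+ 4) ⊗ a ⊗ a ⊗ (d ⊕ ⊖ (constant (+ 2) ⊗ a)) ⊗ ((V ⊕ ⊖ a) ⊗ (a ⊕ ⊖ V′) ⊕ ⊖ (a ⊗ a))
      ≈⟨ ⊕-cong ≈-refl (⊗-cong (≈-refl {constant (+ 4) ⊗ a ⊗ a ⊗ (d ⊕ ⊖ (constant (+ 2) ⊗ a))}) (≈-trans relation 0#≈constant)) ⟩
    a ⊗ a ⊗ (a ⊕ d) ⊗ (a ⊕ d) ⊗ (a ⊕ d) ⊕ constant (+ 4) ⊗ a ⊗ a ⊗ (d ⊕ ⊖ (constant (+ 2) ⊗ a)) ⊗ constant 0ℤ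
      ≈⟨ solve 2 (λ z w → z :+ w :* con 0ℤ := z) ≈-refl (a ⊗ a ⊗ (a ⊕ d) ⊗ (a ⊕ d) ⊗ (a ⊕ d)) _ ⟩
    a ⊗ a ⊗ (a ⊕ d) ⊗ (a ⊕ d) ⊗ (a ⊕ d) ∎
    where
    u u′ : PowerSeries
    u  = constant (+ 2) ⊗ a ⊗ a ⊕ a ⊗ (V ⊕ ⊖ V′)
    u′ = a ⊗ (V ⊕ ⊖ V′) ⊕ ⊖ (constant (+ 2) ⊗ a ⊗ a)

  a⊗N : a ⊗ N ≈ (a ⊗ a ⊕ t) ⊗ (a ⊗ a ⊕ t) ⊗ (a ⊗ a ⊕ t)
  a⊗N = begin
    a ⊗ N
      ≈⟨ ⊗-cong (≈-refl {a}) N-factors ⟩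
    a ⊗ (a ⊗ a ⊗ (a ⊕ d) ⊗ (a ⊕ d) ⊗ (a ⊕ d))
      ≈⟨ solve 2 (λ a d → a :* (a :* a :* (a :+ d) :* (a :+ d) :* (a :+ d)) :=
           (a :* a :+ a :* d) :* (a :* a :+ a :* d) :* (a :* a :+ a :* d)) ≈-refl a d ⟩
    (a ⊗ a ⊕ a ⊗ d) ⊗ (a ⊗ a ⊕ a ⊗ d) ⊗ (a ⊗ a ⊕ a ⊗ d)
      ≈⟨ ⊗-cong (⊗-cong a²+ad a²+ad) a²+ad ⟩
    (a ⊗ a ⊕ t) ⊗ (a ⊗ a ⊕ t) ⊗ (a ⊗ a ⊕ t) ∎
    where
    a²+ad : a ⊗ a ⊕ a ⊗ d ≈ a ⊗ a ⊕ t
    a²+ad = ⊕-cong ≈-refl a⊗d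

  private
    -- The sections of N/φ.
    κ₀ κ₁ κ₂ κ₃ κ₄ : PowerSeries
    κ₀ = a ⊗ a ⊗ a ⊗ a ⊕ ⊖ (constant (+ 3) ⊗ a ⊗ a ⊗ t) ⊕ t ⊗ t
    κ₁ = ⊖ (a ⊗ a ⊗ a ⊗ b) ⊕ constant (+ 2) ⊗ a ⊗ t ⊗ b ⊕ q ⊗ q ⊗ q ⊗ c ⊗ c ⊗ c ⊗ c
    κ₂ = a ⊗ a ⊗ b ⊗ b ⊕ ⊖ (a ⊗ q ⊗ q ⊗ c ⊗ c ⊗ c) ⊕ ⊖ (t ⊗ b ⊗ b)
    κ₃ = a ⊗ a ⊗ q ⊗ c ⊗ c ⊕ ⊖ (a ⊗ b ⊗ b ⊗ b) ⊕ ⊖ (t ⊗ q ⊗ c ⊗ c)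
    κ₄ = ⊖ (a ⊗ a ⊗ a ⊗ c) ⊕ constant (+ 2) ⊗ a ⊗ t ⊗ c ⊕ b ⊗ b ⊗ b ⊗ b

    N-raw : N ≈ a ⊗ a ⊗ a ⊗ a ⊗ a ⊕ q ⊗ b ⊗ b ⊗ b ⊗ b ⊗ b ⊕ q ⊗ q ⊗ q ⊗ q ⊗ c ⊗ c ⊗ c ⊗ c ⊗ c
              ⊕ ⊖ (constant (+ 5) ⊗ a ⊗ a ⊗ a ⊗ t) ⊕ constant (+ 5) ⊗ a ⊗ t ⊗ t
    N-raw = ⊕-cong (⊕-cong (⊕-cong (⊕-cong ≈-refl
      (begin
        U ⊗ U ⊗ V′
          ≈⟨ solve 4 (λ Q b x z → b :* b :* x :* (b :* b :* x) :* (Q :* b :* z :* z) := Q :* b :* b :* b :* b :* b :* (x :* z) :* (x :* z)) ≈-refl q b x x⁻¹ ⟩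
        q ⊗ b ⊗ b ⊗ b ⊗ b ⊗ b ⊗ (x ⊗ x⁻¹) ⊗ (x ⊗ x⁻¹)
          ≈⟨ ⊗-cong (⊗-cong (≈-refl {q ⊗ b ⊗ b ⊗ b ⊗ b ⊗ b}) x-inverse) x-inverse ⟩
        q ⊗ b ⊗ b ⊗ b ⊗ b ⊗ b ⊗ constant 1ℤ ⊗ constant 1ℤ
          ≈⟨ solve 1 (λ z → z :* con 1ℤ :* con 1ℤ := z) ≈-refl _ ⟩
        q ⊗ b ⊗ b ⊗ b ⊗ b ⊗ b ∎))
      (begin
        U′ ⊗ U′ ⊗ V
          ≈⟨ solve 4 (λ Q c x z → Q :* Q :* c :* c :* z :* (Q :* Q :* c :* c :* z) :* (c :* x :* x) :=
                Q :* Q :* Q :* Q :* c :* c :* c :* c :* c :* (x :* z) :* (x :* z)) ≈-refl q c x x⁻¹ ⟩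
        q ⊗ q ⊗ q ⊗ q ⊗ c ⊗ c ⊗ c ⊗ c ⊗ c ⊗ (x ⊗ x⁻¹) ⊗ (x ⊗ x⁻¹)
          ≈⟨ ⊗-cong (⊗-cong (≈-refl {q ⊗ q ⊗ q ⊗ q ⊗ c ⊗ c ⊗ c ⊗ c ⊗ c}) x-inverse) x-inverse ⟩
        q ⊗ q ⊗ q ⊗ q ⊗ c ⊗ c ⊗ c ⊗ c ⊗ c ⊗ constant 1ℤ ⊗ constant 1ℤ
          ≈⟨ solve 1 (λ z → z :* con 1ℤ :* con 1ℤ := z) ≈-refl _ ⟩
        q ⊗ q ⊗ q ⊗ q ⊗ c ⊗ c ⊗ c ⊗ c ⊗ c ∎))
      ≈-refl) ≈-refl

    -- What Cramer's rule leaves once the right sides x, 0, -1, 0, -x⁻¹ are inserted. By `U-linear`,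
    -- `U′-linear` and t = a d both sides become polynomials in a, V, V′, and they differ by -4a²
    -- times `relation`.
    numerator : κ₂ ⊗ x ⊕ ⊖ κ₀ ⊕ ⊖ (q ⊗ κ₃ ⊗ x⁻¹)
                ≈ (constant (+ 3) ⊗ a ⊗ a ⊕ ⊖ (constant (+ 2) ⊗ t)) ⊗ (a ⊗ a ⊕ t)
    numerator = begin
      κ₂ ⊗ x ⊕ ⊖ κ₀ ⊕ ⊖ (q ⊗ κ₃ ⊗ x⁻¹)
        ≈⟨ solve 6 (λ Q a b c x z →
             let t = Q :* b :* c in
             (a :* a :* b :* b :+ :- (a :* Q :* Q :* c :* c :* c) :+ :- (t :* b :* b)) :* x
               :+ :- (a :* a :* a :* a :+ :- (con (+ 3) :* a :* a :* t) :+ t :* t)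
               :+ :- (Q :* (a :* a :* Q :* c :* c :+ :- (a :* b :* b :* b) :+ :- (t :* Q :* c :* c)) :* z) :=
             a :* a :* (b :* b :* x) :+ :- (t :* (b :* b :* x))
               :+ :- (a :* a :* a :* a :+ :- (con (+ 3) :* a :* a :* t) :+ t :* t)
               :+ :- (a :* a :* (Q :* Q :* c :* c :* z)) :+ t :* (Q :* Q :* c :* c :* z)
               :+ (a :* Q :* b :* b :* b :* z :+ :- (a :* Q :* Q :* c :* c :* c :* x)) :* con 1ℤ)
             ≈-refl q a b c x x⁻¹ ⟩
      a ⊗ a ⊗ U ⊕ ⊖ (t ⊗ U) ⊕ ⊖ κ₀ ⊕ ⊖ (a ⊗ a ⊗ U′) ⊕ t ⊗ U′
        ⊕ (a ⊗ q ⊗ b ⊗ b ⊗ b ⊗ x⁻¹ ⊕ ⊖ (a ⊗ q ⊗ q ⊗ c ⊗ c ⊗ c ⊗ x)) ⊗ constant 1ℤ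
        ≈⟨ ⊕-cong ≈-refl (⊗-cong ≈-refl (≈-sym x-inverse)) ⟩
      a ⊗ a ⊗ U ⊕ ⊖ (t ⊗ U) ⊕ ⊖ κ₀ ⊕ ⊖ (a ⊗ a ⊗ U′) ⊕ t ⊗ U′
        ⊕ (a ⊗ q ⊗ b ⊗ b ⊗ b ⊗ x⁻¹ ⊕ ⊖ (a ⊗ q ⊗ q ⊗ c ⊗ c ⊗ c ⊗ x)) ⊗ (x ⊗ x⁻¹)
        ≈⟨ ⊕-cong ≈-refl
             (solve 6 (λ Q a b c x z →
               (a :* Q :* b :* b :* b :* z :+ :- (a :* Q :* Q :* c :* c :* c :* x)) :* (x :* z) :=
               a :* ((b :* b :* x) :* (Q :* b :* z :* z) :+ :- ((Q :* Q :* c :* c :* z) :* (c :* x :* x))))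
               ≈-refl q a b c x x⁻¹) ⟩
      a ⊗ a ⊗ U ⊕ ⊖ (t ⊗ U) ⊕ ⊖ κ₀ ⊕ ⊖ (a ⊗ a ⊗ U′) ⊕ t ⊗ U′ ⊕ a ⊗ (U ⊗ V′ ⊕ ⊖ (U′ ⊗ V))
        ≈⟨ solve 6 (λ a t u u′ v w →
             a :* a :* u :+ :- (t :* u) :+ :- (a :* a :* a :* a :+ :- (con (+ 3) :* a :* a :* t) :+ t :* t)
               :+ :- (a :* a :* u′) :+ t :* u′ :+ a :* (u :* w :+ :- (u′ :* v)) :=
             (a :* a :+ :- t) :* (u :+ :- u′) :+ :- (a :* a :* a :* a :+ :- (con (+ 3) :* a :* a :* t) :+ t :* t)
               :+ a :* (u :* w :+ :- (u′ :* v))) ≈-refl a t U U′ V V′ ⟩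
      (a ⊗ a ⊕ ⊖ t) ⊗ (U ⊕ ⊖ U′) ⊕ ⊖ κ₀ ⊕ a ⊗ (U ⊗ V′ ⊕ ⊖ (U′ ⊗ V))
        ≈⟨ ⊕-cong (⊕-cong (⊗-cong (⊕-cong (≈-refl {a ⊗ a}) (⊖-cong (≈-sym a⊗d))) (⊕-cong U-linear (⊖-cong U′-linear)))
             (⊖-cong (⊕-cong (⊕-cong ≈-refl (⊖-cong (⊗-cong (≈-refl {constant (+ 3) ⊗ a ⊗ a}) (≈-sym a⊗d)))) (⊗-cong (≈-sym a⊗d) (≈-sym a⊗d)))))
             (⊗-cong (≈-refl {a}) (⊕-cong (⊗-cong U-linear (≈-refl {V′})) (⊖-cong (⊗-cong U′-linear (≈-refl {V}))))) ⟩
      (a ⊗ a ⊕ ⊖ (a ⊗ d)) ⊗ (u ⊕ ⊖ u′) ⊕ ⊖ (a ⊗ a ⊗ a ⊗ a ⊕ ⊖ (constant (+ 3) ⊗ a ⊗ a ⊗ (a ⊗ d)) ⊕ (a ⊗ d) ⊗ (a ⊗ d))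
        ⊕ a ⊗ (u ⊗ V′ ⊕ ⊖ (u′ ⊗ V))
        ≈⟨ solve 3 (λ a v w →
             let s = a :* (v :+ :- w)
                 d = v :+ w :+ :- (con (+ 2) :* a)
                 u = con (+ 2) :* a :* a :+ s
                 u′ = s :+ :- (con (+ 2) :* a :* a)
             in (a :* a :+ :- (a :* d)) :* (u :+ :- u′)
                  :+ :- (a :* a :* a :* a :+ :- (con (+ 3) :* a :* a :* (a :* d)) :+ (a :* d) :* (a :* d))
                  :+ a :* (u :* w :+ :- (u′ :* v)) :=
             (con (+ 3) :* a :* a :+ :- (con (+ 2) :* (a :* d))) :* (a :* a :+ a :* d)
               :+ :- (con (+ 4) :* a :* a :* ((v :+ :- a) :* (a :+ :- w) :+ :- (a :* a)))) ≈-refl a V V′ ⟩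
      (constant (+ 3) ⊗ a ⊗ a ⊕ ⊖ (constant (+ 2) ⊗ (a ⊗ d))) ⊗ (a ⊗ a ⊕ a ⊗ d)
        ⊕ ⊖ (constant (+ 4) ⊗ a ⊗ a ⊗ ((V ⊕ ⊖ a) ⊗ (a ⊕ ⊖ V′) ⊕ ⊖ (a ⊗ a)))
        ≈⟨ ⊕-cong (⊗-cong (⊕-cong (≈-refl {constant (+ 3) ⊗ a ⊗ a}) (⊖-cong (⊗-cong (≈-refl {constant (+ 2)}) a⊗d)))
             (⊕-cong (≈-refl {a ⊗ a}) a⊗d))
             (⊖-cong (⊗-cong (≈-refl {constant (+ 4) ⊗ a ⊗ a}) (≈-trans relation 0#≈constant))) ⟩
      (constant (+ 3) ⊗ a ⊗ a ⊕ ⊖ (constant (+ 2) ⊗ t)) ⊗ (a ⊗ a ⊕ t) ⊕ ⊖ (constant (+ 4) ⊗ a ⊗ a ⊗ constant 0ℤ)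
        ≈⟨ solve 2 (λ z w → z :+ :- (w :* con 0ℤ) := z) ≈-refl _ _ ⟩
      (constant (+ 3) ⊗ a ⊗ a ⊕ ⊖ (constant (+ 2) ⊗ t)) ⊗ (a ⊗ a ⊕ t) ∎
      where
      u u′ : PowerSeries
      u  = constant (+ 2) ⊗ a ⊗ a ⊕ a ⊗ (V ⊕ ⊖ V′)
      u′ = a ⊗ (V ⊕ ⊖ V′) ⊕ ⊖ (constant (+ 2) ⊗ a ⊗ a)

  module _ {h₀ h₁ h₂ h₃ h₄ : PowerSeries}
    (e₀ : a ⊗ h₀ ⊕ q ⊗ b ⊗ h₄ ⊕ q ⊗ c ⊗ h₁ ≈ x)
    (e₁ : a ⊗ h₁ ⊕ b ⊗ h₀ ⊕ q ⊗ c ⊗ h₂ ≈ constant 0ℤ)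
    (e₂ : a ⊗ h₂ ⊕ b ⊗ h₁ ⊕ q ⊗ c ⊗ h₃ ≈ ⊖ constant 1ℤ)
    (e₃ : a ⊗ h₃ ⊕ b ⊗ h₂ ⊕ q ⊗ c ⊗ h₄ ≈ constant 0ℤ)
    (e₄ : a ⊗ h₄ ⊕ b ⊗ h₃ ⊕ c ⊗ h₀ ≈ ⊖ x⁻¹)
    where

    N⊗h₂ : N ⊗ h₂ ≈ (constant (+ 3) ⊗ a ⊗ a ⊕ ⊖ (constant (+ 2) ⊗ t)) ⊗ (a ⊗ a ⊕ t)
    N⊗h₂ = begin
      N ⊗ h₂
        ≈⟨ ⊗-cong N-raw ≈-refl ⟩
      _
        ≈⟨ solve 9 (λ Q a b c h₀ h₁ h₂ h₃ h₄ →
             let t = Q :* b :* c in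
             (a :* a :* a :* a :* a :+ Q :* b :* b :* b :* b :* b :+ Q :* Q :* Q :* Q :* c :* c :* c :* c :* c
               :+ :- (con (+ 5) :* a :* a :* a :* t) :+ con (+ 5) :* a :* t :* t) :* h₂ :=
             (a :* a :* b :* b :+ :- (a :* Q :* Q :* c :* c :* c) :+ :- (t :* b :* b)) :* (a :* h₀ :+ Q :* b :* h₄ :+ Q :* c :* h₁)
             :+ (:- (a :* a :* a :* b) :+ con (+ 2) :* a :* t :* b :+ Q :* Q :* Q :* c :* c :* c :* c) :* (a :* h₁ :+ b :* h₀ :+ Q :* c :* h₂)
             :+ (a :* a :* a :* a :+ :- (con (+ 3) :* a :* a :* t) :+ t :* t) :* (a :* h₂ :+ b :* h₁ :+ Q :* c :* h₃)
             :+ Q :* (:- (a :* a :* a :* c) :+ con (+ 2) :* a :* t :* c :+ b :* b :* b :* b) :* (a :* h₃ :+ b :* h₂ :+ Q :* c :* h₄)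
             :+ Q :* (a :* a :* Q :* c :* c :+ :- (a :* b :* b :* b) :+ :- (t :* Q :* c :* c)) :* (a :* h₄ :+ b :* h₃ :+ c :* h₀))
             ≈-refl q a b c h₀ h₁ h₂ h₃ h₄ ⟩
      κ₂ ⊗ _ ⊕ κ₁ ⊗ _ ⊕ κ₀ ⊗ _ ⊕ q ⊗ κ₄ ⊗ _ ⊕ q ⊗ κ₃ ⊗ _
        ≈⟨ ⊕-cong (⊕-cong (⊕-cong (⊕-cong (⊗-cong (≈-refl {κ₂}) e₀) (⊗-cong (≈-refl {κ₁}) e₁)) (⊗-cong (≈-refl {κ₀}) e₂))
             (⊗-cong (≈-refl {q ⊗ κ₄}) e₃)) (⊗-cong (≈-refl {q ⊗ κ₃}) e₄) ⟩
      κ₂ ⊗ x ⊕ κ₁ ⊗ constant 0ℤ ⊕ κ₀ ⊗ ⊖ constant 1ℤ ⊕ q ⊗ κ₄ ⊗ constant 0ℤ ⊕ q ⊗ κ₃ ⊗ ⊖ x⁻¹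
        ≈⟨ solve 8 (λ k₀ k₁ k₂ k₃ k₄ Q x z →
             k₂ :* x :+ k₁ :* con 0ℤ :+ k₀ :* (:- con 1ℤ) :+ Q :* k₄ :* con 0ℤ :+ Q :* k₃ :* (:- z) :=
             k₂ :* x :+ :- k₀ :+ :- (Q :* k₃ :* z)) ≈-refl κ₀ κ₁ κ₂ κ₃ κ₄ q x x⁻¹ ⟩
      κ₂ ⊗ x ⊕ ⊖ κ₀ ⊕ ⊖ (q ⊗ κ₃ ⊗ x⁻¹)
        ≈⟨ numerator ⟩
      (constant (+ 3) ⊗ a ⊗ a ⊕ ⊖ (constant (+ 2) ⊗ t)) ⊗ (a ⊗ a ⊕ t) ∎

    -- The norm enters through a N = (a² + t)³, so that nothing is divided by a; one factor a² + t
    -- is then cancelled by its inverse u.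
    middle-section : ∀ {u} → u ⊗ (a ⊗ a ⊕ t) ≈ constant 1ℤ →
      (a ⊗ a ⊕ t) ⊗ (a ⊗ a ⊕ t) ⊗ h₂ ≈ a ⊗ (constant (+ 3) ⊗ a ⊗ a ⊕ ⊖ (constant (+ 2) ⊗ t))
    middle-section {u} u-inverse = begin
      (a ⊗ a ⊕ t) ⊗ (a ⊗ a ⊕ t) ⊗ h₂
        ≈⟨ solve 2 (λ s h → s :* s :* h := con 1ℤ :* (s :* s :* h)) ≈-refl (a ⊗ a ⊕ t) h₂ ⟩
      constant 1ℤ ⊗ ((a ⊗ a ⊕ t) ⊗ (a ⊗ a ⊕ t) ⊗ h₂)
        ≈⟨ ⊗-cong (≈-sym u-inverse) ≈-refl ⟩
      u ⊗ (a ⊗ a ⊕ t) ⊗ ((a ⊗ a ⊕ t) ⊗ (a ⊗ a ⊕ t) ⊗ h₂)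
        ≈⟨ solve 3 (λ u s h → u :* s :* (s :* s :* h) := u :* (s :* s :* s :* h)) ≈-refl u (a ⊗ a ⊕ t) h₂ ⟩
      u ⊗ ((a ⊗ a ⊕ t) ⊗ (a ⊗ a ⊕ t) ⊗ (a ⊗ a ⊕ t) ⊗ h₂)
        ≈⟨ ⊗-cong (≈-refl {u}) (⊗-cong (≈-sym a⊗N) ≈-refl) ⟩
      u ⊗ (a ⊗ N ⊗ h₂)
        ≈⟨ solve 4 (λ u a n h → u :* (a :* n :* h) := u :* a :* (n :* h)) ≈-refl u a N h₂ ⟩
      u ⊗ a ⊗ (N ⊗ h₂)
        ≈⟨ ⊗-cong (≈-refl {u ⊗ a}) N⊗h₂ ⟩
      u ⊗ a ⊗ (w ⊗ (a ⊗ a ⊕ t))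
        ≈⟨ solve 4 (λ u a w s → u :* a :* (w :* s) := u :* s :* (a :* w)) ≈-refl u a w (a ⊗ a ⊕ t) ⟩
      u ⊗ (a ⊗ a ⊕ t) ⊗ (a ⊗ w)
        ≈⟨ ⊗-cong u-inverse ≈-refl ⟩
      constant 1ℤ ⊗ (a ⊗ w)
        ≈⟨ solve 1 (λ z → con 1ℤ :* z := z) ≈-refl _ ⟩
      a ⊗ w ∎
      where
      w : PowerSeries
      w = constant (+ 3) ⊗ a ⊗ a ⊕ ⊖ (constant (+ 2) ⊗ t)

-- Dilation q ↦ q^k and 5-dissection

q^-⊗-below : ∀ m a {n} → n < m → (q^ m ⊗ a) n ≡ 0ℤ
q^-⊗-below (suc m) a {zero}  _         = ⊗-coeff-0 (q^ suc m) a
q^-⊗-below (suc m) a {suc n} (s≤s n<m) =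
  trans (⊗-coeff-suc (q^ suc m) a n) (trans (ℤ.+-identityˡ _) (q^-⊗-below m a n<m))

q^-⊗-above : ∀ m a n → (q^ m ⊗ a) (m ℕ.+ n) ≡ a n
q^-⊗-above zero    a n = ⊗-identityˡ a n
q^-⊗-above (suc m) a n =
  trans (⊗-coeff-suc (q^ suc m) a (m ℕ.+ n)) (trans (ℤ.+-identityˡ _) (q^-⊗-above m a n))

q^-+ : ∀ m n → q^ m ⊗ q^ n ≈ q^ (m ℕ.+ n)
q^-+ zero    n k       = ⊗-identityˡ (q^ n) k
q^-+ (suc m) n zero    = ⊗-coeff-0 (q^ suc m) (q^ n)
q^-+ (suc m) n (suc k) = trans (⊗-coeff-suc (q^ suc m) (q^ n) k) (trans (ℤ.+-identityˡ _) (q^-+ m n k))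

step-induction : ∀ k .{{_ : NonZero k}} (P : ℕ → Set) → (∀ {n} → n < k → P n) → (∀ n → P n → P (k ℕ.+ n)) → ∀ n → P n
step-induction k P base step = <-rec P $ λ n rec → go rec (n ℕ.<? k)
  where
  go : ∀ {n} → (∀ {m} → m < n → P m) → Dec (n < k) → P n
  go {n} rec (yes n<k) = base n<k
  go {n} rec (no  n≮k) = subst P (ℕ.m+[n∸m]≡n k≤n)
    (step (n ℕ.∸ k) (rec (ℕ.∸-monoʳ-< {n} {k} {0} (ℕ.>-nonZero⁻¹ k) k≤n)))
    where k≤n = ℕ.≮⇒≥ n≮k

-- Taking the residue as an argument lets facts about `dilate` follow by rewriting the remainder and
-- the quotient separately.
head-or-0 : ℕ → ℤ → ℤ
head-or-0 zero    z = z
head-or-0 (suc _) z = 0ℤ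

-- The series a(q^k).
dilate : (k : ℕ) → .{{NonZero k}} → PowerSeries → PowerSeries
dilate k a n = head-or-0 (n ℕ.% k) (a (n ℕ./ k))

module _ (k : ℕ) .{{_ : NonZero k}} where

  dilate-multiple : ∀ a n → dilate k a (n ℕ.* k) ≡ a n
  dilate-multiple a n = cong₂ head-or-0 (m*n%n≡0 n k) (cong a (m*n/n≡m n k))

  dilate-0 : ∀ a → dilate k a 0 ≡ a 0
  dilate-0 a = dilate-multiple a 0

  dilate-below : ∀ a {n} → suc n < k → dilate k a (suc n) ≡ 0ℤ
  dilate-below a {n} n<k = cong (λ r → head-or-0 r (a (suc n ℕ./ k))) (m<n⇒m%n≡m n<k)

  dilate-above : ∀ a n → dilate k a (k ℕ.+ n) ≡ dilate k (tail a) n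
  dilate-above a n = cong₂ head-or-0
    (trans (cong (λ u → u ℕ.% k) (ℕ.+-comm k n)) ([m+n]%n≡m%n n k))
    (cong a (trans (+-distrib-/-∣ˡ n ∣-refl) (cong (λ u → u ℕ.+ n ℕ./ k) (n/n≡1 k))))

  dilate-≈[] : ∀ {a b M} → a ≈[ M ] b → dilate k a ≈[ M ] dilate k b
  dilate-≈[] p n n<M = cong (head-or-0 (n ℕ.% k)) (p (n ℕ./ k) (ℕ.≤-<-trans (m/n≤m n k) n<M))

  dilate-cong : ∀ {a b} → a ≈ b → dilate k a ≈ dilate k b
  dilate-cong p n = cong (head-or-0 (n ℕ.% k)) (p (n ℕ./ k))

  dilate-unfold : ∀ a → dilate k a ≈ constant (a 0) ⊕ q^ k ⊗ dilate k (tail a)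
  dilate-unfold a = step-induction k (λ n → dilate k a n ≡ (constant (a 0) ⊕ q^ k ⊗ dilate k (tail a)) n) below above
    where
    below : ∀ {n} → n < k → dilate k a n ≡ (constant (a 0) ⊕ q^ k ⊗ dilate k (tail a)) n
    below {zero}  0<k = trans (dilate-0 a) (sym (trans (⊕-coeff (constant (a 0)) _ 0)
      (trans (cong (λ u → a 0 ℤ.+ u) (q^-⊗-below k _ 0<k)) (ℤ.+-identityʳ _))))
    below {suc n} n<k = trans (dilate-below a n<k) (sym (trans (⊕-coeff (constant (a 0)) _ (suc n))
      (trans (ℤ.+-identityˡ _) (q^-⊗-below k _ n<k))))
    constant-above : ∀ {j} .{{_ : NonZero j}} z n → constant z (j ℕ.+ n) ≡ 0ℤ
    constant-above {suc j} z n = refl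
    above : ∀ n → _ → dilate k a (k ℕ.+ n) ≡ (constant (a 0) ⊕ q^ k ⊗ dilate k (tail a)) (k ℕ.+ n)
    above n _ = trans (dilate-above a n) (sym (trans (⊕-coeff (constant (a 0)) _ (k ℕ.+ n))
      (trans (cong₂ ℤ._+_ (constant-above {k} (a 0) n) (q^-⊗-above k (dilate k (tail a)) n)) (ℤ.+-identityˡ _))))

  -- The factor q^k moves the recursion k places down, so the unfolding equation determines every
  -- coefficient. Composite dilations are identified in this way.
  dilate-unique : (F : PowerSeries → PowerSeries) →
    (∀ a → F a ≈ constant (a 0) ⊕ q^ k ⊗ F (tail a)) → ∀ a → F a ≈ dilate k a
  dilate-unique F unfold a n = step-induction k (λ n → ∀ a → F a n ≡ dilate k a n) below above n a
    where
    expand : ∀ a n x y → (q^ k ⊗ x) n ≡ (q^ k ⊗ y) n →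
      (constant (a 0) ⊕ q^ k ⊗ x) n ≡ (constant (a 0) ⊕ q^ k ⊗ y) n
    expand a n x y p = trans (⊕-coeff (constant (a 0)) _ n) (trans (cong (λ u → constant (a 0) n ℤ.+ u) p) (sym (⊕-coeff (constant (a 0)) _ n)))
    below : ∀ {n} → n < k → ∀ a → F a n ≡ dilate k a n
    below {n} n<k a = trans (unfold a n) (trans
      (expand a n (F (tail a)) (dilate k (tail a)) (trans (q^-⊗-below k _ n<k) (sym (q^-⊗-below k _ n<k)))) (sym (dilate-unfold a n)))
    above : ∀ n → (∀ a → F a n ≡ dilate k a n) → ∀ a → F a (k ℕ.+ n) ≡ dilate k a (k ℕ.+ n)
    above n rec a = trans (unfold a (k ℕ.+ n)) (trans
      (expand a (k ℕ.+ n) (F (tail a)) (dilate k (tail a))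
        (trans (q^-⊗-above k _ n) (trans (rec (tail a)) (sym (q^-⊗-above k _ n)))))
      (sym (dilate-unfold a (k ℕ.+ n))))

  dilate-⊕ : ∀ a b → dilate k (a ⊕ b) ≈ dilate k a ⊕ dilate k b
  dilate-⊕ a b n = trans (cong (head-or-0 (n ℕ.% k)) (⊕-coeff a b (n ℕ./ k)))
    (trans (additive (n ℕ.% k)) (sym (⊕-coeff (dilate k a) (dilate k b) n)))
    where
    additive : ∀ r {x y} → head-or-0 r (x ℤ.+ y) ≡ head-or-0 r x ℤ.+ head-or-0 r y
    additive zero    = refl
    additive (suc _) = refl

  dilate-⊖ : ∀ a → dilate k (⊖ a) ≈ ⊖ dilate k a
  dilate-⊖ a n = trans (cong (head-or-0 (n ℕ.% k)) (⊖-coeff a (n ℕ./ k)))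
    (trans (negative (n ℕ.% k)) (sym (⊖-coeff (dilate k a) n)))
    where
    negative : ∀ r {x} → head-or-0 r (ℤ.- x) ≡ ℤ.- head-or-0 r x
    negative zero    = refl
    negative (suc _) = refl

  dilate-constant : ∀ z → dilate k (constant z) ≈ constant z
  dilate-constant z = begin
    dilate k (constant z)             ≈⟨ dilate-unfold (constant z) ⟩
    constant z ⊕ q^ k ⊗ dilate k 0#   ≈⟨ ⊕-cong ≈-refl (⊗-cong (≈-refl {q^ k}) dilate-0#) ⟩
    constant z ⊕ q^ k ⊗ constant 0ℤ   ≈⟨ solve 2 (λ z Q → z :+ Q :* con 0ℤ := z) ≈-refl (constant z) (q^ k) ⟩
    constant z                        ∎
    where
    open ≈-Reasoning
    vanish : ∀ r → head-or-0 r 0ℤ ≡ 0ℤ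
    vanish zero    = refl
    vanish (suc _) = refl
    dilate-0# : dilate k 0# ≈ constant 0ℤ
    dilate-0# n = trans (vanish (n ℕ.% k)) (0#≈constant n)

  dilate-constant-⊗ : ∀ z a n → dilate k (constant z ⊗ a) n ≡ z ℤ.* dilate k a n
  dilate-constant-⊗ z a n = trans (cong (head-or-0 (n ℕ.% k)) (constant-⊗ z a (n ℕ./ k))) (scale (n ℕ.% k))
    where
    scale : ∀ r {x} → head-or-0 r (z ℤ.* x) ≡ z ℤ.* head-or-0 r x
    scale zero    = refl
    scale (suc _) = sym (ℤ.*-zeroʳ z)

  -- The induction on the index keeps a and b general: going from n to k + n replaces a by `tail a`,
  -- by the Leibniz rule.
  dilate-⊗ : ∀ a b → dilate k (a ⊗ b) ≈ dilate k a ⊗ dilate k b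
  dilate-⊗ a b n = step-induction k (λ n → ∀ a b → dilate k (a ⊗ b) n ≡ (dilate k a ⊗ dilate k b) n) below above n a b
    where
    open ≈-Reasoning
    right : ∀ a b → dilate k a ⊗ dilate k b ≈ constant (a 0) ⊗ dilate k b ⊕ q^ k ⊗ (dilate k (tail a) ⊗ dilate k b)
    right a b = ≈-trans (⊗-cong (dilate-unfold a) ≈-refl)
      (solve 4 (λ z Q x y → (z :+ Q :* x) :* y := z :* y :+ Q :* (x :* y)) ≈-refl (constant (a 0)) (q^ k) (dilate k (tail a)) (dilate k b))
    right-at : ∀ a b n → (dilate k a ⊗ dilate k b) n ≡ a 0 ℤ.* dilate k b n ℤ.+ (q^ k ⊗ (dilate k (tail a) ⊗ dilate k b)) n
    right-at a b n = trans (right a b n) (trans (⊕-coeff (constant (a 0) ⊗ dilate k b) _ n)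
      (cong (λ u → u ℤ.+ (q^ k ⊗ (dilate k (tail a) ⊗ dilate k b)) n) (constant-⊗ (a 0) (dilate k b) n)))
    below : ∀ {n} → n < k → ∀ a b → dilate k (a ⊗ b) n ≡ (dilate k a ⊗ dilate k b) n
    below {zero}  0<k a b = trans (dilate-0 (a ⊗ b)) (trans (⊗-coeff-0 a b) (sym (trans (⊗-coeff-0 (dilate k a) (dilate k b))
      (cong₂ ℤ._*_ (dilate-0 a) (dilate-0 b)))))
    below {suc n} n<k a b = trans (dilate-below (a ⊗ b) n<k) (sym (trans (right-at a b (suc n))
      (trans (cong₂ ℤ._+_ (trans (cong (λ u → a 0 ℤ.* u) (dilate-below b n<k)) (ℤ.*-zeroʳ (a 0))) (q^-⊗-below k _ n<k)) refl)))
    above : ∀ n → (∀ a b → dilate k (a ⊗ b) n ≡ (dilate k a ⊗ dilate k b) n) →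
            ∀ a b → dilate k (a ⊗ b) (k ℕ.+ n) ≡ (dilate k a ⊗ dilate k b) (k ℕ.+ n)
    above n rec a b = trans (dilate-above (a ⊗ b) n)
      (trans (dilate-cong (tail-⊗ a b) n)
      (trans (dilate-⊕ (constant (a 0) ⊗ tail b) (tail a ⊗ b) n)
      (trans (⊕-coeff (dilate k (constant (a 0) ⊗ tail b)) _ n)
      (trans (cong₂ ℤ._+_ (trans (dilate-constant-⊗ (a 0) (tail b) n) (cong (λ u → a 0 ℤ.* u) (sym (dilate-above b n))))
                          (trans (rec (tail a) b) (sym (q^-⊗-above k (dilate k (tail a) ⊗ dilate k b) n))))
      (sym (right-at a b (k ℕ.+ n)))))))

  dilate-q^ : ∀ m → dilate k (q^ m) ≈ q^ (k ℕ.* m)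
  dilate-q^ zero = ≈-trans (dilate-cong 1#≈constant) (≈-trans (dilate-constant 1ℤ)
    (≈-trans (≈-sym 1#≈constant) λ n → cong (λ j → (q^ j) n) (sym (ℕ.*-zeroʳ k))))
  dilate-q^ (suc m) = begin
    dilate k (q^ suc m)                         ≈⟨ dilate-unfold (q^ suc m) ⟩
    constant 0ℤ ⊕ q^ k ⊗ dilate k (q^ m)        ≈⟨ solve 1 (λ x → con 0ℤ :+ x := x) ≈-refl _ ⟩
    q^ k ⊗ dilate k (q^ m)                      ≈⟨ ⊗-cong (≈-refl {q^ k}) (dilate-q^ m) ⟩
    q^ k ⊗ q^ (k ℕ.* m)                         ≈⟨ q^-+ k (k ℕ.* m) ⟩
    q^ (k ℕ.+ k ℕ.* m)                          ≈⟨ (λ n → cong (λ j → (q^ j) n) (sym (ℕ.*-suc k m))) ⟩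
    q^ (k ℕ.* suc m)                            ∎
    where open ≈-Reasoning

dilate-dilate : ∀ k l .{{_ : NonZero k}} .{{_ : NonZero l}} .{{_ : NonZero (k ℕ.* l)}} a →
  dilate k (dilate l a) ≈ dilate (k ℕ.* l) a
dilate-dilate k l = dilate-unique (k ℕ.* l) (dilate k ∘ dilate l) λ a → begin
  dilate k (dilate l a)
    ≈⟨ dilate-cong k (dilate-unfold l a) ⟩
  dilate k (constant (a 0) ⊕ q^ l ⊗ dilate l (tail a))
    ≈⟨ dilate-⊕ k (constant (a 0)) _ ⟩
  dilate k (constant (a 0)) ⊕ dilate k (q^ l ⊗ dilate l (tail a))
    ≈⟨ ⊕-cong (dilate-constant k (a 0)) (≈-trans (dilate-⊗ k (q^ l) (dilate l (tail a)))
         (⊗-cong (dilate-q^ k l) (≈-refl {dilate k (dilate l (tail a))}))) ⟩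
  constant (a 0) ⊕ q^ (k ℕ.* l) ⊗ dilate k (dilate l (tail a)) ∎
  where open ≈-Reasoning

-- Sections modulo 5 and their reassembly

section : ℕ → PowerSeries → PowerSeries
section r a n = a (r ℕ.+ n ℕ.* 5)

section-cong : ∀ r {a b} → a ≈ b → section r a ≈ section r b
section-cong r p n = p (r ℕ.+ n ℕ.* 5)

section-ext : ∀ {a b} → (∀ r → r < 5 → section r a ≈ section r b) → a ≈ b
section-ext {a} {b} p n = subst (λ m → a m ≡ b m) (sym (m≡m%n+[m/n]*n n 5)) (p (n ℕ.% 5) (m%n<n n 5) (n ℕ./ 5))

section-⊕ : ∀ r a b → section r (a ⊕ b) ≈ section r a ⊕ section r b
section-⊕ r a b n = trans (⊕-coeff a b _) (sym (⊕-coeff (section r a) (section r b) n))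

section-same : ∀ r a → section r (q^ r ⊗ dilate 5 a) ≈ a
section-same r a n = trans (q^-⊗-above r (dilate 5 a) (n ℕ.* 5)) (dilate-multiple 5 a n)

section-other : ∀ r s a → r < 5 → s < 5 → ¬ r ≡ s → section r (q^ s ⊗ dilate 5 a) ≈ constant 0ℤ
section-other r s a r<5 s<5 r≢s n = trans (go n) (0#≈constant n)
  where
  off : ∀ j n → suc j < 5 → dilate 5 a (suc j ℕ.+ n ℕ.* 5) ≡ 0ℤ
  off j n j<5 = cong (λ r → head-or-0 r (a ((suc j ℕ.+ n ℕ.* 5) ℕ./ 5))) (trans ([m+kn]%n≡m%n (suc j) n 5) (m<n⇒m%n≡m j<5))
  go : ∀ n → (q^ s ⊗ dilate 5 a) (r ℕ.+ n ℕ.* 5) ≡ 0ℤ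
  go n with s ℕ.≤? r
  ... | yes s≤r = trans (cong (q^ s ⊗ dilate 5 a) (trans (cong (λ u → u ℕ.+ n ℕ.* 5) (sym (ℕ.m+[n∸m]≡n s≤r))) (ℕ.+-assoc s _ _)))
      (trans (q^-⊗-above s (dilate 5 a) (r ℕ.∸ s ℕ.+ n ℕ.* 5)) (difference (r ℕ.∸ s) refl))
    where
    difference : ∀ j → r ℕ.∸ s ≡ j → dilate 5 a (j ℕ.+ n ℕ.* 5) ≡ 0ℤ
    difference zero    eq = contradiction (ℕ.≤-antisym (ℕ.m∸n≡0⇒m≤n eq) s≤r) r≢s
    difference (suc j) eq = off j n (ℕ.≤-<-trans (subst (λ u → u ≤ r) eq (ℕ.m∸n≤m r s)) r<5)
  go zero    | no s≰r = trans (cong (q^ s ⊗ dilate 5 a) (ℕ.+-identityʳ r)) (q^-⊗-below s (dilate 5 a) (ℕ.≰⇒> s≰r))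
  -- For s > r a 5 is borrowed from the quotient. The new residue r + 5 - s lies strictly between 0
  -- and 5, so the dilated series vanishes there.
  go (suc n) | no s≰r = trans (cong (q^ s ⊗ dilate 5 a) index)
      (trans (q^-⊗-above s (dilate 5 a) (r ℕ.+ 5 ℕ.∸ s ℕ.+ n ℕ.* 5)) (difference (r ℕ.+ 5 ℕ.∸ s) refl))
    where
    s≤r+5 : s ≤ r ℕ.+ 5
    s≤r+5 = ℕ.≤-trans (ℕ.<⇒≤ s<5) (ℕ.m≤n+m 5 r)
    index : r ℕ.+ (5 ℕ.+ n ℕ.* 5) ≡ s ℕ.+ (r ℕ.+ 5 ℕ.∸ s ℕ.+ n ℕ.* 5)
    index = trans (sym (ℕ.+-assoc r 5 (n ℕ.* 5)))
      (trans (cong (λ u → u ℕ.+ n ℕ.* 5) (sym (ℕ.m+[n∸m]≡n s≤r+5))) (ℕ.+-assoc s _ _))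
    difference : ∀ j → r ℕ.+ 5 ℕ.∸ s ≡ j → dilate 5 a (j ℕ.+ n ℕ.* 5) ≡ 0ℤ
    difference zero    eq = contradiction (ℕ.m∸n≡0⇒m≤n eq) (ℕ.<⇒≱ (ℕ.<-≤-trans s<5 (ℕ.m≤n+m 5 r)))
    difference (suc j) eq = off j n (subst (λ u → u < 5) eq (ℕ.+-cancelʳ-< s _ _ (subst (λ u → u < 5 ℕ.+ s) (sym (ℕ.m∸n+n≡m s≤r+5))
      (subst (λ u → u < 5 ℕ.+ s) (ℕ.+-comm 5 r) (ℕ.+-monoʳ-< 5 (ℕ.≰⇒> s≰r))))))

0<5 : 0 < 5
0<5 = s≤s z≤n
1<5 : 1 < 5
1<5 = s≤s (s≤s z≤n)
2<5 : 2 < 5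
2<5 = s≤s (s≤s (s≤s z≤n))
3<5 : 3 < 5
3<5 = s≤s (s≤s (s≤s (s≤s z≤n)))
4<5 : 4 < 5
4<5 = s≤s (s≤s (s≤s (s≤s (s≤s z≤n))))

-- The powers of q are written as repeated products, so that the ring solver treats them as
-- monomials in a single variable.
assemble : PowerSeries → PowerSeries → PowerSeries → PowerSeries → PowerSeries → PowerSeries
assemble a₀ a₁ a₂ a₃ a₄ = dilate 5 a₀ ⊕ q ⊗ dilate 5 a₁ ⊕ q ⊗ q ⊗ dilate 5 a₂
  ⊕ q ⊗ q ⊗ q ⊗ dilate 5 a₃ ⊕ q ⊗ q ⊗ q ⊗ q ⊗ dilate 5 a₄

module _ (a₀ a₁ a₂ a₃ a₄ : PowerSeries) where

  private
    open ≈-Reasoning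

    assemble-q^ : assemble a₀ a₁ a₂ a₃ a₄ ≈
      q^ 0 ⊗ dilate 5 a₀ ⊕ q^ 1 ⊗ dilate 5 a₁ ⊕ q^ 2 ⊗ dilate 5 a₂ ⊕ q^ 3 ⊗ dilate 5 a₃ ⊕ q^ 4 ⊗ dilate 5 a₄
    assemble-q^ = ⊕-cong (⊕-cong (⊕-cong (⊕-cong (≈-sym (⊗-identityˡ _)) ≈-refl)
      (⊗-cong (q^-+ 1 1) ≈-refl))
      (⊗-cong (≈-trans (⊗-cong (q^-+ 1 1) (≈-refl {q})) (q^-+ 2 1)) ≈-refl))
      (⊗-cong (≈-trans (⊗-cong (≈-trans (⊗-cong (q^-+ 1 1) (≈-refl {q})) (q^-+ 2 1)) (≈-refl {q})) (q^-+ 3 1)) ≈-refl)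

    split : ∀ r → section r (assemble a₀ a₁ a₂ a₃ a₄) ≈
      section r (q^ 0 ⊗ dilate 5 a₀) ⊕ section r (q^ 1 ⊗ dilate 5 a₁) ⊕ section r (q^ 2 ⊗ dilate 5 a₂)
        ⊕ section r (q^ 3 ⊗ dilate 5 a₃) ⊕ section r (q^ 4 ⊗ dilate 5 a₄)
    split r = ≈-trans (section-cong r assemble-q^) (≈-trans (section-⊕ r _ _) (⊕-cong (≈-trans (section-⊕ r _ _) (⊕-cong
      (≈-trans (section-⊕ r _ _) (⊕-cong (section-⊕ r _ _) ≈-refl)) ≈-refl)) ≈-refl))

    off : ∀ {r} s a → r < 5 → s < 5 → ¬ r ≡ s → section r (q^ s ⊗ dilate 5 a) ≈ constant 0ℤ
    off {r} s a = section-other r s a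

  section-assemble-0 : section 0 (assemble a₀ a₁ a₂ a₃ a₄) ≈ a₀
  section-assemble-0 = ≈-trans (split 0) (≈-trans
    (⊕-cong (⊕-cong (⊕-cong (⊕-cong (section-same 0 a₀) (off 1 a₁ 0<5 1<5 λ ())) (off 2 a₂ 0<5 2<5 λ ())) (off 3 a₃ 0<5 3<5 λ ())) (off 4 a₄ 0<5 4<5 λ ()))
    (solve 1 (λ x → x :+ con 0ℤ :+ con 0ℤ :+ con 0ℤ :+ con 0ℤ := x) ≈-refl a₀))

  section-assemble-1 : section 1 (assemble a₀ a₁ a₂ a₃ a₄) ≈ a₁
  section-assemble-1 = ≈-trans (split 1) (≈-trans
    (⊕-cong (⊕-cong (⊕-cong (⊕-cong (off 0 a₀ 1<5 0<5 λ ()) (section-same 1 a₁)) (off 2 a₂ 1<5 2<5 λ ())) (off 3 a₃ 1<5 3<5 λ ())) (off 4 a₄ 1<5 4<5 λ ()))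
    (solve 1 (λ x → con 0ℤ :+ x :+ con 0ℤ :+ con 0ℤ :+ con 0ℤ := x) ≈-refl a₁))

  section-assemble-2 : section 2 (assemble a₀ a₁ a₂ a₃ a₄) ≈ a₂
  section-assemble-2 = ≈-trans (split 2) (≈-trans
    (⊕-cong (⊕-cong (⊕-cong (⊕-cong (off 0 a₀ 2<5 0<5 λ ()) (off 1 a₁ 2<5 1<5 λ ())) (section-same 2 a₂)) (off 3 a₃ 2<5 3<5 λ ())) (off 4 a₄ 2<5 4<5 λ ()))
    (solve 1 (λ x → con 0ℤ :+ con 0ℤ :+ x :+ con 0ℤ :+ con 0ℤ := x) ≈-refl a₂))

  section-assemble-3 : section 3 (assemble a₀ a₁ a₂ a₃ a₄) ≈ a₃
  section-assemble-3 = ≈-trans (split 3) (≈-trans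
    (⊕-cong (⊕-cong (⊕-cong (⊕-cong (off 0 a₀ 3<5 0<5 λ ()) (off 1 a₁ 3<5 1<5 λ ())) (off 2 a₂ 3<5 2<5 λ ())) (section-same 3 a₃)) (off 4 a₄ 3<5 4<5 λ ()))
    (solve 1 (λ x → con 0ℤ :+ con 0ℤ :+ con 0ℤ :+ x :+ con 0ℤ := x) ≈-refl a₃))

  section-assemble-4 : section 4 (assemble a₀ a₁ a₂ a₃ a₄) ≈ a₄
  section-assemble-4 = ≈-trans (split 4) (≈-trans
    (⊕-cong (⊕-cong (⊕-cong (⊕-cong (off 0 a₀ 4<5 0<5 λ ()) (off 1 a₁ 4<5 1<5 λ ())) (off 2 a₂ 4<5 2<5 λ ())) (off 3 a₃ 4<5 3<5 λ ())) (section-same 4 a₄))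
    (solve 1 (λ x → con 0ℤ :+ con 0ℤ :+ con 0ℤ :+ con 0ℤ :+ x := x) ≈-refl a₄))

assemble-sections : ∀ a → assemble (section 0 a) (section 1 a) (section 2 a) (section 3 a) (section 4 a) ≈ a
assemble-sections a = section-ext go
  where
  go : ∀ r → r < 5 → section r (assemble (section 0 a) (section 1 a) (section 2 a) (section 3 a) (section 4 a)) ≈ section r a
  go 0 _ = section-assemble-0 (section 0 a) (section 1 a) (section 2 a) (section 3 a) (section 4 a)
  go 1 _ = section-assemble-1 (section 0 a) (section 1 a) (section 2 a) (section 3 a) (section 4 a)
  go 2 _ = section-assemble-2 (section 0 a) (section 1 a) (section 2 a) (section 3 a) (section 4 a)
  go 3 _ = section-assemble-3 (section 0 a) (section 1 a) (section 2 a) (section 3 a) (section 4 a)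
  go 4 _ = section-assemble-4 (section 0 a) (section 1 a) (section 2 a) (section 3 a) (section 4 a)
  go (suc (suc (suc (suc (suc r))))) (s≤s (s≤s (s≤s (s≤s (s≤s ())))))

assemble-cong : ∀ {a₀ a₁ a₂ a₃ a₄ b₀ b₁ b₂ b₃ b₄} → a₀ ≈ b₀ → a₁ ≈ b₁ → a₂ ≈ b₂ → a₃ ≈ b₃ → a₄ ≈ b₄ →
  assemble a₀ a₁ a₂ a₃ a₄ ≈ assemble b₀ b₁ b₂ b₃ b₄
assemble-cong p₀ p₁ p₂ p₃ p₄ = ⊕-cong (⊕-cong (⊕-cong (⊕-cong (dilate-cong 5 p₀) (⊗-cong ≈-refl (dilate-cong 5 p₁)))
  (⊗-cong ≈-refl (dilate-cong 5 p₂))) (⊗-cong ≈-refl (dilate-cong 5 p₃))) (⊗-cong ≈-refl (dilate-cong 5 p₄))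

-- Residues add, and a sum of at least 5 leaves a factor q⁵, the dilation of q: hence the factor q
-- on the wrapped products.
assemble-⊗ : ∀ a₀ a₁ a₂ a₃ a₄ b₀ b₁ b₂ b₃ b₄ →
  assemble a₀ a₁ a₂ a₃ a₄ ⊗ assemble b₀ b₁ b₂ b₃ b₄ ≈ assemble
    (a₀ ⊗ b₀ ⊕ q ⊗ (a₁ ⊗ b₄ ⊕ a₂ ⊗ b₃ ⊕ a₃ ⊗ b₂ ⊕ a₄ ⊗ b₁))
    (a₀ ⊗ b₁ ⊕ a₁ ⊗ b₀ ⊕ q ⊗ (a₂ ⊗ b₄ ⊕ a₃ ⊗ b₃ ⊕ a₄ ⊗ b₂))
    (a₀ ⊗ b₂ ⊕ a₁ ⊗ b₁ ⊕ a₂ ⊗ b₀ ⊕ q ⊗ (a₃ ⊗ b₄ ⊕ a₄ ⊗ b₃))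
    (a₀ ⊗ b₃ ⊕ a₁ ⊗ b₂ ⊕ a₂ ⊗ b₁ ⊕ a₃ ⊗ b₀ ⊕ q ⊗ (a₄ ⊗ b₄))
    (a₀ ⊗ b₄ ⊕ a₁ ⊗ b₃ ⊕ a₂ ⊗ b₂ ⊕ a₃ ⊗ b₁ ⊕ a₄ ⊗ b₀)
assemble-⊗ a₀ a₁ a₂ a₃ a₄ b₀ b₁ b₂ b₃ b₄ = begin
  assemble a₀ a₁ a₂ a₃ a₄ ⊗ assemble b₀ b₁ b₂ b₃ b₄
    ≈⟨ solve 11 (λ Q a₀ a₁ a₂ a₃ a₄ b₀ b₁ b₂ b₃ b₄ →
         let Q⁵ = Q :* Q :* Q :* Q :* Q in
         (a₀ :+ Q :* a₁ :+ Q :* Q :* a₂ :+ Q :* Q :* Q :* a₃ :+ Q :* Q :* Q :* Q :* a₄)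
           :* (b₀ :+ Q :* b₁ :+ Q :* Q :* b₂ :+ Q :* Q :* Q :* b₃ :+ Q :* Q :* Q :* Q :* b₄) :=
         (a₀ :* b₀ :+ Q⁵ :* (a₁ :* b₄ :+ a₂ :* b₃ :+ a₃ :* b₂ :+ a₄ :* b₁))
         :+ Q :* (a₀ :* b₁ :+ a₁ :* b₀ :+ Q⁵ :* (a₂ :* b₄ :+ a₃ :* b₃ :+ a₄ :* b₂))
         :+ Q :* Q :* (a₀ :* b₂ :+ a₁ :* b₁ :+ a₂ :* b₀ :+ Q⁵ :* (a₃ :* b₄ :+ a₄ :* b₃))
         :+ Q :* Q :* Q :* (a₀ :* b₃ :+ a₁ :* b₂ :+ a₂ :* b₁ :+ a₃ :* b₀ :+ Q⁵ :* (a₄ :* b₄))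
         :+ Q :* Q :* Q :* Q :* (a₀ :* b₄ :+ a₁ :* b₃ :+ a₂ :* b₂ :+ a₃ :* b₁ :+ a₄ :* b₀)) ≈-refl
         q (s a₀) (s a₁) (s a₂) (s a₃) (s a₄) (s b₀) (s b₁) (s b₂) (s b₃) (s b₄) ⟩
  _ ≈⟨ ⊕-cong (⊕-cong (⊕-cong (⊕-cong
         (m a₀ b₀ +′ q⁵* (m a₁ b₄ +′ m a₂ b₃ +′ m a₃ b₂ +′ m a₄ b₁))
         (⊗-cong ≈-refl (m a₀ b₁ +′ m a₁ b₀ +′ q⁵* (m a₂ b₄ +′ m a₃ b₃ +′ m a₄ b₂))))
         (⊗-cong ≈-refl (m a₀ b₂ +′ m a₁ b₁ +′ m a₂ b₀ +′ q⁵* (m a₃ b₄ +′ m a₄ b₃))))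
         (⊗-cong ≈-refl (m a₀ b₃ +′ m a₁ b₂ +′ m a₂ b₁ +′ m a₃ b₀ +′ q⁵* (m a₄ b₄))))
         (⊗-cong ≈-refl (m a₀ b₄ +′ m a₁ b₃ +′ m a₂ b₂ +′ m a₃ b₁ +′ m a₄ b₀)) ⟩
  _ ∎
  where
  open ≈-Reasoning
  infixl 6 _+′_
  s : PowerSeries → PowerSeries
  s = dilate 5
  m : ∀ a b → s a ⊗ s b ≈ s (a ⊗ b)
  m a b = ≈-sym (dilate-⊗ 5 a b)
  _+′_ : ∀ {x y z w} → x ≈ s y → z ≈ s w → x ⊕ z ≈ s (y ⊕ w)
  p +′ r = ≈-trans (⊕-cong p r) (≈-sym (dilate-⊕ 5 _ _))
  q⁵ : q ⊗ q ⊗ q ⊗ q ⊗ q ≈ s q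
  q⁵ = ≈-trans (⊗-cong (≈-trans (⊗-cong (≈-trans (⊗-cong (q^-+ 1 1) (≈-refl {q})) (q^-+ 2 1)) (≈-refl {q})) (q^-+ 3 1)) (≈-refl {q}))
    (≈-trans (q^-+ 4 1) (≈-sym (dilate-q^ 5 1)))
  q⁵* : ∀ {x y} → x ≈ s y → q ⊗ q ⊗ q ⊗ q ⊗ q ⊗ x ≈ s (q ⊗ y)
  q⁵* p = ≈-trans (⊗-cong q⁵ p) (≈-sym (dilate-⊗ 5 q _))

-- Summation over ℤ

≈[]-sym : ∀ {a b M} → a ≈[ M ] b → b ≈[ M ] a
≈[]-sym p n n<M = sym (p n n<M)

≈[]-trans : ∀ {a b c M} → a ≈[ M ] b → b ≈[ M ] c → a ≈[ M ] c
≈[]-trans p r n n<M = trans (p n n<M) (r n n<M)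

≈[]-refl : ∀ {a M} → a ≈[ M ] a
≈[]-refl n n<M = refl

sum< : ℕ → (ℕ → PowerSeries) → PowerSeries
sum< zero    g = constant 0ℤ
sum< (suc n) g = sum< n g ⊕ g n

sum<-≈[] : ∀ n {g h M} → (∀ i → i < n → g i ≈[ M ] h i) → sum< n g ≈[ M ] sum< n h
sum<-≈[] zero    p = ≈[]-refl
sum<-≈[] (suc n) p = ⊕-≈[] (sum<-≈[] n λ i i<n → p i (ℕ.m≤n⇒m≤1+n i<n)) (p n ℕ.≤-refl)

sum<-cong : ∀ n {g h} → (∀ i → g i ≈ h i) → sum< n g ≈ sum< n h
sum<-cong n p = ≈[]-limit λ M → sum<-≈[] n λ i _ → ≈[]-all (p i)

sum<-first : ∀ n g → sum< (suc n) g ≈ g 0 ⊕ sum< n (g ∘ suc)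
sum<-first zero    g = ⊕-comm _ (g 0)
sum<-first (suc n) g = ≈-trans (⊕-cong (sum<-first n g) ≈-refl) (⊕-assoc (g 0) _ _)

sum<-⊕ : ∀ n g h → sum< n (λ i → g i ⊕ h i) ≈ sum< n g ⊕ sum< n h
sum<-⊕ zero    g h = solve 0 (con 0ℤ := con 0ℤ :+ con 0ℤ) ≈-refl
sum<-⊕ (suc n) g h = ≈-trans (⊕-cong (sum<-⊕ n g h) ≈-refl)
  (solve 4 (λ x y z w → x :+ y :+ (z :+ w) := x :+ z :+ (y :+ w)) ≈-refl (sum< n g) (sum< n h) (g n) (h n))

sum<-⊗ : ∀ n c g → sum< n (λ i → c ⊗ g i) ≈ c ⊗ sum< n g
sum<-⊗ zero    c g = solve 1 (λ c → con 0ℤ := c :* con 0ℤ) ≈-refl c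
sum<-⊗ (suc n) c g = ≈-trans (⊕-cong (sum<-⊗ n c g) ≈-refl)
  (solve 3 (λ c x y → c :* x :+ c :* y := c :* (x :+ y)) ≈-refl c (sum< n g) (g n))

sum<-swap : ∀ m n (G : ℕ → ℕ → PowerSeries) →
  sum< m (λ i → sum< n (G i)) ≈ sum< n (λ j → sum< m (λ i → G i j))
sum<-swap zero    n G = zeros n
  where
  zeros : ∀ n → constant 0ℤ ≈ sum< n (λ _ → constant 0ℤ)
  zeros zero    = ≈-refl
  zeros (suc n) = ≈-trans (solve 0 (con 0ℤ := con 0ℤ :+ con 0ℤ) ≈-refl) (⊕-cong (zeros n) ≈-refl)
sum<-swap (suc m) n G = ≈-trans (⊕-cong (sum<-swap m n G) ≈-refl) (≈-sym (sum<-⊕ n _ (G m)))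

-- The sum of F j over -m ≤ j < n.
window : (ℤ → PowerSeries) → ℕ → ℕ → PowerSeries
window F m n = sum< m (λ i → F -[1+ i ]) ⊕ sum< n (λ i → F (+ i))

-- The two ends of the window vary independently. Translations and reflections produce unsymmetric
-- windows, and they preserve this notion of convergence.
record HasSum (F : ℤ → PowerSeries) (S : PowerSeries) : Set where
  field sums : ∀ M → ∃ λ N → ∀ m n → N ≤ m → N ≤ n → window F m n ≈[ M ] S
open HasSum

window-≈[] : ∀ {F G M} m n → (∀ j → F j ≈[ M ] G j) → window F m n ≈[ M ] window G m n
window-≈[] m n p = ⊕-≈[] (sum<-≈[] m λ i _ → p -[1+ i ]) (sum<-≈[] n λ i _ → p (+ i))

window-cong : ∀ {F G} m n → (∀ j → F j ≈ G j) → window F m n ≈ window G m n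
window-cong m n p = ⊕-cong (sum<-cong m λ i → p -[1+ i ]) (sum<-cong n λ i → p (+ i))

HasSum-unique : ∀ {F S T} → HasSum F S → HasSum F T → S ≈ T
HasSum-unique s t = ≈[]-limit λ M →
  let N , p = sums s M ; K , r = sums t M in
  ≈[]-trans (≈[]-sym (p (N ℕ.⊔ K) (N ℕ.⊔ K) (ℕ.m≤m⊔n N K) (ℕ.m≤m⊔n N K)))
            (r (N ℕ.⊔ K) (N ℕ.⊔ K) (ℕ.m≤n⊔m N K) (ℕ.m≤n⊔m N K))

HasSum-cong : ∀ {F G S T} → (∀ j → F j ≈ G j) → S ≈ T → HasSum F S → HasSum G T
sums (HasSum-cong p r s) M = let N , h = sums s M in N , λ m n N≤m N≤n →
  ≈[]-trans (≈[]-all (window-cong m n λ j → ≈-sym (p j))) (≈[]-trans (h m n N≤m N≤n) (≈[]-all r))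

HasSum-⊕ : ∀ {F G S T} → HasSum F S → HasSum G T → HasSum (λ j → F j ⊕ G j) (S ⊕ T)
sums (HasSum-⊕ {F} {G} s t) M = let N , p = sums s M ; K , r = sums t M in N ℕ.⊔ K , λ m n N≤m N≤n →
  ≈[]-trans (≈[]-all (distribute m n))
    (⊕-≈[] (p m n (ℕ.≤-trans (ℕ.m≤m⊔n N K) N≤m) (ℕ.≤-trans (ℕ.m≤m⊔n N K) N≤n))
           (r m n (ℕ.≤-trans (ℕ.m≤n⊔m N K) N≤m) (ℕ.≤-trans (ℕ.m≤n⊔m N K) N≤n)))
  where
  distribute : ∀ m n → window (λ j → F j ⊕ G j) m n ≈ window F m n ⊕ window G m n
  distribute m n = ≈-trans (⊕-cong (sum<-⊕ m _ _) (sum<-⊕ n _ _))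
    (solve 4 (λ x y z w → x :+ y :+ (z :+ w) := x :+ z :+ (y :+ w)) ≈-refl
      (sum< m λ i → F -[1+ i ]) (sum< m λ i → G -[1+ i ]) (sum< n λ i → F (+ i)) (sum< n λ i → G (+ i)))

window-⊗ : ∀ c F m n → window (λ j → c ⊗ F j) m n ≈ c ⊗ window F m n
window-⊗ c F m n = ≈-trans (⊕-cong (sum<-⊗ m c _) (sum<-⊗ n c _))
  (solve 3 (λ c x y → c :* x :+ c :* y := c :* (x :+ y)) ≈-refl c (sum< m λ i → F -[1+ i ]) (sum< n λ i → F (+ i)))

HasSum-⊗ : ∀ c {F S} → HasSum F S → HasSum (λ j → c ⊗ F j) (c ⊗ S)
sums (HasSum-⊗ c {F} s) M = let N , p = sums s M in N , λ m n N≤m N≤n →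
  ≈[]-trans (≈[]-all (window-⊗ c F m n)) (⊗-≈[] (≈[]-refl {c}) (p m n N≤m N≤n))

-- A shift trades one term of the negative half for one of the positive half, which is why the bound
-- grows to `suc N`.
HasSum-suc : ∀ {F S} → HasSum F S → HasSum (F ∘ ℤ.suc) S
sums (HasSum-suc {F} s) M = let N , p = sums s M in suc N , λ
  { (suc m) n (s≤s N≤m) N<n → ≈[]-trans (≈[]-all (shift m n)) (p m (suc n) N≤m (ℕ.≤-trans (ℕ.n≤1+n N) (ℕ.m≤n⇒m≤1+n N<n))) }
  where
  shift : ∀ m n → window (F ∘ ℤ.suc) (suc m) n ≈ window F m (suc n)
  shift m n = ≈-trans (⊕-cong (sum<-first m _) ≈-refl)
    (≈-trans (solve 3 (λ x y z → x :+ y :+ z := y :+ (x :+ z)) ≈-refl (F 0ℤ) (sum< m λ i → F -[1+ i ]) (sum< n λ i → F (+ suc i)))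
             (⊕-cong ≈-refl (≈-sym (sum<-first n (λ i → F (+ i))))))

HasSum-pred : ∀ {F S} → HasSum F S → HasSum (F ∘ ℤ.pred) S
sums (HasSum-pred {F} s) M = let N , p = sums s M in suc N , λ
  { m (suc n) N<m (s≤s N≤n) → ≈[]-trans (≈[]-all (shift m n)) (p (suc m) n (ℕ.≤-trans (ℕ.n≤1+n N) (ℕ.m≤n⇒m≤1+n N<m)) N≤n) }
  where
  shift : ∀ m n → window (F ∘ ℤ.pred) m (suc n) ≈ window F (suc m) n
  shift m n = ≈-trans (⊕-cong ≈-refl (sum<-first n _))
    (≈-trans (solve 3 (λ x y z → y :+ (x :+ z) := (x :+ y) :+ z) ≈-refl (F -[1+ 0 ]) (sum< m λ i → F -[1+ suc i ]) (sum< n λ i → F (+ i)))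
             (⊕-cong (≈-sym (sum<-first m (λ i → F -[1+ i ]))) ≈-refl))

HasSum-reindex : ∀ {F} {ι κ : ℤ → ℤ} {S} → (∀ j → ι j ≡ κ j) → HasSum (F ∘ ι) S → HasSum (F ∘ κ) S
HasSum-reindex {F} eq = HasSum-cong (λ j n → cong (λ i → F i n) (eq j)) ≈-refl

HasSum-translate : ∀ {F S} t → HasSum F S → HasSum (λ j → F (j ℤ.+ t)) S
HasSum-translate {F} t s = HasSum-reindex {F} (λ j → ℤ.+-comm t j) (go F t s)
  where
  go : ∀ F {S} t → HasSum F S → HasSum (λ j → F (t ℤ.+ j)) S
  go F (+ zero)     s = HasSum-reindex {F} (λ j → sym (ℤ.+-identityˡ j)) s
  go F (+ suc k)    s = HasSum-reindex {F} (λ j → sym (ℤ.+-assoc 1ℤ (+ k) j)) (go (F ∘ ℤ.suc) (+ k) (HasSum-suc s))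
  go F -[1+ zero ]  s = HasSum-pred s
  go F -[1+ suc k ] s = HasSum-reindex {F} (λ j → sym (ℤ.+-assoc -[1+ 0 ] -[1+ k ] j)) (go (F ∘ ℤ.pred) -[1+ k ] (HasSum-pred s))

HasSum-negate : ∀ {F S} → HasSum F S → HasSum (λ j → F (ℤ.- j)) S
sums (HasSum-negate {F} s) M = let N , p = sums s M in suc N , λ
  { m (suc n) N<m (s≤s N≤n) → ≈[]-trans (≈[]-all (flip m n)) (p n (suc m) N≤n (ℕ.≤-trans (ℕ.n≤1+n N) (ℕ.m≤n⇒m≤1+n N<m))) }
  where
  flip : ∀ m n → window (λ j → F (ℤ.- j)) m (suc n) ≈ window F n (suc m)
  flip m n = ≈-trans (⊕-cong ≈-refl (sum<-first n _))
    (≈-trans (solve 3 (λ x y z → y :+ (x :+ z) := z :+ (x :+ y)) ≈-refl (F 0ℤ) (sum< m λ i → F (+ suc i)) (sum< n λ i → F -[1+ i ]))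
             (⊕-cong ≈-refl (≈-sym (sum<-first m (λ i → F (+ i))))))

-- Here `μ` is a modulus of continuity: knowing `L a` modulo q^M takes a modulo q^(μ M). For
-- sections this is r + 5M.
HasSum-map : ∀ {F S} (L : PowerSeries → PowerSeries) (μ : ℕ → ℕ) →
  (∀ {a b M} → a ≈[ μ M ] b → L a ≈[ M ] L b) → L (constant 0ℤ) ≈ constant 0ℤ → (∀ a b → L (a ⊕ b) ≈ L a ⊕ L b) →
  HasSum F S → HasSum (L ∘ F) (L S)
sums (HasSum-map {F} L μ continuous zero-homo ⊕-homo s) M = let N , p = sums s (μ M) in N , λ m n N≤m N≤n →
  ≈[]-trans (≈[]-all (≈-sym (≈-trans (⊕-homo _ _) (⊕-cong (sum<-homo m _) (sum<-homo n _))))) (continuous (p m n N≤m N≤n))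
  where
  sum<-homo : ∀ n g → L (sum< n g) ≈ sum< n (L ∘ g)
  sum<-homo zero    g = zero-homo
  sum<-homo (suc n) g = ≈-trans (⊕-homo _ _) (⊕-cong (sum<-homo n g) ≈-refl)

HasSum-dilate : ∀ k .{{_ : NonZero k}} {F S} → HasSum F S → HasSum (λ j → dilate k (F j)) (dilate k S)
HasSum-dilate k = HasSum-map (dilate k) (λ M → M) (dilate-≈[] k) (dilate-constant k 0ℤ) (dilate-⊕ k)

HasSum-section : ∀ r {F S} → HasSum F S → HasSum (λ j → section r (F j)) (section r S)
HasSum-section r = HasSum-map (section r) (λ M → r ℕ.+ M ℕ.* 5)
  (λ p n n<M → p (r ℕ.+ n ℕ.* 5) (ℕ.+-monoʳ-< r (ℕ.*-monoˡ-< 5 n<M)))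
  (λ n → trans (sym (0#≈constant _)) (0#≈constant n)) (section-⊕ r)

HasSum-fives : ∀ {F S} → HasSum F S →
  HasSum (λ j → F (+ 5 ℤ.* j) ⊕ F (+ 5 ℤ.* j ℤ.+ + 1) ⊕ F (+ 5 ℤ.* j ℤ.+ + 2) ⊕ F (+ 5 ℤ.* j ℤ.+ + 3) ⊕ F (+ 5 ℤ.* j ℤ.+ + 4)) S
sums (HasSum-fives {F} s) M = let N , p = sums s M in N , λ m n N≤m N≤n →
  ≈[]-trans (≈[]-all (group m n)) (p (m ℕ.* 5) (n ℕ.* 5) (ℕ.≤-trans N≤m (ℕ.m≤m*n m 5)) (ℕ.≤-trans N≤n (ℕ.m≤m*n n 5)))
  where
  G : ℤ → PowerSeries
  G j = F (+ 5 ℤ.* j) ⊕ F (+ 5 ℤ.* j ℤ.+ + 1) ⊕ F (+ 5 ℤ.* j ℤ.+ + 2) ⊕ F (+ 5 ℤ.* j ℤ.+ + 3) ⊕ F (+ 5 ℤ.* j ℤ.+ + 4)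
  sum<-fives : ∀ n g → sum< n (λ i → g (i ℕ.* 5) ⊕ g (1 ℕ.+ i ℕ.* 5) ⊕ g (2 ℕ.+ i ℕ.* 5) ⊕ g (3 ℕ.+ i ℕ.* 5) ⊕ g (4 ℕ.+ i ℕ.* 5)) ≈ sum< (n ℕ.* 5) g
  sum<-fives zero    g = ≈-refl
  sum<-fives (suc n) g = ≈-trans (⊕-cong (sum<-fives n g) ≈-refl)
    (solve 6 (λ x a b c d e → x :+ (a :+ b :+ c :+ d :+ e) := x :+ a :+ b :+ c :+ d :+ e) ≈-refl
      (sum< (n ℕ.* 5) g) (g (n ℕ.* 5)) (g (1 ℕ.+ n ℕ.* 5)) (g (2 ℕ.+ n ℕ.* 5)) (g (3 ℕ.+ n ℕ.* 5)) (g (4 ℕ.+ n ℕ.* 5)))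
  F≡ : ∀ {i j} → i ≡ j → F i ≈ F j
  F≡ i≡j n = cong (λ i → F i n) i≡j
  positive : ∀ i → + (i ℕ.* 5) ≡ + 5 ℤ.* + i
  positive i = trans (ℤ.pos-* i 5) (ℤ.*-comm (+ i) (+ 5))
  negative : ∀ r i → -[1+ r ℕ.+ i ℕ.* 5 ] ≡ ℤ.- (1ℤ ℤ.+ (+ r ℤ.+ + i ℤ.* + 5))
  negative r i = cong (λ u → ℤ.- (1ℤ ℤ.+ (+ r ℤ.+ u))) (ℤ.pos-* i 5)
  up : ∀ i → G (+ i) ≈ F (+ (i ℕ.* 5)) ⊕ F (+ (1 ℕ.+ i ℕ.* 5)) ⊕ F (+ (2 ℕ.+ i ℕ.* 5)) ⊕ F (+ (3 ℕ.+ i ℕ.* 5)) ⊕ F (+ (4 ℕ.+ i ℕ.* 5))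
  up i = ⊕-cong (⊕-cong (⊕-cong (⊕-cong (F≡ (sym (positive i))) (at 1)) (at 2)) (at 3)) (at 4)
    where
    at : ∀ r → F (+ 5 ℤ.* + i ℤ.+ + r) ≈ F (+ (r ℕ.+ i ℕ.* 5))
    at r = F≡ (trans (ℤ.+-comm (+ 5 ℤ.* + i) (+ r)) (cong (λ u → + r ℤ.+ u) (sym (positive i))))
  down : ∀ i → G -[1+ i ] ≈ F -[1+ i ℕ.* 5 ] ⊕ F -[1+ 1 ℕ.+ i ℕ.* 5 ] ⊕ F -[1+ 2 ℕ.+ i ℕ.* 5 ] ⊕ F -[1+ 3 ℕ.+ i ℕ.* 5 ] ⊕ F -[1+ 4 ℕ.+ i ℕ.* 5 ]
  down i = ≈-trans
    (⊕-cong (⊕-cong (⊕-cong (⊕-cong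
      -- On the negative side 5(-1-i) + 4 - r = -1 - (r + 5i), so the five residues appear in
      -- reverse order.
      (F≡ (trans (ℤsolve 1 (λ i → conᶻ (+ 5) :*ᶻ (-ᶻ (conᶻ 1ℤ :+ᶻ i)) :=ᶻ -ᶻ (conᶻ 1ℤ :+ᶻ (conᶻ (+ 4) :+ᶻ i :*ᶻ conᶻ (+ 5)))) refl (+ i)) (sym (negative 4 i))))
      (F≡ (trans (ℤsolve 1 (λ i → conᶻ (+ 5) :*ᶻ (-ᶻ (conᶻ 1ℤ :+ᶻ i)) :+ᶻ conᶻ (+ 1) :=ᶻ -ᶻ (conᶻ 1ℤ :+ᶻ (conᶻ (+ 3) :+ᶻ i :*ᶻ conᶻ (+ 5)))) refl (+ i)) (sym (negative 3 i)))))
      (F≡ (trans (ℤsolve 1 (λ i → conᶻ (+ 5) :*ᶻ (-ᶻ (conᶻ 1ℤ :+ᶻ i)) :+ᶻ conᶻ (+ 2) :=ᶻ -ᶻ (conᶻ 1ℤ :+ᶻ (conᶻ (+ 2) :+ᶻ i :*ᶻ conᶻ (+ 5)))) refl (+ i)) (sym (negative 2 i)))))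
      (F≡ (trans (ℤsolve 1 (λ i → conᶻ (+ 5) :*ᶻ (-ᶻ (conᶻ 1ℤ :+ᶻ i)) :+ᶻ conᶻ (+ 3) :=ᶻ -ᶻ (conᶻ 1ℤ :+ᶻ (conᶻ (+ 1) :+ᶻ i :*ᶻ conᶻ (+ 5)))) refl (+ i)) (sym (negative 1 i)))))
      (F≡ (trans (ℤsolve 1 (λ i → conᶻ (+ 5) :*ᶻ (-ᶻ (conᶻ 1ℤ :+ᶻ i)) :+ᶻ conᶻ (+ 4) :=ᶻ -ᶻ (conᶻ 1ℤ :+ᶻ (conᶻ (+ 0) :+ᶻ i :*ᶻ conᶻ (+ 5)))) refl (+ i)) (sym (negative 0 i)))))
    (solve 5 (λ a b c d e → e :+ d :+ c :+ b :+ a := a :+ b :+ c :+ d :+ e) ≈-refl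
      (F -[1+ i ℕ.* 5 ]) (F -[1+ 1 ℕ.+ i ℕ.* 5 ]) (F -[1+ 2 ℕ.+ i ℕ.* 5 ]) (F -[1+ 3 ℕ.+ i ℕ.* 5 ]) (F -[1+ 4 ℕ.+ i ℕ.* 5 ]))
  group : ∀ m n → window G m n ≈ window F (m ℕ.* 5) (n ℕ.* 5)
  group m n = ⊕-cong (≈-trans (sum<-cong m down) (sum<-fives m λ i → F -[1+ i ]))
                     (≈-trans (sum<-cong n up) (sum<-fives n λ i → F (+ i)))

-- q-adic decay and the interchange of double sums

Supported : ℕ → (ℤ → PowerSeries) → Set
Supported M F = ∀ j → M ≤ ℤ.∣ j ∣ → F j ≈[ M ] constant 0ℤ

sum<-stable : ∀ {g M m n} → (∀ i → m ≤ i → g i ≈[ M ] constant 0ℤ) → m ≤ n → sum< n g ≈[ M ] sum< m g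
sum<-stable {g} {M} {m} z m≤n = go (ℕ.≤⇒≤′ m≤n)
  where
  go : ∀ {n} → m ℕ.≤′ n → sum< n g ≈[ M ] sum< m g
  go ℕ.≤′-refl = ≈[]-refl
  go {suc n} (ℕ.≤′-step m≤′n) = ≈[]-trans (⊕-≈[] (go m≤′n) (z n (ℕ.≤′⇒≤ m≤′n)))
    (≈[]-all (solve 1 (λ x → x :+ con 0ℤ := x) ≈-refl (sum< m g)))

window-stable : ∀ {F M m n} → Supported M F → M ≤ m → M ≤ n → window F m n ≈[ M ] window F M M
window-stable z M≤m M≤n = ⊕-≈[] (sum<-stable (λ i M≤i → z -[1+ i ] (ℕ.m≤n⇒m≤1+n M≤i)) M≤m) (sum<-stable (λ i M≤i → z (+ i) M≤i) M≤n)

-- Decay replaces the unspecified bound of `HasSum` by M itself, giving a finite sum that is exact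
-- modulo q^M.
Supported-sum : ∀ {F M S m n} → Supported M F → HasSum F S → M ≤ m → M ≤ n → window F m n ≈[ M ] S
Supported-sum {F} {M} z s M≤m M≤n = let N , p = sums s M in
  ≈[]-trans (window-stable z M≤m M≤n)
    (≈[]-trans (≈[]-sym (window-stable z (ℕ.m≤m⊔n M N) (ℕ.m≤m⊔n M N))) (p (M ℕ.⊔ N) (M ℕ.⊔ N) (ℕ.m≤n⊔m M N) (ℕ.m≤n⊔m M N)))

Supported-limit : ∀ {F M S} → (∀ j → F j ≈[ M ] constant 0ℤ) → HasSum F S → S ≈[ M ] constant 0ℤ
Supported-limit {F} {M} z s = ≈[]-trans (≈[]-sym (Supported-sum (λ j _ → z j) s ℕ.≤-refl ℕ.≤-refl))
  (≈[]-trans (window-stable {m = M} {n = M} (λ j _ → z j) ℕ.≤-refl ℕ.≤-refl)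
    (≈[]-trans (window-≈[] M M z) (≈[]-all (zeros M M))))
  where
  sum<-0 : ∀ n → sum< n (λ _ → constant 0ℤ) ≈ constant 0ℤ
  sum<-0 zero    = ≈-refl
  sum<-0 (suc n) = ≈-trans (⊕-cong (sum<-0 n) ≈-refl) (solve 0 (con 0ℤ :+ con 0ℤ := con 0ℤ) ≈-refl)
  zeros : ∀ m n → window (λ _ → constant 0ℤ) m n ≈ constant 0ℤ
  zeros m n = ≈-trans (⊕-cong (sum<-0 m) (sum<-0 n)) (solve 0 (con 0ℤ :+ con 0ℤ := con 0ℤ) ≈-refl)

window-swap : ∀ (G : ℤ → ℤ → PowerSeries) m n k l →
  window (λ x → window (G x) k l) m n ≈ window (λ y → window (λ x → G x y) m n) k l
window-swap G m n k l = begin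
  window (λ x → window (G x) k l) m n
    ≈⟨ ⊕-cong (sum<-⊕ m _ _) (sum<-⊕ n _ _) ⟩
  A ⊕ B ⊕ (C ⊕ D)
    ≈⟨ solve 4 (λ x y z w → x :+ y :+ (z :+ w) := x :+ z :+ (y :+ w)) ≈-refl A B C D ⟩
  A ⊕ C ⊕ (B ⊕ D)
    ≈⟨ ⊕-cong (⊕-cong (sum<-swap m k _) (sum<-swap n k _)) (⊕-cong (sum<-swap m l _) (sum<-swap n l _)) ⟩
  _ ≈⟨ ⊕-cong (sum<-⊕ k _ _) (sum<-⊕ l _ _) ⟨
  window (λ y → window (λ x → G x y) m n) k l ∎
  where
  open ≈-Reasoning
  A B C D : PowerSeries
  A = sum< m λ i → sum< k λ j → G -[1+ i ] -[1+ j ]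
  B = sum< m λ i → sum< l λ j → G -[1+ i ] (+ j)
  C = sum< n λ i → sum< k λ j → G (+ i) -[1+ j ]
  D = sum< n λ i → sum< l λ j → G (+ i) (+ j)

-- Modulo q^M the decay in y, uniform in x, truncates every inner sum to the same window, and the
-- finite sums can be exchanged. Decay in x then recovers `R y`, and the tail of R vanishes because
-- all its terms do.
HasSum-swap : ∀ {G : ℤ → ℤ → PowerSeries} {R R′ : ℤ → PowerSeries} {S} →
  (∀ M x → Supported M (G x)) → (∀ M y → Supported M (λ x → G x y)) →
  (∀ y → HasSum (λ x → G x y) (R y)) → HasSum R S → (∀ x → HasSum (G x) (R′ x)) → HasSum R′ S
sums (HasSum-swap {G} {R} {R′} zy zx r s r′) M = M , λ m n M≤m M≤n → ≈[]-trans
  (window-≈[] m n λ x → ≈[]-sym (Supported-sum (zy M x) (r′ x) ℕ.≤-refl ℕ.≤-refl))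
  (≈[]-trans (≈[]-all (window-swap G m n M M))
  (≈[]-trans (window-≈[] M M λ y → Supported-sum (zx M y) (r y) M≤m M≤n)
  (Supported-sum (λ y M≤∣y∣ → Supported-limit (λ x → zy M x y M≤∣y∣) (r y)) s ℕ.≤-refl ℕ.≤-refl)))

-- Infinite products and the Jacobi triple product

q^-≡ : ∀ {m n} → m ≡ n → q^ m ≈ q^ n
q^-≡ m≡n k = cong (λ j → (q^ j) k) m≡n

q^-≈[]-0 : ∀ {M m} → M ≤ m → q^ m ≈[ M ] constant 0ℤ
q^-≈[]-0 {M} {m} M≤m n n<M = trans (q^-below (ℕ.<-≤-trans n<M M≤m)) (0#≈constant n)

opaque
  unfolding _⊕_

  ⊗-inverse : ∀ a → a 0 ≡ 1ℤ → a ⊗ a ⁻¹ ≈ constant 1ℤ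
  ⊗-inverse a a₀≡1 = ≈-trans (*-inverseʳ a a₀≡1) 1#≈constant

  ∏<-unfold : ∀ N a → ∏< (suc N) a ≈ a N ⊗ ∏< N a
  ∏<-unfold N a _ = refl

  factor-unfold : ∀ m → 1# - q^ m ≈ 1# ⊕ ⊖ (q^ m)
  factor-unfold m _ = refl

prod< : ℕ → (ℕ → PowerSeries) → PowerSeries
prod< zero    g = constant 1ℤ
prod< (suc n) g = prod< n g ⊗ g n

prod<-≈[] : ∀ n {g h M} → (∀ i → i < n → g i ≈[ M ] h i) → prod< n g ≈[ M ] prod< n h
prod<-≈[] zero    p = ≈[]-refl
prod<-≈[] (suc n) p = ⊗-≈[] (prod<-≈[] n λ i i<n → p i (ℕ.m≤n⇒m≤1+n i<n)) (p n ℕ.≤-refl)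

prod<-cong : ∀ n {g h} → (∀ i → g i ≈ h i) → prod< n g ≈ prod< n h
prod<-cong n p = ≈[]-limit λ M → prod<-≈[] n λ i _ → ≈[]-all (p i)

prod<-⊗ : ∀ n g h → prod< n (λ i → g i ⊗ h i) ≈ prod< n g ⊗ prod< n h
prod<-⊗ zero    g h = solve 0 (con 1ℤ := con 1ℤ :* con 1ℤ) ≈-refl
prod<-⊗ (suc n) g h = ≈-trans (⊗-cong (prod<-⊗ n g h) ≈-refl)
  (solve 4 (λ x y z w → x :* y :* (z :* w) := x :* z :* (y :* w)) ≈-refl (prod< n g) (prod< n h) (g n) (h n))

prod<-+ : ∀ m n g → prod< (n ℕ.+ m) g ≈ prod< m g ⊗ prod< n (λ i → g (i ℕ.+ m))
prod<-+ m zero    g = solve 1 (λ x → x := x :* con 1ℤ) ≈-refl (prod< m g)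
prod<-+ m (suc n) g = ≈-trans (⊗-cong (prod<-+ m n g) ≈-refl) (⊗-assoc (prod< m g) _ _)

prod<-first : ∀ n g → prod< (suc n) g ≈ g 0 ⊗ prod< n (g ∘ suc)
prod<-first zero    g = ⊗-comm _ (g 0)
prod<-first (suc n) g = ≈-trans (⊗-cong (prod<-first n g) ≈-refl) (⊗-assoc (g 0) _ _)

prod<-split : ∀ m N g → prod< (N ℕ.* m) g ≈ prod< m (λ j → prod< N (λ i → g (j ℕ.+ i ℕ.* m)))
prod<-split m zero g = ones m
  where
  ones : ∀ m → constant 1ℤ ≈ prod< m (λ _ → constant 1ℤ)
  ones zero    = ≈-refl
  ones (suc m) = ≈-trans (solve 0 (con 1ℤ := con 1ℤ :* con 1ℤ) ≈-refl) (⊗-cong (ones m) ≈-refl)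
prod<-split m (suc N) g = begin
  prod< (m ℕ.+ N ℕ.* m) g
    ≈⟨ (λ n → cong (λ k → prod< k g n) (ℕ.+-comm m (N ℕ.* m))) ⟩
  prod< (N ℕ.* m ℕ.+ m) g
    ≈⟨ prod<-+ m (N ℕ.* m) g ⟩
  prod< m g ⊗ prod< (N ℕ.* m) (λ i → g (i ℕ.+ m))
    ≈⟨ ⊗-cong ≈-refl (prod<-split m N (λ i → g (i ℕ.+ m))) ⟩
  prod< m g ⊗ prod< m (λ j → prod< N (λ i → g (j ℕ.+ i ℕ.* m ℕ.+ m)))
    ≈⟨ prod<-⊗ m g _ ⟨
  prod< m (λ j → g j ⊗ prod< N (λ i → g (j ℕ.+ i ℕ.* m ℕ.+ m)))
    ≈⟨ prod<-cong m (λ j → ⊗-cong (λ n → cong (λ k → g k n) (sym (ℕ.+-identityʳ j)))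
         (prod<-cong N λ i n → cong (λ k → g k n) (trans (ℕ.+-assoc j (i ℕ.* m) m) (cong (j ℕ.+_) (ℕ.+-comm (i ℕ.* m) m))))) ⟩
  prod< m (λ j → g (j ℕ.+ 0) ⊗ prod< N (λ i → g (j ℕ.+ suc i ℕ.* m)))
    ≈⟨ prod<-cong m (λ j → prod<-first N (λ i → g (j ℕ.+ i ℕ.* m))) ⟨
  prod< m (λ j → prod< (suc N) (λ i → g (j ℕ.+ i ℕ.* m))) ∎
  where open ≈-Reasoning

factor : ℕ → PowerSeries
factor m = constant 1ℤ ⊕ ⊖ (q^ m)

-- (q^a ; q^c)_N and (q^a ; q^c)_∞
poch< : ℕ → ℕ → ℕ → PowerSeries
poch< c a N = prod< N (λ i → factor (a ℕ.+ c ℕ.* i))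

poch : ℕ → ℕ → PowerSeries
poch c a n = poch< c a n n

factor-≈[] : ∀ {M m} → M ≤ m → factor m ≈[ M ] constant 1ℤ
factor-≈[] {M} {m} M≤m = ≈[]-trans (⊕-≈[] (≈[]-refl {constant 1ℤ}) λ n n<M → trans (⊖-coeff (q^ m) n)
    (trans (cong ℤ.-_ (q^-≈[]-0 M≤m n n<M)) (sym (⊖-coeff (constant 0ℤ) n))))
  (≈[]-all (solve 0 (con 1ℤ :+ :- con 0ℤ := con 1ℤ) ≈-refl))

exponent-large : ∀ {c a} → 1 ≤ c → 1 ≤ a → ∀ i → i < a ℕ.+ c ℕ.* i
exponent-large 1≤c 1≤a i = ℕ.+-mono-≤ 1≤a (ℕ.≤-trans (ℕ.≤-reflexive (sym (ℕ.*-identityˡ i))) (ℕ.*-monoˡ-≤ i 1≤c))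

poch-stable : ∀ {c a} → 1 ≤ c → 1 ≤ a → ∀ {M N} → M ≤ N → poch< c a N ≈[ M ] poch c a
poch-stable {c} {a} 1≤c 1≤a M≤N n n<M = go (ℕ.≤⇒≤′ (ℕ.≤-trans (ℕ.<⇒≤ n<M) M≤N))
  where
  go : ∀ {n N} → n ℕ.≤′ N → poch< c a N n ≡ poch c a n
  go ℕ.≤′-refl = refl
  go {n} {suc N} (ℕ.≤′-step n≤′N) = trans
    (⊗-≈[] {M = suc n} (≈[]-refl {poch< c a N}) (factor-≈[] (ℕ.≤-trans (s≤s (ℕ.≤′⇒≤ n≤′N)) (exponent-large 1≤c 1≤a N))) n ℕ.≤-refl)
    (trans (solve 1 (λ x → x :* con 1ℤ := x) ≈-refl (poch< c a N) n) (go n≤′N))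

-- The factors are sorted by their index modulo m. On finite products with M m factors this is
-- exact, and `poch-stable` passes to the limit.
poch-split : ∀ {c a} → 1 ≤ c → 1 ≤ a → ∀ m → 1 ≤ m → poch c a ≈ prod< m (λ j → poch (c ℕ.* m) (a ℕ.+ c ℕ.* j))
poch-split {c} {a} 1≤c 1≤a m 1≤m = ≈[]-limit λ M →
  ≈[]-trans (≈[]-sym (poch-stable 1≤c 1≤a (ℕ.≤-trans (ℕ.≤-reflexive (sym (ℕ.*-identityʳ M))) (ℕ.*-monoʳ-≤ M 1≤m))))
  (≈[]-trans (≈[]-all (prod<-split m M _))
  (prod<-≈[] m λ j _ → ≈[]-trans
    (≈[]-all (prod<-cong M λ i → ⊕-cong ≈-refl (⊖-cong (q^-≡ (index j i)))))
    (poch-stable (ℕ.*-mono-≤ 1≤c 1≤m) (ℕ.≤-trans 1≤a (ℕ.m≤m+n a (c ℕ.* j))) ℕ.≤-refl)))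
  where
  open ℕ-Solver.+-*-Solver using () renaming (solve to ℕsolve; _:=_ to _:=ⁿ_; _:+_ to _:+ⁿ_; _:*_ to _:*ⁿ_)
  index : ∀ j i → a ℕ.+ c ℕ.* (j ℕ.+ i ℕ.* m) ≡ a ℕ.+ c ℕ.* j ℕ.+ c ℕ.* m ℕ.* i
  index j i = ℕsolve 5 (λ a c j i m → a :+ⁿ c :*ⁿ (j :+ⁿ i :*ⁿ m) :=ⁿ a :+ⁿ c :*ⁿ j :+ⁿ c :*ⁿ m :*ⁿ i) refl a c j i m

f≈poch : ∀ k .{{_ : NonZero k}} → f k ≈ poch k k
f≈poch k n = go n n
  where
  go : ∀ N → ∏< N (λ i → 1# - q^ (k ℕ.* suc i)) ≈ poch< k k N
  go zero    = 1#≈constant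
  go (suc N) = begin
    _ ≈⟨ ∏<-unfold N (λ i → 1# - q^ (k ℕ.* suc i)) ⟩
    (1# - q^ (k ℕ.* suc N)) ⊗ ∏< N (λ i → 1# - q^ (k ℕ.* suc i))
      ≈⟨ ⊗-cong (≈-trans (factor-unfold (k ℕ.* suc N)) (⊕-cong 1#≈constant (⊖-cong (q^-≡ (ℕ.*-suc k N))))) (go N) ⟩
    factor (k ℕ.+ k ℕ.* N) ⊗ poch< k k N
      ≈⟨ ⊗-comm (factor (k ℕ.+ k ℕ.* N)) (poch< k k N) ⟩
    poch< k k (suc N) ∎
    where open ≈-Reasoning

poch<-0 : ∀ {c a} → 1 ≤ a → ∀ N → poch< c a N 0 ≡ 1ℤ
poch<-0 1≤a zero    = refl
poch<-0 {c} {a} 1≤a (suc N) = trans (⊗-coeff-0 (poch< c a N) (factor (a ℕ.+ c ℕ.* N)))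
  (cong₂ ℤ._*_ (poch<-0 {c} 1≤a N) (factor-≈[] (ℕ.≤-trans 1≤a (ℕ.m≤m+n a _)) 0 ℕ.≤-refl))

-- Signs and exponents of theta series

alternating : ℕ → ℤ
alternating zero    = 1ℤ
alternating (suc n) = ℤ.- alternating n

-- (-1)^j
sign : ℤ → ℤ
sign j = alternating ℤ.∣ j ∣

sign-pred : ∀ j → sign (ℤ.pred j) ≡ ℤ.- sign j
sign-pred (+ zero)  = refl
sign-pred (+ suc n) = sym (ℤ.neg-involutive (alternating n))
sign-pred -[1+ n ]  = refl

sign-neg : ∀ j → sign (ℤ.- j) ≡ sign j
sign-neg j = cong alternating (ℤ.∣-i∣≡∣i∣ j)

triangular : ℕ → ℕ
triangular zero    = 0
triangular (suc n) = suc n ℕ.+ triangular n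

triangular-pos : ∀ n → + 2 ℤ.* + triangular n ≡ + n ℤ.* (1ℤ ℤ.+ + n)
triangular-pos zero    = refl
triangular-pos (suc n) = trans (ℤ.*-distribˡ-+ (+ 2) (1ℤ ℤ.+ + n) (+ triangular n)) (trans (cong (λ u → + 2 ℤ.* (1ℤ ℤ.+ + n) ℤ.+ u) (triangular-pos n))
  (ℤsolve 1 (λ n → conᶻ (+ 2) :*ᶻ (conᶻ 1ℤ :+ᶻ n) :+ᶻ n :*ᶻ (conᶻ 1ℤ :+ᶻ n) :=ᶻ (conᶻ 1ℤ :+ᶻ n) :*ᶻ (conᶻ 1ℤ :+ᶻ (conᶻ 1ℤ :+ᶻ n))) refl (+ n)))

n≤triangular : ∀ n → n ≤ triangular n
n≤triangular zero    = z≤n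
n≤triangular (suc n) = ℕ.m≤m+n (suc n) (triangular n)

-- The exponent a j(j+1)/2 + b j(j-1)/2.
theta-exponent : ℕ → ℕ → ℤ → ℕ
theta-exponent a b (+ zero)  = 0
theta-exponent a b (+ suc n) = a ℕ.* triangular (suc n) ℕ.+ b ℕ.* triangular n
theta-exponent a b -[1+ n ]  = a ℕ.* triangular n ℕ.+ b ℕ.* triangular (suc n)

-- Ramanujan's f(-q^a, -q^b) is the sum of these terms.
theta-term : ℕ → ℕ → ℤ → PowerSeries
theta-term a b j = constant (sign j) ⊗ q^ (theta-exponent a b j)

-- With the halves cleared the exponent is a polynomial in j over ℤ, without the case distinction on
-- its sign. Identities between exponents are proved in this form by the solver and halved by
-- `exponent-from-twice`.
twice-theta-exponent : ∀ a b j → + 2 ℤ.* + theta-exponent a b j ≡ + a ℤ.* (j ℤ.* (j ℤ.+ 1ℤ)) ℤ.+ + b ℤ.* (j ℤ.* (j ℤ.+ ℤ.- 1ℤ))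
twice-theta-exponent a b (+ zero) = ℤsolve 2 (λ a b → conᶻ (+ 2) :*ᶻ conᶻ 0ℤ :=ᶻ a :*ᶻ (conᶻ 0ℤ :*ᶻ (conᶻ 0ℤ :+ᶻ conᶻ 1ℤ)) :+ᶻ b :*ᶻ (conᶻ 0ℤ :*ᶻ (conᶻ 0ℤ :+ᶻ -ᶻ conᶻ 1ℤ))) refl (+ a) (+ b)
twice-theta-exponent a b (+ suc n) = begin
  + 2 ℤ.* + (a ℕ.* triangular (suc n) ℕ.+ b ℕ.* triangular n)
    ≡⟨ cong (+ 2 ℤ.*_) (trans (ℤ.pos-+ (a ℕ.* triangular (suc n)) _) (cong₂ ℤ._+_ (ℤ.pos-* a (triangular (suc n))) (ℤ.pos-* b (triangular n)))) ⟩
  + 2 ℤ.* (+ a ℤ.* + triangular (suc n) ℤ.+ + b ℤ.* + triangular n)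
    ≡⟨ ℤsolve 4 (λ a b s t → conᶻ (+ 2) :*ᶻ (a :*ᶻ s :+ᶻ b :*ᶻ t) :=ᶻ a :*ᶻ (conᶻ (+ 2) :*ᶻ s) :+ᶻ b :*ᶻ (conᶻ (+ 2) :*ᶻ t)) refl (+ a) (+ b) (+ triangular (suc n)) (+ triangular n) ⟩
  + a ℤ.* (+ 2 ℤ.* + triangular (suc n)) ℤ.+ + b ℤ.* (+ 2 ℤ.* + triangular n)
    ≡⟨ cong₂ (λ s t → + a ℤ.* s ℤ.+ + b ℤ.* t) (triangular-pos (suc n)) (triangular-pos n) ⟩
  + a ℤ.* ((1ℤ ℤ.+ + n) ℤ.* (1ℤ ℤ.+ (1ℤ ℤ.+ + n))) ℤ.+ + b ℤ.* (+ n ℤ.* (1ℤ ℤ.+ + n))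
    ≡⟨ ℤsolve 3 (λ a b n → a :*ᶻ ((conᶻ 1ℤ :+ᶻ n) :*ᶻ (conᶻ 1ℤ :+ᶻ (conᶻ 1ℤ :+ᶻ n))) :+ᶻ b :*ᶻ (n :*ᶻ (conᶻ 1ℤ :+ᶻ n)) :=ᶻ
         a :*ᶻ ((conᶻ 1ℤ :+ᶻ n) :*ᶻ ((conᶻ 1ℤ :+ᶻ n) :+ᶻ conᶻ 1ℤ)) :+ᶻ b :*ᶻ ((conᶻ 1ℤ :+ᶻ n) :*ᶻ ((conᶻ 1ℤ :+ᶻ n) :+ᶻ -ᶻ conᶻ 1ℤ))) refl (+ a) (+ b) (+ n) ⟩
  + a ℤ.* (+ suc n ℤ.* (+ suc n ℤ.+ 1ℤ)) ℤ.+ + b ℤ.* (+ suc n ℤ.* (+ suc n ℤ.+ ℤ.- 1ℤ)) ∎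
  where open ≡-Reasoning
twice-theta-exponent a b -[1+ n ] = begin
  + 2 ℤ.* + (a ℕ.* triangular n ℕ.+ b ℕ.* triangular (suc n))
    ≡⟨ cong (+ 2 ℤ.*_) (trans (ℤ.pos-+ (a ℕ.* triangular n) _) (cong₂ ℤ._+_ (ℤ.pos-* a (triangular n)) (ℤ.pos-* b (triangular (suc n))))) ⟩
  + 2 ℤ.* (+ a ℤ.* + triangular n ℤ.+ + b ℤ.* + triangular (suc n))
    ≡⟨ ℤsolve 4 (λ a b s t → conᶻ (+ 2) :*ᶻ (a :*ᶻ s :+ᶻ b :*ᶻ t) :=ᶻ a :*ᶻ (conᶻ (+ 2) :*ᶻ s) :+ᶻ b :*ᶻ (conᶻ (+ 2) :*ᶻ t)) refl (+ a) (+ b) (+ triangular n) (+ triangular (suc n)) ⟩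
  + a ℤ.* (+ 2 ℤ.* + triangular n) ℤ.+ + b ℤ.* (+ 2 ℤ.* + triangular (suc n))
    ≡⟨ cong₂ (λ s t → + a ℤ.* s ℤ.+ + b ℤ.* t) (triangular-pos n) (triangular-pos (suc n)) ⟩
  + a ℤ.* (+ n ℤ.* (1ℤ ℤ.+ + n)) ℤ.+ + b ℤ.* ((1ℤ ℤ.+ + n) ℤ.* (1ℤ ℤ.+ (1ℤ ℤ.+ + n)))
    ≡⟨ ℤsolve 3 (λ a b n → a :*ᶻ (n :*ᶻ (conᶻ 1ℤ :+ᶻ n)) :+ᶻ b :*ᶻ ((conᶻ 1ℤ :+ᶻ n) :*ᶻ (conᶻ 1ℤ :+ᶻ (conᶻ 1ℤ :+ᶻ n))) :=ᶻ
         a :*ᶻ ((-ᶻ (conᶻ 1ℤ :+ᶻ n)) :*ᶻ ((-ᶻ (conᶻ 1ℤ :+ᶻ n)) :+ᶻ conᶻ 1ℤ)) :+ᶻ b :*ᶻ ((-ᶻ (conᶻ 1ℤ :+ᶻ n)) :*ᶻ ((-ᶻ (conᶻ 1ℤ :+ᶻ n)) :+ᶻ -ᶻ conᶻ 1ℤ))) refl (+ a) (+ b) (+ n) ⟩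
  + a ℤ.* (-[1+ n ] ℤ.* (-[1+ n ] ℤ.+ 1ℤ)) ℤ.+ + b ℤ.* (-[1+ n ] ℤ.* (-[1+ n ] ℤ.+ ℤ.- 1ℤ)) ∎
  where open ≡-Reasoning

exponent-from-twice : ∀ {m n} → + 2 ℤ.* + m ≡ + 2 ℤ.* + n → m ≡ n
exponent-from-twice p = ℤ.+-injective (ℤ.*-cancelˡ-≡ (+ 2) _ _ p)

theta-exponent-large : ∀ {a b} → 1 ≤ a → 1 ≤ b → ∀ j → ℤ.∣ j ∣ ≤ theta-exponent a b j
theta-exponent-large 1≤a 1≤b (+ zero) = z≤n
theta-exponent-large {a} {b} 1≤a 1≤b (+ suc n) = ℕ.≤-trans (n≤triangular (suc n))
  (ℕ.≤-trans (ℕ.≤-reflexive (sym (ℕ.*-identityˡ _))) (ℕ.≤-trans (ℕ.*-monoˡ-≤ _ 1≤a) (ℕ.m≤m+n _ _)))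
theta-exponent-large {a} {b} 1≤a 1≤b -[1+ n ] = ℕ.≤-trans (n≤triangular (suc n))
  (ℕ.≤-trans (ℕ.≤-reflexive (sym (ℕ.*-identityˡ _))) (ℕ.≤-trans (ℕ.*-monoˡ-≤ _ 1≤b) (ℕ.m≤n+m _ _)))

theta-exponent-neg : ∀ a b j → theta-exponent a b (ℤ.- j) ≡ theta-exponent b a j
theta-exponent-neg a b j = exponent-from-twice (trans (twice-theta-exponent a b (ℤ.- j)) (trans
  (ℤsolve 3 (λ a b j → a :*ᶻ ((-ᶻ j) :*ᶻ ((-ᶻ j) :+ᶻ conᶻ 1ℤ)) :+ᶻ b :*ᶻ ((-ᶻ j) :*ᶻ ((-ᶻ j) :+ᶻ -ᶻ conᶻ 1ℤ)) :=ᶻ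
     b :*ᶻ (j :*ᶻ (j :+ᶻ conᶻ 1ℤ)) :+ᶻ a :*ᶻ (j :*ᶻ (j :+ᶻ -ᶻ conᶻ 1ℤ))) refl (+ a) (+ b) j)
  (sym (twice-theta-exponent b a j))))

theta-term-neg : ∀ a b j → theta-term a b (ℤ.- j) ≈ theta-term b a j
theta-term-neg a b j = ⊗-cong (λ n → cong (λ z → constant z n) (sign-neg j)) (q^-≡ (theta-exponent-neg a b j))

q^-large : ∀ {M m} z → M ≤ m → constant z ⊗ q^ m ≈[ M ] constant 0ℤ
q^-large z M≤m = ≈[]-trans (⊗-≈[] (≈[]-refl {constant z}) (q^-≈[]-0 M≤m)) (≈[]-all (solve 1 (λ z → z :* con 0ℤ := con 0ℤ) ≈-refl (constant z)))

theta-term-supported : ∀ {a b} → 1 ≤ a → 1 ≤ b → ∀ M → Supported M (theta-term a b)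
theta-term-supported 1≤a 1≤b M j M≤∣j∣ = q^-large (sign j) (ℕ.≤-trans M≤∣j∣ (theta-exponent-large 1≤a 1≤b j))

-- The finite q-binomial theorem

natural-part : ℤ → ℕ
natural-part (+ n)    = n
natural-part -[1+ n ] = 0

-- 1/(q^c ; q^c)_x, which is 0 for x < 0.
inverse-poch : ℕ → ℤ → PowerSeries
inverse-poch c (+ k)    = poch< c c k ⁻¹
inverse-poch c -[1+ k ] = constant 0ℤ

module _ {c : ℕ} (1≤c : 1 ≤ c) where

  poch<-inverse : ∀ k → poch< c c k ⊗ inverse-poch c (+ k) ≈ constant 1ℤ
  poch<-inverse k = ⊗-inverse (poch< c c k) (poch<-0 {c} 1≤c k)

  -- Valid for all integers x: at 0 the factor 1 - q⁰ vanishes, in agreement with the value 0 of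
  -- `inverse-poch` at -1, and below 0 both sides are 0 whatever `natural-part` returns.
  inverse-poch-pred : ∀ x → inverse-poch c (ℤ.pred x) ≈ factor (c ℕ.* natural-part x) ⊗ inverse-poch c x
  inverse-poch-pred (+ zero) = begin
    constant 0ℤ
      ≈⟨ solve 1 (λ r → con 0ℤ := (con 1ℤ :+ :- con 1ℤ) :* r) ≈-refl _ ⟩
    (constant 1ℤ ⊕ ⊖ constant 1ℤ) ⊗ inverse-poch c (+ 0)
      ≈⟨ ⊗-cong (⊕-cong ≈-refl (⊖-cong (≈-trans (≈-sym 1#≈constant) (q^-≡ (sym (ℕ.*-zeroʳ c)))))) ≈-refl ⟩
    factor (c ℕ.* 0) ⊗ inverse-poch c (+ 0) ∎
    where open ≈-Reasoning
  inverse-poch-pred (+ suc k) = begin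
    r
      ≈⟨ solve 1 (λ r → r := con 1ℤ :* r) ≈-refl r ⟩
    constant 1ℤ ⊗ r
      ≈⟨ ⊗-cong (≈-sym (poch<-inverse (suc k))) ≈-refl ⟩
    p ⊗ factor (c ℕ.+ c ℕ.* k) ⊗ r′ ⊗ r
      ≈⟨ solve 4 (λ p u r′ r → p :* u :* r′ :* r := p :* r :* (u :* r′)) ≈-refl p (factor (c ℕ.+ c ℕ.* k)) r′ r ⟩
    p ⊗ r ⊗ (factor (c ℕ.+ c ℕ.* k) ⊗ r′)
      ≈⟨ ⊗-cong (poch<-inverse k) (⊗-cong (⊕-cong ≈-refl (⊖-cong (q^-≡ (sym (ℕ.*-suc c k))))) ≈-refl) ⟩
    constant 1ℤ ⊗ (factor (c ℕ.* suc k) ⊗ r′)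
      ≈⟨ solve 1 (λ r → con 1ℤ :* r := r) ≈-refl _ ⟩
    factor (c ℕ.* suc k) ⊗ r′ ∎
    where
    open ≈-Reasoning
    p r r′ : PowerSeries
    p  = poch< c c k
    r  = inverse-poch c (+ k)
    r′ = inverse-poch c (+ suc k)
  inverse-poch-pred -[1+ n ] = solve 1 (λ u → con 0ℤ := u :* con 0ℤ) ≈-refl _

  inverse-poch-∞ : poch c c ⊗ poch c c ⁻¹ ≈ constant 1ℤ
  inverse-poch-∞ = ⊗-inverse (poch c c) refl

  inverse-poch-limit : ∀ {M} k → M ≤ k → inverse-poch c (+ k) ≈[ M ] poch c c ⁻¹
  inverse-poch-limit {M} k M≤k = ≈[]-trans
    (≈[]-all (≈-trans (solve 1 (λ r → r := r :* con 1ℤ) ≈-refl r) (⊗-cong (≈-refl {r}) (≈-sym inverse-poch-∞))))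
    (≈[]-trans (⊗-≈[] (≈[]-refl {r}) (⊗-≈[] (≈[]-sym (poch-stable 1≤c 1≤c M≤k)) (≈[]-refl {g})))
    (≈[]-all (≈-trans (solve 3 (λ r p g → r :* (p :* g) := p :* r :* g) ≈-refl r (poch< c c k) g)
      (≈-trans (⊗-cong (poch<-inverse k) ≈-refl) (solve 1 (λ g → con 1ℤ :* g := g) ≈-refl g)))))
    where
    r g : PowerSeries
    r = inverse-poch c (+ k)
    g = poch c c ⁻¹

-- The terms of the q-binomial theorem for
-- (q^a ; q^c)_m (q^b ; q^c)_n with c = a + b.
binomial-term : ℕ → ℕ → ℕ → ℕ → ℕ → ℤ → PowerSeries
binomial-term c a b m n j = poch< c c (m ℕ.+ n) ⊗ theta-term a b j ⊗ inverse-poch c (+ n ℤ.+ j) ⊗ inverse-poch c (+ m ℤ.+ ℤ.- j)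

module _ {a b c : ℕ} (1≤a : 1 ≤ a) (1≤b : 1 ≤ b) (c≡a+b : c ≡ a ℕ.+ b) where

  private
    1≤c : 1 ≤ c
    1≤c = subst (1 ≤_) (sym c≡a+b) (ℕ.≤-trans 1≤a (ℕ.m≤m+n a b))

    r : ℤ → PowerSeries
    r = inverse-poch c

  -- Passing from j - 1 to j raises the theta exponent by a j + b (j - 1), which is exactly a + c m
  -- - c (m + 1 - j) because c = a + b.
  exponent-shift : ∀ m j u → + u ≡ + suc m ℤ.+ ℤ.- j →
    a ℕ.+ c ℕ.* m ℕ.+ theta-exponent a b (ℤ.pred j) ≡ c ℕ.* u ℕ.+ theta-exponent a b j
  exponent-shift m j u u≡ = exponent-from-twice $ begin
    + 2 ℤ.* + (a ℕ.+ c ℕ.* m ℕ.+ theta-exponent a b (ℤ.pred j))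
      ≡⟨ cong (λ z → + 2 ℤ.* + (a ℕ.+ z ℕ.* m ℕ.+ theta-exponent a b (ℤ.pred j))) c≡a+b ⟩
    + 2 ℤ.* + (a ℕ.+ (a ℕ.+ b) ℕ.* m ℕ.+ theta-exponent a b (ℤ.pred j))
      ≡⟨ cong (λ z → + 2 ℤ.* (+ a ℤ.+ z ℤ.+ + theta-exponent a b (ℤ.pred j))) (ℤ.pos-* (a ℕ.+ b) m) ⟩
    + 2 ℤ.* (+ a ℤ.+ (+ a ℤ.+ + b) ℤ.* + m ℤ.+ + theta-exponent a b (ℤ.pred j))
      ≡⟨ ℤsolve 4 (λ a b m e → conᶻ (+ 2) :*ᶻ (a :+ᶻ (a :+ᶻ b) :*ᶻ m :+ᶻ e) :=ᶻ conᶻ (+ 2) :*ᶻ (a :+ᶻ (a :+ᶻ b) :*ᶻ m) :+ᶻ conᶻ (+ 2) :*ᶻ e) refl (+ a) (+ b) (+ m) _ ⟩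
    + 2 ℤ.* (+ a ℤ.+ (+ a ℤ.+ + b) ℤ.* + m) ℤ.+ + 2 ℤ.* + theta-exponent a b (ℤ.pred j)
      ≡⟨ cong (λ z → + 2 ℤ.* (+ a ℤ.+ (+ a ℤ.+ + b) ℤ.* + m) ℤ.+ z) (twice-theta-exponent a b (ℤ.pred j)) ⟩
    + 2 ℤ.* (+ a ℤ.+ (+ a ℤ.+ + b) ℤ.* + m) ℤ.+ (+ a ℤ.* (ℤ.pred j ℤ.* (ℤ.pred j ℤ.+ 1ℤ)) ℤ.+ + b ℤ.* (ℤ.pred j ℤ.* (ℤ.pred j ℤ.+ ℤ.- 1ℤ)))
      ≡⟨ ℤsolve 4 (λ a b m j →
           conᶻ (+ 2) :*ᶻ (a :+ᶻ (a :+ᶻ b) :*ᶻ m) :+ᶻ (a :*ᶻ ((conᶻ -[1+ 0 ] :+ᶻ j) :*ᶻ ((conᶻ -[1+ 0 ] :+ᶻ j) :+ᶻ conᶻ 1ℤ))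
             :+ᶻ b :*ᶻ ((conᶻ -[1+ 0 ] :+ᶻ j) :*ᶻ ((conᶻ -[1+ 0 ] :+ᶻ j) :+ᶻ -ᶻ conᶻ 1ℤ))) :=ᶻ
           conᶻ (+ 2) :*ᶻ ((a :+ᶻ b) :*ᶻ ((conᶻ 1ℤ :+ᶻ m) :+ᶻ -ᶻ j)) :+ᶻ (a :*ᶻ (j :*ᶻ (j :+ᶻ conᶻ 1ℤ)) :+ᶻ b :*ᶻ (j :*ᶻ (j :+ᶻ -ᶻ conᶻ 1ℤ)))) refl (+ a) (+ b) (+ m) j ⟩
    + 2 ℤ.* ((+ a ℤ.+ + b) ℤ.* (+ suc m ℤ.+ ℤ.- j)) ℤ.+ (+ a ℤ.* (j ℤ.* (j ℤ.+ 1ℤ)) ℤ.+ + b ℤ.* (j ℤ.* (j ℤ.+ ℤ.- 1ℤ)))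
      ≡⟨ cong₂ (λ y z → + 2 ℤ.* ((+ a ℤ.+ + b) ℤ.* y) ℤ.+ z) u≡ (twice-theta-exponent a b j) ⟨
    + 2 ℤ.* ((+ a ℤ.+ + b) ℤ.* + u) ℤ.+ + 2 ℤ.* + theta-exponent a b j
      ≡⟨ ℤ.*-distribˡ-+ (+ 2) ((+ a ℤ.+ + b) ℤ.* + u) _ ⟨
    + 2 ℤ.* ((+ a ℤ.+ + b) ℤ.* + u ℤ.+ + theta-exponent a b j)
      ≡⟨ cong (λ z → + 2 ℤ.* (z ℤ.+ + theta-exponent a b j)) (ℤ.pos-* (a ℕ.+ b) u) ⟨
    + 2 ℤ.* + ((a ℕ.+ b) ℕ.* u ℕ.+ theta-exponent a b j)
      ≡⟨ cong (λ z → + 2 ℤ.* + (z ℕ.* u ℕ.+ theta-exponent a b j)) c≡a+b ⟨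
    + 2 ℤ.* + (c ℕ.* u ℕ.+ theta-exponent a b j) ∎
    where open ≡-Reasoning

  constant-neg : ∀ z → constant (ℤ.- z) ≈ ⊖ constant z
  constant-neg z zero    = sym (⊖-coeff (constant z) 0)
  constant-neg z (suc n) = sym (⊖-coeff (constant z) (suc n))

  -- The exponents can only be compared for y ≥ 0; the common factor `r y`, which is 0 for negative
  -- y, extends the identity to all j.
  theta-term-shift : ∀ m j y → y ≡ + suc m ℤ.+ ℤ.- j →
    q^ (a ℕ.+ c ℕ.* m) ⊗ theta-term a b (ℤ.pred j) ⊗ r y ≈ ⊖ (q^ (c ℕ.* natural-part y) ⊗ theta-term a b j) ⊗ r y
  theta-term-shift m j -[1+ _ ] _ = solve 2 (λ x y → x :* con 0ℤ := y :* con 0ℤ) ≈-refl _ _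
  theta-term-shift m j (+ u) u≡ = ⊗-cong (begin
    q^ (a ℕ.+ c ℕ.* m) ⊗ (constant (sign (ℤ.pred j)) ⊗ q^ e′)
      ≈⟨ ⊗-cong ≈-refl (⊗-cong (≈-trans (λ n → cong (λ z → constant z n) (sign-pred j)) (constant-neg (sign j))) ≈-refl) ⟩
    q^ (a ℕ.+ c ℕ.* m) ⊗ (⊖ constant (sign j) ⊗ q^ e′)
      ≈⟨ solve 3 (λ x s y → x :* (:- s :* y) := :- (s :* (x :* y))) ≈-refl _ (constant (sign j)) (q^ e′) ⟩
    ⊖ (constant (sign j) ⊗ (q^ (a ℕ.+ c ℕ.* m) ⊗ q^ e′))
      ≈⟨ ⊖-cong (⊗-cong ≈-refl (≈-trans (q^-+ (a ℕ.+ c ℕ.* m) e′) (≈-trans (q^-≡ (exponent-shift m j u u≡)) (≈-sym (q^-+ (c ℕ.* u) e))))) ⟩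
    ⊖ (constant (sign j) ⊗ (q^ (c ℕ.* u) ⊗ q^ e))
      ≈⟨ solve 3 (λ s x y → :- (s :* (x :* y)) := :- (x :* (s :* y))) ≈-refl (constant (sign j)) _ (q^ e) ⟩
    ⊖ (q^ (c ℕ.* u) ⊗ (constant (sign j) ⊗ q^ e)) ∎) ≈-refl
    where
    open ≈-Reasoning
    e e′ : ℕ
    e  = theta-exponent a b j
    e′ = theta-exponent a b (ℤ.pred j)

  split-power : ∀ m x y → + suc m ≡ x ℤ.+ y →
    q^ (c ℕ.+ c ℕ.* m) ⊗ (r x ⊗ r y) ≈ q^ (c ℕ.* natural-part x) ⊗ q^ (c ℕ.* natural-part y) ⊗ (r x ⊗ r y)
  split-power m (+ u) (+ v) m≡ = ⊗-cong (≈-trans (q^-≡ (trans (sym (ℕ.*-suc c m))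
    (trans (cong (c ℕ.*_) (ℤ.+-injective m≡)) (ℕ.*-distribˡ-+ c u v)))) (≈-sym (q^-+ (c ℕ.* u) (c ℕ.* v)))) ≈-refl
  split-power m -[1+ _ ] y _ = solve 3 (λ x z w → x :* (con 0ℤ :* w) := z :* (con 0ℤ :* w)) ≈-refl _ _ (r y)
  split-power m (+ u) -[1+ _ ] _ = solve 3 (λ x z w → x :* (w :* con 0ℤ) := z :* (w :* con 0ℤ)) ≈-refl _ _ (r (+ u))

  -- A q-Pascal rule. With X = q^(cx), Y = q^(cy) and x + y = m + n + 1, the new factor splits as 1
  -- - XY = (1 - Y) + Y (1 - X). The two summands lower y and x by one, and in the second one Y
  -- moves the theta term from j to j - 1.
  binomial-step : ∀ m n j → binomial-term c a b (suc m) n j ≈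
    binomial-term c a b m n j ⊕ ⊖ (q^ (a ℕ.+ c ℕ.* m)) ⊗ binomial-term c a b m n (ℤ.pred j)
  binomial-step m n j = begin
    p ⊗ factor (c ℕ.+ c ℕ.* (m ℕ.+ n)) ⊗ θ ⊗ r x ⊗ r y
      ≈⟨ solve 5 (λ p t u v w → p :* (con 1ℤ :+ :- w) :* t :* u :* v := p :* t :* u :* v :+ :- (p :* t :* (w :* (u :* v)))) ≈-refl
           p θ (r x) (r y) (q^ (c ℕ.+ c ℕ.* (m ℕ.+ n))) ⟩
    p ⊗ θ ⊗ r x ⊗ r y ⊕ ⊖ (p ⊗ θ ⊗ (q^ (c ℕ.+ c ℕ.* (m ℕ.+ n)) ⊗ (r x ⊗ r y)))
      ≈⟨ ⊕-cong ≈-refl (⊖-cong (⊗-cong ≈-refl (split-power (m ℕ.+ n) x y x+y))) ⟩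
    p ⊗ θ ⊗ r x ⊗ r y ⊕ ⊖ (p ⊗ θ ⊗ (X ⊗ Y ⊗ (r x ⊗ r y)))
      ≈⟨ solve 6 (λ p t u v X Y → p :* t :* u :* v :+ :- (p :* t :* (X :* Y :* (u :* v))) :=
           p :* t :* u :* ((con 1ℤ :+ :- Y) :* v) :+ :- (p :* (:- (Y :* t) :* v) :* ((con 1ℤ :+ :- X) :* u))) ≈-refl p θ (r x) (r y) X Y ⟩
    p ⊗ θ ⊗ r x ⊗ (factor (c ℕ.* natural-part y) ⊗ r y) ⊕ ⊖ (p ⊗ (⊖ (Y ⊗ θ) ⊗ r y) ⊗ (factor (c ℕ.* natural-part x) ⊗ r x))
      ≈⟨ ⊕-cong (⊗-cong ≈-refl (≈-sym (inverse-poch-pred 1≤c y)))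
           (⊖-cong (⊗-cong (⊗-cong ≈-refl (≈-sym (theta-term-shift m j y refl))) (≈-sym (inverse-poch-pred 1≤c x)))) ⟩
    p ⊗ θ ⊗ r x ⊗ r (ℤ.pred y) ⊕ ⊖ (p ⊗ (q^ (a ℕ.+ c ℕ.* m) ⊗ θ′ ⊗ r y) ⊗ r (ℤ.pred x))
      ≈⟨ solve 7 (λ p z t′ v′ w t u → t :+ :- (p :* (z :* t′ :* v′) :* w) := t :+ :- z :* (p :* t′ :* w :* v′)) ≈-refl
           p (q^ (a ℕ.+ c ℕ.* m)) θ′ (r y) (r (ℤ.pred x)) (p ⊗ θ ⊗ r x ⊗ r (ℤ.pred y)) p ⟩
    p ⊗ θ ⊗ r x ⊗ r (ℤ.pred y) ⊕ ⊖ (q^ (a ℕ.+ c ℕ.* m)) ⊗ (p ⊗ θ′ ⊗ r (ℤ.pred x) ⊗ r y)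
      ≈⟨ ⊕-cong (⊗-cong ≈-refl (r≡ (ℤsolve 2 (λ m j → conᶻ -[1+ 0 ] :+ᶻ ((conᶻ 1ℤ :+ᶻ m) :+ᶻ -ᶻ j) :=ᶻ m :+ᶻ -ᶻ j) refl (+ m) j)))
           (⊗-cong ≈-refl (⊗-cong (⊗-cong ≈-refl (r≡ (ℤsolve 2 (λ n j → conᶻ -[1+ 0 ] :+ᶻ (n :+ᶻ j) :=ᶻ n :+ᶻ (conᶻ -[1+ 0 ] :+ᶻ j)) refl (+ n) j)))
             (r≡ (ℤsolve 2 (λ m j → (conᶻ 1ℤ :+ᶻ m) :+ᶻ -ᶻ j :=ᶻ m :+ᶻ -ᶻ (conᶻ -[1+ 0 ] :+ᶻ j)) refl (+ m) j)))) ⟩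
    binomial-term c a b m n j ⊕ ⊖ (q^ (a ℕ.+ c ℕ.* m)) ⊗ binomial-term c a b m n (ℤ.pred j) ∎
    where
    open ≈-Reasoning
    x y : ℤ
    x = + n ℤ.+ j
    y = + suc m ℤ.+ ℤ.- j
    p θ θ′ X Y : PowerSeries
    p  = poch< c c (m ℕ.+ n)
    θ  = theta-term a b j
    θ′ = theta-term a b (ℤ.pred j)
    X  = q^ (c ℕ.* natural-part x)
    Y  = q^ (c ℕ.* natural-part y)
    x+y : + suc (m ℕ.+ n) ≡ x ℤ.+ y
    x+y = ℤsolve 3 (λ m n j → conᶻ 1ℤ :+ᶻ (m :+ᶻ n) :=ᶻ n :+ᶻ j :+ᶻ ((conᶻ 1ℤ :+ᶻ m) :+ᶻ -ᶻ j)) refl (+ m) (+ n) j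
    r≡ : ∀ {i j} → i ≡ j → r i ≈ r j
    r≡ i≡j n = cong (λ i → r i n) i≡j

  -- Summed over j, the two terms of `binomial-step` have the same sum up to the factor -q^(a + cm),
  -- since a shift of j does not change a sum over ℤ. Each step thus contributes 1 - q^(a + cm).
  q-binomial-left : ∀ n {P} → HasSum (binomial-term c a b 0 n) P → ∀ m → HasSum (binomial-term c a b m n) (poch< c a m ⊗ P)
  q-binomial-left n {P} base zero    = HasSum-cong (λ _ → ≈-refl) (solve 1 (λ x → x := con 1ℤ :* x) ≈-refl P) base
  q-binomial-left n {P} base (suc m) = HasSum-cong (λ j → ≈-sym (binomial-step m n j))
    (solve 3 (λ x y Q → x :* y :+ :- Q :* (x :* y) := x :* (con 1ℤ :+ :- Q) :* y) ≈-refl (poch< c a m) P (q^ (a ℕ.+ c ℕ.* m)))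
    (HasSum-⊕ IH (HasSum-⊗ (⊖ (q^ (a ℕ.+ c ℕ.* m))) (HasSum-pred IH)))
    where
    IH : HasSum (binomial-term c a b m n) (poch< c a m ⊗ P)
    IH = q-binomial-left n base m

HasSum-single : ∀ {F} → (∀ j → ¬ j ≡ 0ℤ → F j ≈ constant 0ℤ) → HasSum F (F 0ℤ)
sums (HasSum-single {F} z) M = 1 , λ m n 1≤m 1≤n → ≈[]-trans
  (⊕-≈[] (sum<-stable {m = 0} {n = m} (λ i _ → ≈[]-all (z -[1+ i ] λ ())) z≤n)
         (sum<-stable {m = 1} {n = n} (λ { (suc i) _ → ≈[]-all (z (+ suc i) λ ()) }) 1≤n))
  (≈[]-all (solve 1 (λ x → con 0ℤ :+ (con 0ℤ :+ x) := x) ≈-refl (F 0ℤ)))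

module _ {a b : ℕ} (1≤a : 1 ≤ a) (1≤b : 1 ≤ b) where

  private
    c : ℕ
    c = a ℕ.+ b
    1≤c : 1 ≤ c
    1≤c = ℕ.≤-trans 1≤a (ℕ.m≤m+n a b)
    r : ℤ → PowerSeries
    r = inverse-poch c

  binomial-term-flip : ∀ {a b} m n j → binomial-term c a b m n (ℤ.- j) ≈ binomial-term c b a n m j
  binomial-term-flip {a} {b} m n j = begin
    poch< c c (m ℕ.+ n) ⊗ theta-term a b (ℤ.- j) ⊗ r (+ n ℤ.+ ℤ.- j) ⊗ r (+ m ℤ.+ ℤ.- (ℤ.- j))
      ≈⟨ ⊗-cong (⊗-cong (⊗-cong (λ k → cong (λ i → poch< c c i k) (ℕ.+-comm m n)) (theta-term-neg a b j)) ≈-refl)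
           (λ k → cong (λ i → r (+ m ℤ.+ i) k) (ℤ.neg-involutive j)) ⟩
    poch< c c (n ℕ.+ m) ⊗ theta-term b a j ⊗ r (+ n ℤ.+ ℤ.- j) ⊗ r (+ m ℤ.+ j)
      ≈⟨ solve 3 (λ x y z → x :* y :* z := x :* z :* y) ≈-refl _ _ _ ⟩
    poch< c c (n ℕ.+ m) ⊗ theta-term b a j ⊗ r (+ m ℤ.+ j) ⊗ r (+ n ℤ.+ ℤ.- j) ∎
    where open ≈-Reasoning

  binomial-term-0-0 : HasSum (binomial-term c b a 0 0) (constant 1ℤ)
  binomial-term-0-0 = HasSum-cong (λ _ → ≈-refl)
    (≈-trans (⊗-cong (⊗-cong (⊗-cong (≈-refl {constant 1ℤ}) (⊗-cong (≈-refl {constant 1ℤ}) 1#≈constant)) r₀) r₀)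
      (solve 0 (con 1ℤ :* (con 1ℤ :* con 1ℤ) :* con 1ℤ :* con 1ℤ := con 1ℤ) ≈-refl))
    (HasSum-single vanish)
    where
    r₀ : r 0ℤ ≈ constant 1ℤ
    r₀ = ≈-trans (solve 1 (λ r → r := con 1ℤ :* r) ≈-refl (r 0ℤ)) (poch<-inverse 1≤c 0)
    vanish : ∀ j → ¬ j ≡ 0ℤ → binomial-term c b a 0 0 j ≈ constant 0ℤ
    vanish (+ zero)  j≢0 = contradiction refl j≢0
    vanish (+ suc n) _   = solve 1 (λ x → x :* con 0ℤ := con 0ℤ) ≈-refl _
    vanish -[1+ n ]  _   = solve 2 (λ x y → x :* con 0ℤ :* y := con 0ℤ) ≈-refl _ _

  -- The factors for b come from the same induction: the reflection j ↦ -j exchanges a with b and m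
  -- with n. Both inductions start from the single term j = 0 for m = n = 0.
  q-binomial : ∀ m n → HasSum (binomial-term c a b m n) (poch< c a m ⊗ poch< c b n)
  q-binomial m n = q-binomial-left 1≤a 1≤b refl n
    (HasSum-cong (λ j → ≈-trans (binomial-term-flip {b} {a} n 0 j) ≈-refl)
      (solve 1 (λ x → x :* con 1ℤ := x) ≈-refl (poch< c b n))
      (HasSum-negate (q-binomial-left 1≤b 1≤a (ℕ.+-comm a b) 0 binomial-term-0-0 n))) m

  -- The size 2M leaves room: for |j| ≤ M the indices 2M + j and 2M - j are at least M, so both
  -- inverse products agree with 1/(q^c; q^c)_∞ modulo q^M. For |j| ≥ M the theta term is itself 0
  -- modulo q^M.
  binomial-term-limit : ∀ M j → poch c c ⊗ binomial-term c a b (M ℕ.+ M) (M ℕ.+ M) j ≈[ M ] theta-term a b j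
  binomial-term-limit M j with M ℕ.≤? ℤ.∣ j ∣
  ... | yes M≤∣j∣ = ≈[]-trans (⊗-≈[] (≈[]-refl {poch c c}) (⊗-≈[] (⊗-≈[] (⊗-≈[] (≈[]-refl {p}) small) (≈[]-refl {r₁})) (≈[]-refl {r₂})))
      (≈[]-trans (≈[]-all (solve 4 (λ x y z w → x :* (y :* con 0ℤ :* z :* w) := con 0ℤ) ≈-refl (poch c c) p r₁ r₂)) (≈[]-sym small))
    where
    p r₁ r₂ : PowerSeries
    p  = poch< c c (M ℕ.+ M ℕ.+ (M ℕ.+ M))
    r₁ = r (+ (M ℕ.+ M) ℤ.+ j)
    r₂ = r (+ (M ℕ.+ M) ℤ.+ ℤ.- j)
    small : theta-term a b j ≈[ M ] constant 0ℤ
    small = theta-term-supported 1≤a 1≤b M j M≤∣j∣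
  ... | no M≰∣j∣ = ≈[]-trans
      (⊗-≈[] (≈[]-refl {poch c c}) (⊗-≈[] (⊗-≈[] (⊗-≈[] (poch-stable 1≤c 1≤c M≤4M) (≈[]-refl {θ}))
        (limit j (ℕ.≰⇒≥ M≰∣j∣)))
        (limit (ℤ.- j) (subst (_≤ M) (sym (ℤ.∣-i∣≡∣i∣ j)) (ℕ.≰⇒≥ M≰∣j∣)))))
      (≈[]-all (begin
        p ⊗ (p ⊗ θ ⊗ g ⊗ g)
          ≈⟨ solve 3 (λ p t g → p :* (p :* t :* g :* g) := p :* g :* (p :* g) :* t) ≈-refl p θ g ⟩
        p ⊗ g ⊗ (p ⊗ g) ⊗ θ
          ≈⟨ ⊗-cong (⊗-cong (inverse-poch-∞ 1≤c) (inverse-poch-∞ 1≤c)) ≈-refl ⟩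
        constant 1ℤ ⊗ constant 1ℤ ⊗ θ
          ≈⟨ solve 1 (λ t → con 1ℤ :* con 1ℤ :* t := t) ≈-refl θ ⟩
        θ ∎))
    where
    open ≈-Reasoning
    p g θ : PowerSeries
    p = poch c c
    g = poch c c ⁻¹
    θ = theta-term a b j
    M≤4M : M ≤ M ℕ.+ M ℕ.+ (M ℕ.+ M)
    M≤4M = ℕ.≤-trans (ℕ.m≤m+n M M) (ℕ.m≤m+n (M ℕ.+ M) _)
    limit : ∀ i → ℤ.∣ i ∣ ≤ M → r (+ (M ℕ.+ M) ℤ.+ i) ≈[ M ] g
    limit (+ i)    _   = inverse-poch-limit 1≤c (M ℕ.+ M ℕ.+ i) (ℕ.≤-trans (ℕ.m≤m+n M M) (ℕ.m≤m+n (M ℕ.+ M) i))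
    limit -[1+ i ] i<M = subst (λ x → r x ≈[ M ] g) (sym (ℤ.⊖-≥ (ℕ.≤-trans i<M (ℕ.m≤m+n M M))))
      (inverse-poch-limit 1≤c (M ℕ.+ M ℕ.∸ suc i) (subst (M ≤_) (sym (ℕ.+-∸-assoc M i<M)) (ℕ.m≤m+n M _)))

  jacobi-triple-product : HasSum (theta-term a b) (poch c c ⊗ (poch c a ⊗ poch c b))
  sums jacobi-triple-product M = M , λ m n M≤m M≤n → ≈[]-trans
    (window-≈[] m n λ j → ≈[]-sym (binomial-term-limit M j))
    (≈[]-trans (Supported-sum (λ j M≤∣j∣ → ≈[]-trans (binomial-term-limit M j) (theta-term-supported 1≤a 1≤b M j M≤∣j∣))
      (HasSum-⊗ (poch c c) (q-binomial (M ℕ.+ M) (M ℕ.+ M))) M≤m M≤n)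
    (⊗-≈[] (≈[]-refl {poch c c}) (⊗-≈[] (poch-stable 1≤c 1≤a (ℕ.m≤m+n M M)) (poch-stable 1≤c 1≤b (ℕ.m≤m+n M M)))))

-- Dissections of theta series

alternating-square : ∀ n → alternating n ℤ.* alternating n ≡ 1ℤ
alternating-square zero    = refl
alternating-square (suc n) = trans (ℤsolve 1 (λ s → (-ᶻ s) :*ᶻ (-ᶻ s) :=ᶻ s :*ᶻ s) refl (alternating n)) (alternating-square n)

sign-suc : ∀ j → sign (ℤ.suc j) ≡ ℤ.- sign j
sign-suc j = begin
  sign (ℤ.suc j)                ≡⟨ ℤ.neg-involutive _ ⟨
  ℤ.- (ℤ.- sign (ℤ.suc j))      ≡⟨ cong ℤ.-_ (sign-pred (ℤ.suc j)) ⟨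
  ℤ.- sign (ℤ.pred (ℤ.suc j))   ≡⟨ cong (λ i → ℤ.- sign i) (ℤ.pred-suc j) ⟩
  ℤ.- sign j                    ∎
  where open ≡-Reasoning

sign-+ : ∀ i j → sign (i ℤ.+ j) ≡ sign i ℤ.* sign j
sign-+ (+ zero)  j = trans (cong sign (ℤ.+-identityˡ j)) (sym (ℤ.*-identityˡ (sign j)))
sign-+ (+ suc n) j = trans (cong sign (ℤ.+-assoc 1ℤ (+ n) j)) (trans (sign-suc (+ n ℤ.+ j))
  (trans (cong ℤ.-_ (sign-+ (+ n) j)) (ℤ.neg-distribˡ-* (sign (+ n)) (sign j))))
sign-+ -[1+ zero ]  j = trans (sign-pred j) (sym (ℤ.-1*i≡-i (sign j)))
sign-+ -[1+ suc n ] j = trans (cong sign (ℤ.+-assoc -[1+ 0 ] -[1+ n ] j)) (trans (sign-pred (-[1+ n ] ℤ.+ j))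
  (trans (cong ℤ.-_ (sign-+ -[1+ n ] j)) (ℤ.neg-distribˡ-* (sign -[1+ n ]) (sign j))))

sign-fives : ∀ i j → sign (+ 5 ℤ.* j ℤ.+ i) ≡ sign i ℤ.* sign j
sign-fives i j = begin
  sign (+ 5 ℤ.* j ℤ.+ i)
    ≡⟨ cong sign (ℤsolve 2 (λ i j → conᶻ (+ 5) :*ᶻ j :+ᶻ i :=ᶻ i :+ᶻ (j :+ᶻ ((j :+ᶻ j) :+ᶻ (j :+ᶻ j)))) refl i j) ⟩
  sign (i ℤ.+ (j ℤ.+ (j ℤ.+ j ℤ.+ (j ℤ.+ j))))
    ≡⟨ trans (sign-+ i _) (cong (sign i ℤ.*_) (trans (sign-+ j _) (cong (sign j ℤ.*_)
         (trans (sign-+ (j ℤ.+ j) (j ℤ.+ j)) (cong₂ ℤ._*_ square square))))) ⟩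
  sign i ℤ.* (sign j ℤ.* 1ℤ)
    ≡⟨ cong (sign i ℤ.*_) (ℤ.*-identityʳ (sign j)) ⟩
  sign i ℤ.* sign j ∎
  where
  open ≡-Reasoning
  square : sign (j ℤ.+ j) ≡ 1ℤ
  square = trans (sign-+ j j) (alternating-square ℤ.∣ j ∣)

twice : ℕ → ℕ → ℤ → ℤ
twice a b j = + a ℤ.* (j ℤ.* (j ℤ.+ 1ℤ)) ℤ.+ + b ℤ.* (j ℤ.* (j ℤ.+ ℤ.- 1ℤ))

constant-* : ∀ x y → constant (x ℤ.* y) ≈ constant x ⊗ constant y
constant-* x y zero    = sym (⊗-coeff-0 (constant x) (constant y))
constant-* x y (suc n) = sym (trans (constant-⊗ x (constant y) (suc n)) (ℤ.*-zeroʳ x))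

-- The hypothesis is the expansion of the doubled exponent at 5j + i. The sign factors because 5 is
-- odd.
theta-term-fives : ∀ a b i s t a′ b′ →
  (∀ j → twice a b (+ 5 ℤ.* j ℤ.+ i) ≡ + 2 ℤ.* (+ s ℤ.+ + 5 ℤ.* + t) ℤ.+ + 5 ℤ.* twice a′ b′ j) →
  ∀ j → theta-term a b (+ 5 ℤ.* j ℤ.+ i) ≈ q^ s ⊗ dilate 5 (constant (sign i) ⊗ (q^ t ⊗ theta-term a′ b′ j))
theta-term-fives a b i s t a′ b′ split j = begin
  constant (sign (+ 5 ℤ.* j ℤ.+ i)) ⊗ q^ (theta-exponent a b (+ 5 ℤ.* j ℤ.+ i))
    ≈⟨ ⊗-cong (≈-trans (λ n → cong (λ z → constant z n) (sign-fives i j)) (constant-* (sign i) (sign j))) (q^-≡ exponent) ⟩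
  constant (sign i) ⊗ constant (sign j) ⊗ q^ (s ℕ.+ 5 ℕ.* (t ℕ.+ e))
    ≈⟨ ⊗-cong ≈-refl (≈-trans (≈-sym (q^-+ s _)) (⊗-cong ≈-refl (≈-trans (≈-sym (dilate-q^ 5 (t ℕ.+ e))) (≈-trans
         (dilate-cong 5 (≈-sym (q^-+ t e))) (dilate-⊗ 5 (q^ t) (q^ e)))))) ⟩
  constant (sign i) ⊗ constant (sign j) ⊗ (q^ s ⊗ (dilate 5 (q^ t) ⊗ dilate 5 (q^ e)))
    ≈⟨ solve 5 (λ x y z u v → x :* y :* (z :* (u :* v)) := z :* (x :* (u :* (y :* v)))) ≈-refl _ _ _ (dilate 5 (q^ t)) (dilate 5 (q^ e)) ⟩
  q^ s ⊗ (constant (sign i) ⊗ (dilate 5 (q^ t) ⊗ (constant (sign j) ⊗ dilate 5 (q^ e))))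
    ≈⟨ ⊗-cong ≈-refl (⊗-cong (≈-sym (dilate-constant 5 (sign i))) (⊗-cong (≈-refl {dilate 5 (q^ t)}) (⊗-cong (≈-sym (dilate-constant 5 (sign j))) ≈-refl))) ⟩
  q^ s ⊗ (dilate 5 (constant (sign i)) ⊗ (dilate 5 (q^ t) ⊗ (dilate 5 (constant (sign j)) ⊗ dilate 5 (q^ e))))
    ≈⟨ ⊗-cong ≈-refl (≈-sym (≈-trans (dilate-⊗ 5 (constant (sign i)) _) (⊗-cong (≈-refl {dilate 5 (constant (sign i))}) (≈-trans (dilate-⊗ 5 (q^ t) _)
         (⊗-cong (≈-refl {dilate 5 (q^ t)}) (dilate-⊗ 5 (constant (sign j)) (q^ e))))))) ⟩
  q^ s ⊗ dilate 5 (constant (sign i) ⊗ (q^ t ⊗ theta-term a′ b′ j)) ∎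
  where
  open ≈-Reasoning
  e : ℕ
  e = theta-exponent a′ b′ j
  exponent : theta-exponent a b (+ 5 ℤ.* j ℤ.+ i) ≡ s ℕ.+ 5 ℕ.* (t ℕ.+ e)
  exponent = exponent-from-twice (trans (twice-theta-exponent a b (+ 5 ℤ.* j ℤ.+ i)) (trans (split j) (sym (trans
    (cong (λ z → + 2 ℤ.* (+ s ℤ.+ z)) (ℤ.pos-* 5 (t ℕ.+ e)))
    (trans (ℤsolve 3 (λ s t e → conᶻ (+ 2) :*ᶻ (s :+ᶻ conᶻ (+ 5) :*ᶻ (t :+ᶻ e)) :=ᶻ
       conᶻ (+ 2) :*ᶻ (s :+ᶻ conᶻ (+ 5) :*ᶻ t) :+ᶻ conᶻ (+ 5) :*ᶻ (conᶻ (+ 2) :*ᶻ e)) refl (+ s) (+ t) (+ e))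
     (cong (λ z → + 2 ℤ.* (+ s ℤ.+ + 5 ℤ.* + t) ℤ.+ + 5 ℤ.* z) (twice-theta-exponent a′ b′ j)))))))

twiceᶻ : ∀ {n} → ℕ → ℕ → ℤPolynomial n → ℤPolynomial n
twiceᶻ a b j = conᶻ (+ a) :*ᶻ (j :*ᶻ (j :+ᶻ conᶻ 1ℤ)) :+ᶻ conᶻ (+ b) :*ᶻ (j :*ᶻ (j :+ᶻ -ᶻ conᶻ 1ℤ))

-- The residues -2, ..., 2 are used because j ↦ -j pairs the classes i and -i, which for φ give the
-- same theta series.
HasSum-centred-fives : ∀ {F S} → HasSum F S →
  HasSum (λ j → F (+ 5 ℤ.* j ℤ.+ -[1+ 1 ]) ⊕ F (+ 5 ℤ.* j ℤ.+ -[1+ 0 ]) ⊕ F (+ 5 ℤ.* j ℤ.+ + 0) ⊕ F (+ 5 ℤ.* j ℤ.+ + 1) ⊕ F (+ 5 ℤ.* j ℤ.+ + 2)) S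
HasSum-centred-fives {F} s = HasSum-cong
  (λ j → ⊕-cong (⊕-cong (⊕-cong (⊕-cong ≈-refl (shift 1 j)) (shift 2 j)) (shift 3 j)) (shift 4 j)) ≈-refl
  (HasSum-fives (HasSum-translate -[1+ 1 ] s))
  where
  shift : ∀ r j → F (+ 5 ℤ.* j ℤ.+ + r ℤ.+ -[1+ 1 ]) ≈ F (+ 5 ℤ.* j ℤ.+ (+ r ℤ.+ -[1+ 1 ]))
  shift r j n = cong (λ i → F i n) (ℤ.+-assoc (+ 5 ℤ.* j) (+ r) -[1+ 1 ])

HasSum-0 : HasSum (λ _ → constant 0ℤ) (constant 0ℤ)
HasSum-0 = HasSum-single (λ _ _ → ≈-refl)

-- By recursion on both residues, so that for numerals every summand of a section reduces to its
-- part or to 0 by computation.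
when-equal : ℕ → ℕ → PowerSeries → PowerSeries
when-equal zero    zero    a = a
when-equal zero    (suc s) a = constant 0ℤ
when-equal (suc r) zero    a = constant 0ℤ
when-equal (suc r) (suc s) a = when-equal r s a

section-q^-dilate : ∀ {r s} a → r < 5 → s < 5 → section r (q^ s ⊗ dilate 5 a) ≈ when-equal r s a
section-q^-dilate {r} {s} a r<5 s<5 with r ℕ.≟ s
... | yes refl = ≈-trans (section-same r a) (same r)
  where
  same : ∀ r → a ≈ when-equal r r a
  same zero    = ≈-refl
  same (suc r) = same r
... | no r≢s = ≈-trans (section-other r s a r<5 s<5 r≢s) (other r s r≢s)
  where
  other : ∀ r s → ¬ r ≡ s → constant 0ℤ ≈ when-equal r s a
  other zero    zero    r≢s = contradiction refl r≢s
  other zero    (suc s) _   = ≈-refl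
  other (suc r) zero    _   = ≈-refl
  other (suc r) (suc s) r≢s = other r s (r≢s ∘ cong suc)

record Split (F : ℤ → PowerSeries) (i : ℤ) : Set where
  field
    residue   : ℕ
    residue<5 : residue < 5
    part      : ℤ → PowerSeries
    split     : ∀ j → F (+ 5 ℤ.* j ℤ.+ i) ≈ q^ residue ⊗ dilate 5 (part j)
open Split

section-of : ∀ {F i} → ℕ → Split F i → ℤ → PowerSeries
section-of r σ j = when-equal r (residue σ) (part σ j)

HasSum-sections : ∀ {F S} (σ₋₂ : Split F -[1+ 1 ]) (σ₋₁ : Split F -[1+ 0 ]) (σ₀ : Split F (+ 0)) (σ₁ : Split F (+ 1)) (σ₂ : Split F (+ 2)) →
  HasSum F S → ∀ r → r < 5 →
  HasSum (λ j → section-of r σ₋₂ j ⊕ section-of r σ₋₁ j ⊕ section-of r σ₀ j ⊕ section-of r σ₁ j ⊕ section-of r σ₂ j) (section r S)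
HasSum-sections {F} σ₋₂ σ₋₁ σ₀ σ₁ σ₂ s r r<5 = HasSum-cong (λ j → ≈-trans
    (≈-trans (section-⊕ r _ (F (+ 5 ℤ.* j ℤ.+ + 2))) (⊕-cong (≈-trans (section-⊕ r _ (F (+ 5 ℤ.* j ℤ.+ + 1)))
      (⊕-cong (≈-trans (section-⊕ r _ (F (+ 5 ℤ.* j ℤ.+ + 0))) (⊕-cong (section-⊕ r (F (+ 5 ℤ.* j ℤ.+ -[1+ 1 ])) (F (+ 5 ℤ.* j ℤ.+ -[1+ 0 ]))) ≈-refl)) ≈-refl)) ≈-refl))
    (⊕-cong (⊕-cong (⊕-cong (⊕-cong (at σ₋₂ j) (at σ₋₁ j)) (at σ₀ j)) (at σ₁ j)) (at σ₂ j)))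
  ≈-refl (HasSum-section r (HasSum-centred-fives s))
  where
  at : ∀ {i} (σ : Split F i) j → section r (F (+ 5 ℤ.* j ℤ.+ i)) ≈ section-of r σ j
  at σ j = ≈-trans (section-cong r (split σ j)) (section-q^-dilate (part σ j) r<5 (residue<5 σ))

-- Euler's pentagonal number theorem: the triple product for a = 1, b = 2 collects the three residue
-- classes modulo 3.
pentagonal : HasSum (theta-term 1 2) (poch 1 1)
pentagonal = HasSum-cong (λ _ → ≈-refl) (≈-sym (≈-trans (poch-split {1} {1} (s≤s z≤n) (s≤s z≤n) 3 (s≤s z≤n))
    (solve 3 (λ x y z → con 1ℤ :* x :* y :* z := z :* (x :* y)) ≈-refl (poch 3 1) (poch 3 2) (poch 3 3))))
  (jacobi-triple-product {1} {2} (s≤s z≤n) (s≤s z≤n))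

theta-split : ∀ a b i s → s < 5 → ∀ t a′ b′ →
  (∀ j → twice a b (+ 5 ℤ.* j ℤ.+ i) ≡ + 2 ℤ.* (+ s ℤ.+ + 5 ℤ.* + t) ℤ.+ + 5 ℤ.* twice a′ b′ j) →
  Split (theta-term a b) i
theta-split a b i s s<5 t a′ b′ eq = record
  { residue = s ; residue<5 = s<5 ; part = λ j → constant (sign i) ⊗ (q^ t ⊗ theta-term a′ b′ j)
  ; split = theta-term-fives a b i s t a′ b′ eq }

split-equation : ∀ {n} → ℕ → ℕ → ℤ → ℕ → ℕ → ℕ → ℕ → ℤPolynomial n → ℤPolynomial n Product.× ℤPolynomial n
split-equation a b i s t a′ b′ j = twiceᶻ a b (conᶻ (+ 5) :*ᶻ j :+ᶻ conᶻ i) :=ᶻ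
  (conᶻ (+ 2) :*ᶻ (conᶻ (+ s) :+ᶻ conᶻ (+ 5) :*ᶻ conᶻ (+ t)) :+ᶻ conᶻ (+ 5) :*ᶻ twiceᶻ a′ b′ j)

-- The numerals are read off from the expansion of j(3j - 1)/2 at 5j + i. For i = -2, ..., 2 the
-- residues are 2, 2, 0, 1, 0; residues 3 and 4 never occur, whence the two vanishing sections of
-- f₁.
pentagonal₋₂ : Split (theta-term 1 2) -[1+ 1 ]
pentagonal₋₂ = theta-split 1 2 -[1+ 1 ] 2 2<5 1 1 14 (ℤsolve 1 (split-equation 1 2 -[1+ 1 ] 2 1 1 14) refl)
pentagonal₋₁ : Split (theta-term 1 2) -[1+ 0 ]
pentagonal₋₁ = theta-split 1 2 -[1+ 0 ] 2 2<5 0 4 11 (ℤsolve 1 (split-equation 1 2 -[1+ 0 ] 2 0 4 11) refl)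
pentagonal₀ : Split (theta-term 1 2) (+ 0)
pentagonal₀ = theta-split 1 2 (+ 0) 0 0<5 0 7 8 (ℤsolve 1 (split-equation 1 2 (+ 0) 0 0 7 8) refl)
pentagonal₁ : Split (theta-term 1 2) (+ 1)
pentagonal₁ = theta-split 1 2 (+ 1) 1 1<5 0 10 5 (ℤsolve 1 (split-equation 1 2 (+ 1) 1 0 10 5) refl)
pentagonal₂ : Split (theta-term 1 2) (+ 2)
pentagonal₂ = theta-split 1 2 (+ 2) 0 0<5 1 13 2 (ℤsolve 1 (split-equation 1 2 (+ 2) 0 1 13 2) refl)

pentagonal-section : ∀ r → r < 5 → HasSum (λ j → section-of r pentagonal₋₂ j ⊕ section-of r pentagonal₋₁ j ⊕ section-of r pentagonal₀ j
  ⊕ section-of r pentagonal₁ j ⊕ section-of r pentagonal₂ j) (section r (poch 1 1))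
pentagonal-section = HasSum-sections pentagonal₋₂ pentagonal₋₁ pentagonal₀ pentagonal₁ pentagonal₂ pentagonal

zeros : constant 0ℤ ⊕ constant 0ℤ ⊕ constant 0ℤ ⊕ constant 0ℤ ⊕ constant 0ℤ ≈ constant 0ℤ
zeros = solve 0 (con 0ℤ :+ con 0ℤ :+ con 0ℤ :+ con 0ℤ :+ con 0ℤ := con 0ℤ) ≈-refl

pentagonal-section-3 : section 3 (poch 1 1) ≈ constant 0ℤ
pentagonal-section-3 = HasSum-unique (HasSum-cong (λ _ → zeros) ≈-refl (pentagonal-section 3 3<5)) HasSum-0

pentagonal-section-4 : section 4 (poch 1 1) ≈ constant 0ℤ
pentagonal-section-4 = HasSum-unique (HasSum-cong (λ _ → zeros) ≈-refl (pentagonal-section 4 4<5)) HasSum-0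

theta-term-dilate : ∀ k .{{_ : NonZero k}} a b j → dilate k (theta-term a b j) ≈ theta-term (k ℕ.* a) (k ℕ.* b) j
theta-term-dilate k a b j = ≈-trans (dilate-⊗ k (constant (sign j)) _) (⊗-cong (dilate-constant k (sign j)) (≈-trans (dilate-q^ k _) (q^-≡ (scale j))))
  where
  scale : ∀ j → k ℕ.* theta-exponent a b j ≡ theta-exponent (k ℕ.* a) (k ℕ.* b) j
  distribute : ∀ s t → k ℕ.* (a ℕ.* s ℕ.+ b ℕ.* t) ≡ k ℕ.* a ℕ.* s ℕ.+ k ℕ.* b ℕ.* t
  distribute s t = trans (ℕ.*-distribˡ-+ k (a ℕ.* s) _) (sym (cong₂ ℕ._+_ (ℕ.*-assoc k a s) (ℕ.*-assoc k b t)))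
  scale (+ zero)  = ℕ.*-zeroʳ k
  scale (+ suc n) = distribute (triangular (suc n)) (triangular n)
  scale -[1+ n ]  = distribute (triangular n) (triangular (suc n))

-- Only the class i = 1 has residue 1, and its part is, up to sign, the pentagonal series at q⁵ with
-- the index reflected.
pentagonal-section-1 : section 1 (poch 1 1) ≈ ⊖ dilate 5 (poch 1 1)
pentagonal-section-1 = HasSum-unique
  (HasSum-cong (λ j → ≈-trans (solve 1 (λ t → con 0ℤ :+ con 0ℤ :+ con 0ℤ :+ t :+ con 0ℤ := t) ≈-refl _) (⊗-cong ≈-refl (⊗-identityˡ (theta-term 10 5 j))))
    ≈-refl (pentagonal-section 1 1<5))
  (HasSum-cong (λ j → ⊗-cong (≈-refl {constant (ℤ.- 1ℤ)}) (≈-trans (theta-term-dilate 5 1 2 (ℤ.- j)) (theta-term-neg 5 10 j)))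
    (solve 1 (λ x → con (ℤ.- 1ℤ) :* x := :- x) ≈-refl (dilate 5 (poch 1 1)))
    (HasSum-negate (HasSum-⊗ (constant (ℤ.- 1ℤ)) (HasSum-dilate 5 pentagonal))))

-- φ(-q)
phi : PowerSeries
phi = poch 2 2 ⊗ (poch 2 1 ⊗ poch 2 1)

-- f(-q³, -q⁷) and f(-q, -q⁹)
theta₃₇ theta₁₉ : PowerSeries
theta₃₇ = poch 10 10 ⊗ (poch 10 3 ⊗ poch 10 7)
theta₁₉ = poch 10 10 ⊗ (poch 10 1 ⊗ poch 10 9)

HasSum-phi : HasSum (theta-term 1 1) phi
HasSum-phi = jacobi-triple-product {1} {1} (s≤s z≤n) (s≤s z≤n)

HasSum-theta₃₇ : HasSum (theta-term 3 7) theta₃₇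
HasSum-theta₃₇ = jacobi-triple-product {3} {7} (s≤s z≤n) (s≤s z≤n)

HasSum-theta₁₉ : HasSum (theta-term 1 9) theta₁₉
HasSum-theta₁₉ = jacobi-triple-product {1} {9} (s≤s z≤n) (s≤s z≤n)

HasSum-theta-flip : ∀ {a b S} → HasSum (theta-term a b) S → HasSum (theta-term b a) S
HasSum-theta-flip {a} {b} s = HasSum-cong (theta-term-neg a b) ≈-refl (HasSum-negate s)

-- The exponents are squares, so the residue is that of i²: 4, 1, 0, 1, 4. The parts are theta
-- series with a′ + b′ = 10.
phi₋₂ : Split (theta-term 1 1) -[1+ 1 ]
phi₋₂ = theta-split 1 1 -[1+ 1 ] 4 4<5 0 1 9 (ℤsolve 1 (split-equation 1 1 -[1+ 1 ] 4 0 1 9) refl)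
phi₋₁ : Split (theta-term 1 1) -[1+ 0 ]
phi₋₁ = theta-split 1 1 -[1+ 0 ] 1 1<5 0 3 7 (ℤsolve 1 (split-equation 1 1 -[1+ 0 ] 1 0 3 7) refl)
phi₀ : Split (theta-term 1 1) (+ 0)
phi₀ = theta-split 1 1 (+ 0) 0 0<5 0 5 5 (ℤsolve 1 (split-equation 1 1 (+ 0) 0 0 5 5) refl)
phi₁ : Split (theta-term 1 1) (+ 1)
phi₁ = theta-split 1 1 (+ 1) 1 1<5 0 7 3 (ℤsolve 1 (split-equation 1 1 (+ 1) 1 0 7 3) refl)
phi₂ : Split (theta-term 1 1) (+ 2)
phi₂ = theta-split 1 1 (+ 2) 4 4<5 0 9 1 (ℤsolve 1 (split-equation 1 1 (+ 2) 4 0 9 1) refl)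

HasSum-signed : ∀ s {a b S} → HasSum (theta-term a b) S → HasSum (λ j → constant s ⊗ (q^ 0 ⊗ theta-term a b j)) (constant s ⊗ S)
HasSum-signed s {a} {b} h = HasSum-⊗ (constant s) (HasSum-cong (λ j → ≈-sym (⊗-identityˡ (theta-term a b j))) ≈-refl h)

HasSum-part₋₂ : HasSum (part phi₋₂) (constant 1ℤ ⊗ theta₁₉)
HasSum-part₋₂ = HasSum-signed 1ℤ HasSum-theta₁₉
HasSum-part₋₁ : HasSum (part phi₋₁) (constant (ℤ.- 1ℤ) ⊗ theta₃₇)
HasSum-part₋₁ = HasSum-signed (ℤ.- 1ℤ) HasSum-theta₃₇
HasSum-part₀ : HasSum (part phi₀) (constant 1ℤ ⊗ dilate 5 phi)
HasSum-part₀ = HasSum-signed 1ℤ (HasSum-cong (theta-term-dilate 5 1 1) ≈-refl (HasSum-dilate 5 HasSum-phi))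
HasSum-part₁ : HasSum (part phi₁) (constant (ℤ.- 1ℤ) ⊗ theta₃₇)
HasSum-part₁ = HasSum-signed (ℤ.- 1ℤ) (HasSum-theta-flip {3} {7} HasSum-theta₃₇)
HasSum-part₂ : HasSum (part phi₂) (constant 1ℤ ⊗ theta₁₉)
HasSum-part₂ = HasSum-signed 1ℤ (HasSum-theta-flip {1} {9} HasSum-theta₁₉)

phi-section : ∀ r → r < 5 → HasSum (λ j → section-of r phi₋₂ j ⊕ section-of r phi₋₁ j ⊕ section-of r phi₀ j
  ⊕ section-of r phi₁ j ⊕ section-of r phi₂ j) (section r phi)
phi-section = HasSum-sections phi₋₂ phi₋₁ phi₀ phi₁ phi₂ HasSum-phi

phi-section-0 : section 0 phi ≈ dilate 5 phi
phi-section-0 = HasSum-unique (phi-section 0 0<5) (HasSum-cong (λ _ → ≈-refl)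
  (solve 1 (λ x → con 0ℤ :+ con 0ℤ :+ con 1ℤ :* x :+ con 0ℤ :+ con 0ℤ := x) ≈-refl (dilate 5 phi))
  (HasSum-⊕ (HasSum-⊕ (HasSum-⊕ (HasSum-⊕ HasSum-0 HasSum-0) HasSum-part₀) HasSum-0) HasSum-0))

phi-section-1 : section 1 phi ≈ ⊖ (constant (+ 2) ⊗ theta₃₇)
phi-section-1 = HasSum-unique (phi-section 1 1<5) (HasSum-cong (λ _ → ≈-refl)
  (solve 1 (λ x → con 0ℤ :+ con (ℤ.- 1ℤ) :* x :+ con 0ℤ :+ con (ℤ.- 1ℤ) :* x :+ con 0ℤ := :- (con (+ 2) :* x)) ≈-refl theta₃₇)
  (HasSum-⊕ (HasSum-⊕ (HasSum-⊕ (HasSum-⊕ HasSum-0 HasSum-part₋₁) HasSum-0) HasSum-part₁) HasSum-0))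

phi-section-2 : section 2 phi ≈ constant 0ℤ
phi-section-2 = HasSum-unique (HasSum-cong (λ _ → zeros) ≈-refl (phi-section 2 2<5)) HasSum-0

phi-section-3 : section 3 phi ≈ constant 0ℤ
phi-section-3 = HasSum-unique (HasSum-cong (λ _ → zeros) ≈-refl (phi-section 3 3<5)) HasSum-0

phi-section-4 : section 4 phi ≈ constant (+ 2) ⊗ theta₁₉
phi-section-4 = HasSum-unique (phi-section 4 4<5) (HasSum-cong (λ _ → ≈-refl)
  (solve 1 (λ x → con 1ℤ :* x :+ con 0ℤ :+ con 0ℤ :+ con 0ℤ :+ con 1ℤ :* x := con (+ 2) :* x) ≈-refl theta₁₉)
  (HasSum-⊕ (HasSum-⊕ (HasSum-⊕ (HasSum-⊕ HasSum-part₋₂ HasSum-0) HasSum-0) HasSum-0) HasSum-part₂))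

-- The square of φ via multiplication by 2 + i in ℤ[i]

HasSum-split : ∀ {F i T} (σ : Split F i) → HasSum (part σ) T → HasSum (λ j → F (+ 5 ℤ.* j ℤ.+ i)) (q^ residue σ ⊗ dilate 5 T)
HasSum-split σ s = HasSum-cong (λ j → ≈-sym (split σ j)) ≈-refl (HasSum-⊗ (q^ residue σ) (HasSum-dilate 5 s))

-- The coefficient of qⁿ is determined modulo q^(n+1), hence the window of size `suc n`.
total : (ℤ → PowerSeries) → PowerSeries
total F n = window F (suc n) (suc n) n

HasSum-total : ∀ {F} → (∀ M → Supported M F) → HasSum F (total F)
sums (HasSum-total z) M = M , λ m n M≤m M≤n k k<M →
  window-stable {M = suc k} (z (suc k)) (ℕ.≤-trans k<M M≤m) (ℕ.≤-trans k<M M≤n) k ℕ.≤-refl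

monomial-⊗ : ∀ s t m n → (constant s ⊗ q^ m) ⊗ (constant t ⊗ q^ n) ≈ constant (s ℤ.* t) ⊗ q^ (m ℕ.+ n)
monomial-⊗ s t m n = ≈-trans (solve 4 (λ s t x y → (s :* x) :* (t :* y) := (s :* t) :* (x :* y)) ≈-refl (constant s) (constant t) (q^ m) (q^ n))
  (⊗-cong (≈-sym (constant-* s t)) (q^-+ m n))

module _ where
  private
    g g₅ : ℤ → PowerSeries
    g   = theta-term 1 1
    g₅ j = dilate 5 (g j)

    -- The terms of φ(-q⁵)² at (u, y) with u = x - 2y. This shear makes x = u + 2y, a coordinate of
    -- the rotated vector, one of the two summation variables.
    G : ℤ → ℤ → PowerSeries
    G x y = g₅ (x ℤ.+ ℤ.- (y ℤ.+ y)) ⊗ g₅ y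

    double-sign : ∀ i j → sign (i ℤ.+ (j ℤ.+ j)) ≡ sign i
    double-sign i j = trans (sign-+ i (j ℤ.+ j)) (trans (cong (sign i ℤ.*_) (trans (sign-+ j j) (alternating-square ℤ.∣ j ∣))) (ℤ.*-identityʳ (sign i)))

    -- Multiplication by 2 + i: with u = x - 2y, 5u² + 5y² = (2u - y)² + (u + 2y)² = (2x - 5y)² + x².
    rotate : ∀ x y → G x y ≈ g x ⊗ g (x ℤ.+ x ℤ.+ ℤ.- (+ 5 ℤ.* y))
    rotate x y = begin
      g₅ u ⊗ g₅ y
        ≈⟨ ⊗-cong (theta-term-dilate 5 1 1 u) (theta-term-dilate 5 1 1 y) ⟩
      theta-term 5 5 u ⊗ theta-term 5 5 y
        ≈⟨ monomial-⊗ (sign u) (sign y) (theta-exponent 5 5 u) (theta-exponent 5 5 y) ⟩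
      constant (sign u ℤ.* sign y) ⊗ q^ (theta-exponent 5 5 u ℕ.+ theta-exponent 5 5 y)
        ≈⟨ ⊗-cong (λ n → cong (λ z → constant z n) signs) (q^-≡ exponents) ⟩
      constant (sign x ℤ.* sign v) ⊗ q^ (theta-exponent 1 1 x ℕ.+ theta-exponent 1 1 v)
        ≈⟨ monomial-⊗ (sign x) (sign v) (theta-exponent 1 1 x) (theta-exponent 1 1 v) ⟨
      g x ⊗ g v ∎
      where
      open ≈-Reasoning
      u v : ℤ
      u = x ℤ.+ ℤ.- (y ℤ.+ y)
      v = x ℤ.+ x ℤ.+ ℤ.- (+ 5 ℤ.* y)
      -- Modulo 2, u agrees with x and v with y.
      signs : sign u ℤ.* sign y ≡ sign x ℤ.* sign v
      signs = cong₂ ℤ._*_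
        (trans (cong sign (ℤsolve 2 (λ x y → x :+ᶻ -ᶻ (y :+ᶻ y) :=ᶻ x :+ᶻ (-ᶻ y :+ᶻ -ᶻ y)) refl x y)) (double-sign x (ℤ.- y)))
        (sym (trans (cong sign (ℤsolve 2 (λ x y → x :+ᶻ x :+ᶻ -ᶻ (conᶻ (+ 5) :*ᶻ y) :=ᶻ y :+ᶻ ((x :+ᶻ -ᶻ (conᶻ (+ 3) :*ᶻ y)) :+ᶻ (x :+ᶻ -ᶻ (conᶻ (+ 3) :*ᶻ y)))) refl x y))
                    (double-sign y (x ℤ.+ ℤ.- (+ 3 ℤ.* y)))))
      twice-+ : ∀ a b i j → + 2 ℤ.* + (theta-exponent a b i ℕ.+ theta-exponent a b j) ≡ twice a b i ℤ.+ twice a b j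
      twice-+ a b i j = trans (ℤ.*-distribˡ-+ (+ 2) (+ theta-exponent a b i) (+ theta-exponent a b j)) (cong₂ ℤ._+_ (twice-theta-exponent a b i) (twice-theta-exponent a b j))
      exponents : theta-exponent 5 5 u ℕ.+ theta-exponent 5 5 y ≡ theta-exponent 1 1 x ℕ.+ theta-exponent 1 1 v
      exponents = exponent-from-twice $ trans (twice-+ 5 5 u y) (trans
        (ℤsolve 2 (λ x y → twiceᶻ 5 5 (x :+ᶻ -ᶻ (y :+ᶻ y)) :+ᶻ twiceᶻ 5 5 y :=ᶻ twiceᶻ 1 1 x :+ᶻ twiceᶻ 1 1 (x :+ᶻ x :+ᶻ -ᶻ (conᶻ (+ 5) :*ᶻ y))) refl x y)
        (sym (twice-+ 1 1 x v)))

    ⊗-vanishʳ : ∀ {M b} a → b ≈[ M ] constant 0ℤ → a ⊗ b ≈[ M ] constant 0ℤ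
    ⊗-vanishʳ a p = ≈[]-trans (⊗-≈[] (≈[]-refl {a}) p) (≈[]-all (solve 1 (λ a → a :* con 0ℤ := con 0ℤ) ≈-refl a))

    supported-y : ∀ M x → Supported M (G x)
    supported-y M x y M≤∣y∣ = ⊗-vanishʳ (g₅ (x ℤ.+ ℤ.- (y ℤ.+ y))) (≈[]-trans (dilate-≈[] 5 (theta-term-supported {1} {1} (s≤s z≤n) (s≤s z≤n) M y M≤∣y∣))
      (≈[]-all (dilate-constant 5 0ℤ)))

    -- Decay in x that is uniform in y becomes visible only after the rotation, where `g x` is a
    -- factor.
    supported-x : ∀ M y → Supported M (λ x → G x y)
    supported-x M y x M≤∣x∣ = ≈[]-trans (≈[]-all (≈-trans (rotate x y) (⊗-comm (g x) _)))
      (⊗-vanishʳ (g (x ℤ.+ x ℤ.+ ℤ.- (+ 5 ℤ.* y))) (theta-term-supported {1} {1} (s≤s z≤n) (s≤s z≤n) M x M≤∣x∣))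

    Φ : PowerSeries
    Φ = dilate 5 phi

    -- Summed over x first, the terms for fixed y form a translate of φ(-q⁵), so the total is Φ².
    -- The interchange moves this total to the other order of summation.
    HasSum-Φ² : HasSum (λ x → total (G x)) (Φ ⊗ Φ)
    HasSum-Φ² = HasSum-swap {G} {λ y → Φ ⊗ g₅ y} supported-y supported-x
      (λ y → HasSum-cong (λ x → ⊗-comm (g₅ y) (g₅ (x ℤ.+ ℤ.- (y ℤ.+ y)))) (⊗-comm (g₅ y) Φ)
        (HasSum-⊗ (g₅ y) (HasSum-translate {g₅} (ℤ.- (y ℤ.+ y)) (HasSum-dilate 5 HasSum-phi))))
      (HasSum-⊗ Φ (HasSum-dilate 5 HasSum-phi))
      (λ x → HasSum-total λ M → supported-y M x)

    -- For fixed x the second rotated coordinate 2x - 5y = 5(2z - y) + k runs through the whole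
    -- class of k modulo 5; a reflection and a translation of y make it the standard one.
    total-G : ∀ {T} k → HasSum (λ y → g (+ 5 ℤ.* y ℤ.+ k)) T → ∀ x z → x ℤ.+ x ≡ + 5 ℤ.* (z ℤ.+ z) ℤ.+ k → total (G x) ≈ g x ⊗ T
    total-G k s x z 2x≡ = HasSum-unique (HasSum-total λ M → supported-y M x)
      (HasSum-cong (λ y → ≈-trans (⊗-cong (≈-refl {g x}) (λ n → cong (λ i → g i n) (index y))) (≈-sym (rotate x y))) ≈-refl
        (HasSum-⊗ (g x) (HasSum-negate (HasSum-translate {λ y → g (+ 5 ℤ.* y ℤ.+ k)} (z ℤ.+ z) s))))
      where
      index : ∀ y → + 5 ℤ.* (ℤ.- y ℤ.+ (z ℤ.+ z)) ℤ.+ k ≡ x ℤ.+ x ℤ.+ ℤ.- (+ 5 ℤ.* y)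
      index y = trans (ℤsolve 3 (λ y w k → conᶻ (+ 5) :*ᶻ (-ᶻ y :+ᶻ w) :+ᶻ k :=ᶻ (conᶻ (+ 5) :*ᶻ w :+ᶻ k) :+ᶻ -ᶻ (conᶻ (+ 5) :*ᶻ y)) refl y (z ℤ.+ z) k)
        (cong (ℤ._+ ℤ.- (+ 5 ℤ.* y)) (sym 2x≡))

    T₀ T₁ T₂ : PowerSeries
    T₀ = q^ 0 ⊗ dilate 5 (constant 1ℤ ⊗ dilate 5 phi)
    T₁ = q^ 1 ⊗ dilate 5 (constant (ℤ.- 1ℤ) ⊗ theta₃₇)
    T₂ = q^ 4 ⊗ dilate 5 (constant 1ℤ ⊗ theta₁₉)

    t₋₂ : HasSum (λ j → g (+ 5 ℤ.* j ℤ.+ -[1+ 1 ])) T₂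
    t₋₂ = HasSum-split phi₋₂ HasSum-part₋₂
    t₋₁ : HasSum (λ j → g (+ 5 ℤ.* j ℤ.+ -[1+ 0 ])) T₁
    t₋₁ = HasSum-split phi₋₁ HasSum-part₋₁
    t₀ : HasSum (λ j → g (+ 5 ℤ.* j ℤ.+ + 0)) T₀
    t₀ = HasSum-split phi₀ HasSum-part₀
    t₁ : HasSum (λ j → g (+ 5 ℤ.* j ℤ.+ + 1)) T₁
    t₁ = HasSum-split phi₁ HasSum-part₁
    t₂ : HasSum (λ j → g (+ 5 ℤ.* j ℤ.+ + 2)) T₂
    t₂ = HasSum-split phi₂ HasSum-part₂
    -- The classes -4 and 4 arise as doubles of -2 and 2; modulo 5 they are the classes of 1 and -1.
    t₋₄ : HasSum (λ j → g (+ 5 ℤ.* j ℤ.+ -[1+ 3 ])) T₁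
    t₋₄ = HasSum-reindex {g} (λ j → ℤsolve 1 (λ j → conᶻ (+ 5) :*ᶻ (j :+ᶻ conᶻ -[1+ 0 ]) :+ᶻ conᶻ (+ 1) :=ᶻ conᶻ (+ 5) :*ᶻ j :+ᶻ conᶻ -[1+ 3 ]) refl j)
      (HasSum-translate {λ j → g (+ 5 ℤ.* j ℤ.+ + 1)} -[1+ 0 ] t₁)
    t₄ : HasSum (λ j → g (+ 5 ℤ.* j ℤ.+ + 4)) T₁
    t₄ = HasSum-reindex {g} (λ j → ℤsolve 1 (λ j → conᶻ (+ 5) :*ᶻ (j :+ᶻ conᶻ (+ 1)) :+ᶻ conᶻ -[1+ 0 ] :=ᶻ conᶻ (+ 5) :*ᶻ j :+ᶻ conᶻ (+ 4)) refl j)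
      (HasSum-translate {λ j → g (+ 5 ℤ.* j ℤ.+ -[1+ 0 ])} (+ 1) t₋₁)

    class : ∀ {S T} i k → HasSum (λ j → g (+ 5 ℤ.* j ℤ.+ i)) S → HasSum (λ y → g (+ 5 ℤ.* y ℤ.+ k)) T → k ≡ i ℤ.+ i →
      HasSum (λ z → total (G (+ 5 ℤ.* z ℤ.+ i))) (T ⊗ S)
    class {S} {T} i k s t refl = HasSum-cong (λ z → ≈-trans (⊗-comm T (g (+ 5 ℤ.* z ℤ.+ i))) (≈-sym (total-G k t (+ 5 ℤ.* z ℤ.+ i) z
        (ℤsolve 2 (λ z i → conᶻ (+ 5) :*ᶻ z :+ᶻ i :+ᶻ (conᶻ (+ 5) :*ᶻ z :+ᶻ i) :=ᶻ conᶻ (+ 5) :*ᶻ (z :+ᶻ z) :+ᶻ (i :+ᶻ i)) refl z i))))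
      ≈-refl (HasSum-⊗ T s)

    -- The class of x is paired with its double. Doubling exchanges {1, -1} and {2, -2} modulo 5, so
    -- each nonzero class contributes T₁ T₂ and the class of 0 contributes T₀².
    Φ²-classes : Φ ⊗ Φ ≈ T₁ ⊗ T₂ ⊕ T₂ ⊗ T₁ ⊕ T₀ ⊗ T₀ ⊕ T₂ ⊗ T₁ ⊕ T₁ ⊗ T₂
    Φ²-classes = HasSum-unique (HasSum-centred-fives HasSum-Φ²)
      (HasSum-⊕ (HasSum-⊕ (HasSum-⊕ (HasSum-⊕ (class -[1+ 1 ] -[1+ 3 ] t₋₂ t₋₄ refl) (class -[1+ 0 ] -[1+ 1 ] t₋₁ t₋₂ refl))
        (class (+ 0) (+ 0) t₀ t₀ refl)) (class (+ 1) (+ 2) t₁ t₂ refl)) (class (+ 2) (+ 4) t₂ t₄ refl))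

  phi-square : phi ⊗ phi ≈ dilate 5 phi ⊗ dilate 5 phi ⊕ ⊖ (constant (+ 4) ⊗ q ⊗ theta₃₇ ⊗ theta₁₉)
  phi-square = begin
    phi ⊗ phi
      -- The identity just obtained is one between series in q⁵; taking section 0 replaces q⁵ by q.
      ≈⟨ section-dilate (phi ⊗ phi) ⟨
    section 0 (dilate 5 (phi ⊗ phi))
      ≈⟨ section-cong 0 (begin
           dilate 5 (phi ⊗ phi)
             ≈⟨ dilate-⊗ 5 phi phi ⟩
           Φ ⊗ Φ
             ≈⟨ Φ²-classes ⟩
           T₁ ⊗ T₂ ⊕ T₂ ⊗ T₁ ⊕ T₀ ⊗ T₀ ⊕ T₂ ⊗ T₁ ⊕ T₁ ⊗ T₂
             ≈⟨ solve 6 (λ a x p y r u → x :* p :* (y :* r) :+ y :* r :* (x :* p) :+ u :* a :* (u :* a) :+ y :* r :* (x :* p) :+ x :* p :* (y :* r) :=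
                  u :* u :* (a :* a) :+ con (+ 4) :* (x :* y :* (p :* r))) ≈-refl D₀ (q^ 1) D₁ (q^ 4) D₂ (q^ 0) ⟩
           q^ 0 ⊗ q^ 0 ⊗ (D₀ ⊗ D₀) ⊕ constant (+ 4) ⊗ (q^ 1 ⊗ q^ 4 ⊗ (D₁ ⊗ D₂))
             ≈⟨ ⊕-cong (⊗-cong (≈-trans (q^-+ 0 0) 1#≈constant) (≈-sym (dilate-⊗ 5 e₀ e₀)))
                  (⊗-cong (≈-sym (dilate-constant 5 (+ 4))) (⊗-cong (≈-trans (q^-+ 1 4) (≈-sym (dilate-q^ 5 1))) (≈-sym (dilate-⊗ 5 e₁ e₂)))) ⟩
           constant 1ℤ ⊗ dilate 5 (e₀ ⊗ e₀) ⊕ dilate 5 (constant (+ 4)) ⊗ (dilate 5 q ⊗ dilate 5 (e₁ ⊗ e₂))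
             ≈⟨ ⊕-cong (solve 1 (λ x → con 1ℤ :* x := x) ≈-refl _) (≈-sym (≈-trans (dilate-⊗ 5 (constant (+ 4)) _) (⊗-cong (≈-refl {dilate 5 (constant (+ 4))}) (dilate-⊗ 5 q _)))) ⟩
           dilate 5 (e₀ ⊗ e₀) ⊕ dilate 5 (constant (+ 4) ⊗ (q ⊗ (e₁ ⊗ e₂)))
             ≈⟨ dilate-⊕ 5 (e₀ ⊗ e₀) _ ⟨
           dilate 5 (e₀ ⊗ e₀ ⊕ constant (+ 4) ⊗ (q ⊗ (e₁ ⊗ e₂))) ∎) ⟩
    section 0 (dilate 5 (e₀ ⊗ e₀ ⊕ constant (+ 4) ⊗ (q ⊗ (e₁ ⊗ e₂))))
      ≈⟨ section-dilate _ ⟩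
    e₀ ⊗ e₀ ⊕ constant (+ 4) ⊗ (q ⊗ (e₁ ⊗ e₂))
      ≈⟨ solve 4 (λ a p r Q → con 1ℤ :* a :* (con 1ℤ :* a) :+ con (+ 4) :* (Q :* ((con (ℤ.- 1ℤ) :* p) :* (con 1ℤ :* r))) :=
           a :* a :+ :- (con (+ 4) :* Q :* p :* r)) ≈-refl (dilate 5 phi) theta₃₇ theta₁₉ q ⟩
    dilate 5 phi ⊗ dilate 5 phi ⊕ ⊖ (constant (+ 4) ⊗ q ⊗ theta₃₇ ⊗ theta₁₉) ∎
    where
    open ≈-Reasoning
    e₀ e₁ e₂ D₀ D₁ D₂ : PowerSeries
    e₀ = constant 1ℤ ⊗ dilate 5 phi
    e₁ = constant (ℤ.- 1ℤ) ⊗ theta₃₇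
    e₂ = constant 1ℤ ⊗ theta₁₉
    D₀ = dilate 5 e₀
    D₁ = dilate 5 e₁
    D₂ = dilate 5 e₂
    section-dilate : ∀ a → section 0 (dilate 5 a) ≈ a
    section-dilate a = ≈-trans (section-cong 0 (≈-sym (⊗-identityˡ (dilate 5 a)))) (section-same 0 a)

-- The section H₂

dilate-poch : ∀ k .{{_ : NonZero k}} {c a} → 1 ≤ c → 1 ≤ a → dilate k (poch c a) ≈ poch (k ℕ.* c) (k ℕ.* a)
dilate-poch k {c} {a} 1≤c 1≤a = ≈[]-limit λ M → ≈[]-trans (dilate-≈[] k (≈[]-sym (poch-stable {c} {a} 1≤c 1≤a (ℕ.≤-refl {M}))))
  (≈[]-trans (≈[]-all (finite M)) (poch-stable (positive 1≤c) (positive 1≤a) ℕ.≤-refl))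
  where
  positive : ∀ {m} → 1 ≤ m → 1 ≤ k ℕ.* m
  positive = ℕ.*-mono-≤ (ℕ.>-nonZero⁻¹ k)
  finite : ∀ N → dilate k (poch< c a N) ≈ poch< (k ℕ.* c) (k ℕ.* a) N
  finite zero    = dilate-constant k 1ℤ
  finite (suc N) = ≈-trans (dilate-⊗ k (poch< c a N) (factor (a ℕ.+ c ℕ.* N))) (⊗-cong (finite N)
    (≈-trans (dilate-⊕ k (constant 1ℤ) _) (⊕-cong (dilate-constant k 1ℤ) (≈-trans (dilate-⊖ k (q^ (a ℕ.+ c ℕ.* N))) (⊖-cong (≈-trans (dilate-q^ k (a ℕ.+ c ℕ.* N))
      (q^-≡ (trans (ℕ.*-distribˡ-+ k a (c ℕ.* N)) (cong (k ℕ.* a ℕ.+_) (sym (ℕ.*-assoc k c N)))))))))))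

unit-cancelˡ : ∀ {u a x y} → a ⊗ u ≈ constant 1ℤ → a ⊗ x ≈ a ⊗ y → x ≈ y
unit-cancelˡ {u} {a} {x} {y} unit p = begin
  x                  ≈⟨ expand x ⟩
  u ⊗ (a ⊗ x)        ≈⟨ ⊗-cong ≈-refl p ⟩
  u ⊗ (a ⊗ y)        ≈⟨ expand y ⟨
  y                  ∎
  where
  open ≈-Reasoning
  expand : ∀ x → x ≈ u ⊗ (a ⊗ x)
  expand x = ≈-trans (solve 1 (λ x → x := con 1ℤ :* x) ≈-refl x) (≈-trans (⊗-cong (≈-sym unit) ≈-refl)
    (solve 3 (λ u a x → a :* u :* x := u :* (a :* x)) ≈-refl u a x))

constant-cancelˡ : ∀ z .{{_ : ℤ.NonZero z}} {a b} → constant z ⊗ a ≈ constant z ⊗ b → a ≈ b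
constant-cancelˡ z {a} {b} p n = ℤ.*-cancelˡ-≡ z (a n) (b n) (trans (sym (constant-⊗ z a n)) (trans (p n) (constant-⊗ z b n)))

F₁ F₂ F₅ F₁₀ G₁ G₂ G₅ G₁₀ A B C α β γ a b c H : PowerSeries
F₁  = poch 1 1
F₂  = poch 2 2
F₅  = poch 5 5
F₁₀ = poch 10 10
G₁  = F₁ ⁻¹
G₂  = F₂ ⁻¹
G₅  = F₅ ⁻¹
G₁₀ = F₁₀ ⁻¹
A   = section 0 F₁
B   = ⊖ F₅
C   = section 2 F₁
α   = dilate 2 A
β   = ⊖ F₁₀
γ   = dilate 2 C
a   = dilate 5 phi
b   = ⊖ (constant (+ 2) ⊗ theta₃₇)
c   = constant (+ 2) ⊗ theta₁₉
H   = F₂ ⊗ F₂ ⊗ (G₁ ⊗ G₁)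

FG₁ : F₁ ⊗ G₁ ≈ constant 1ℤ
FG₁ = ⊗-inverse F₁ refl
FG₂ : F₂ ⊗ G₂ ≈ constant 1ℤ
FG₂ = ⊗-inverse F₂ refl
FG₅ : F₅ ⊗ G₅ ≈ constant 1ℤ
FG₅ = ⊗-inverse F₅ refl
FG₁₀ : F₁₀ ⊗ G₁₀ ≈ constant 1ℤ
FG₁₀ = ⊗-inverse F₁₀ refl

F₁-dissection : F₁ ≈ assemble A B C (constant 0ℤ) (constant 0ℤ)
F₁-dissection = ≈-trans (≈-sym (assemble-sections F₁)) (assemble-cong (≈-refl {A})
  (≈-trans pentagonal-section-1 (⊖-cong (dilate-poch 5 {1} {1} (s≤s z≤n) (s≤s z≤n)))) (≈-refl {C}) pentagonal-section-3 pentagonal-section-4)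

-- Substituting q² for q in the dissection of f₁ doubles the residues 0, 1, 2 and commutes with the
-- dilation by 5.
F₂-dissection : F₂ ≈ assemble α (constant 0ℤ) β (constant 0ℤ) γ
F₂-dissection = begin
  F₂
    ≈⟨ dilate-poch 2 {1} {1} (s≤s z≤n) (s≤s z≤n) ⟨
  dilate 2 F₁
    ≈⟨ dilate-cong 2 F₁-dissection ⟩
  dilate 2 (assemble A B C (constant 0ℤ) (constant 0ℤ))
    ≈⟨ dilate-cong 2 (⊕-cong (⊕-cong ≈-refl (zero-term (q ⊗ q ⊗ q))) (zero-term (q ⊗ q ⊗ q ⊗ q))) ⟩
  dilate 2 (dilate 5 A ⊕ q ⊗ dilate 5 B ⊕ q ⊗ q ⊗ dilate 5 C ⊕ constant 0ℤ ⊕ constant 0ℤ)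
    ≈⟨ dilate-cong 2 (solve 3 (λ x y z → x :+ y :+ z :+ con 0ℤ :+ con 0ℤ := x :+ y :+ z) ≈-refl (dilate 5 A) (q ⊗ dilate 5 B) (q ⊗ q ⊗ dilate 5 C)) ⟩
  dilate 2 (dilate 5 A ⊕ q ⊗ dilate 5 B ⊕ q ⊗ q ⊗ dilate 5 C)
    ≈⟨ ≈-trans (dilate-⊕ 2 (dilate 5 A ⊕ q ⊗ dilate 5 B) (q ⊗ q ⊗ dilate 5 C)) (⊕-cong (≈-trans (dilate-⊕ 2 (dilate 5 A) (q ⊗ dilate 5 B))
         (⊕-cong (exchange A) (≈-trans (dilate-⊗ 2 q (dilate 5 B)) (⊗-cong q² (≈-trans (exchange B) (dilate-cong 5 dilate-B))))))
         (≈-trans (dilate-⊗ 2 (q ⊗ q) (dilate 5 C)) (⊗-cong (≈-trans (dilate-⊗ 2 q q) (⊗-cong q² q²)) (exchange C)))) ⟩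
  dilate 5 α ⊕ q ⊗ q ⊗ dilate 5 β ⊕ q ⊗ q ⊗ (q ⊗ q) ⊗ dilate 5 γ
    ≈⟨ solve 4 (λ x y z Q → x :+ Q :* Q :* y :+ Q :* Q :* (Q :* Q) :* z :=
         x :+ Q :* con 0ℤ :+ Q :* Q :* y :+ Q :* Q :* Q :* con 0ℤ :+ Q :* Q :* Q :* Q :* z) ≈-refl (dilate 5 α) (dilate 5 β) (dilate 5 γ) q ⟩
  dilate 5 α ⊕ q ⊗ constant 0ℤ ⊕ q ⊗ q ⊗ dilate 5 β ⊕ q ⊗ q ⊗ q ⊗ constant 0ℤ ⊕ q ⊗ q ⊗ q ⊗ q ⊗ dilate 5 γ
    ≈⟨ ⊕-cong (⊕-cong (⊕-cong (⊕-cong ≈-refl (⊗-cong ≈-refl (≈-sym (dilate-constant 5 0ℤ)))) ≈-refl) (⊗-cong ≈-refl (≈-sym (dilate-constant 5 0ℤ)))) ≈-refl ⟩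
  assemble α (constant 0ℤ) β (constant 0ℤ) γ ∎
  where
  open ≈-Reasoning
  zero-term : ∀ x → x ⊗ dilate 5 (constant 0ℤ) ≈ constant 0ℤ
  zero-term x = ≈-trans (⊗-cong ≈-refl (dilate-constant 5 0ℤ)) (solve 1 (λ x → x :* con 0ℤ := con 0ℤ) ≈-refl x)
  exchange : ∀ x → dilate 2 (dilate 5 x) ≈ dilate 5 (dilate 2 x)
  exchange x = ≈-trans (dilate-dilate 2 5 x) (≈-sym (dilate-dilate 5 2 x))
  q² : dilate 2 q ≈ q ⊗ q
  q² = ≈-trans (dilate-q^ 2 1) (≈-sym (q^-+ 1 1))
  dilate-B : dilate 2 B ≈ β
  dilate-B = ≈-trans (dilate-⊖ 2 F₅) (⊖-cong (dilate-poch 2 {5} {5} (s≤s z≤n) (s≤s z≤n)))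

phi-dissection : phi ≈ assemble a b (constant 0ℤ) (constant 0ℤ) c
phi-dissection = ≈-trans (≈-sym (assemble-sections phi)) (assemble-cong phi-section-0 phi-section-1 phi-section-2 phi-section-3 phi-section-4)

-- By parity of the exponents f₁ = (q; q²)_∞ f₂, while φ is f₂ (q; q²)_∞² by the triple product.
phi⊗F₂ : phi ⊗ F₂ ≈ F₁ ⊗ F₁
phi⊗F₂ = begin
  F₂ ⊗ (p ⊗ p) ⊗ F₂
    ≈⟨ solve 2 (λ f p → f :* (p :* p) :* f := con 1ℤ :* p :* f :* (con 1ℤ :* p :* f)) ≈-refl F₂ p ⟩
  constant 1ℤ ⊗ p ⊗ F₂ ⊗ (constant 1ℤ ⊗ p ⊗ F₂)
    ≈⟨ ⊗-cong F₁-halves F₁-halves ⟨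
  F₁ ⊗ F₁ ∎
  where
  open ≈-Reasoning
  p : PowerSeries
  p = poch 2 1
  F₁-halves : F₁ ≈ constant 1ℤ ⊗ p ⊗ F₂
  F₁-halves = poch-split {1} {1} (s≤s z≤n) (s≤s z≤n) 2 (s≤s z≤n)

a⊗F₁₀ : a ⊗ F₁₀ ≈ F₅ ⊗ F₅
a⊗F₁₀ = begin
  dilate 5 phi ⊗ F₁₀          ≈⟨ ⊗-cong ≈-refl (≈-sym (dilate-poch 5 {2} {2} (s≤s z≤n) (s≤s z≤n))) ⟩
  dilate 5 phi ⊗ dilate 5 F₂  ≈⟨ dilate-⊗ 5 phi F₂ ⟨
  dilate 5 (phi ⊗ F₂)         ≈⟨ dilate-cong 5 phi⊗F₂ ⟩
  dilate 5 (F₁ ⊗ F₁)          ≈⟨ dilate-⊗ 5 F₁ F₁ ⟩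
  dilate 5 F₁ ⊗ dilate 5 F₁   ≈⟨ ⊗-cong F₅-dilate F₅-dilate ⟩
  F₅ ⊗ F₅                     ∎
  where
  open ≈-Reasoning
  F₅-dilate : dilate 5 F₁ ≈ F₅
  F₅-dilate = dilate-poch 5 {1} {1} (s≤s z≤n) (s≤s z≤n)

-- The theta series supply the residues 1, 3, 7, 9 modulo 10, f₂ the even ones and f₅ the residue 5.
-- Together they fill f₁, and three of the four factors f₁₀ are left over.
theta₃₇⊗theta₁₉ : theta₃₇ ⊗ theta₁₉ ⊗ F₂ ⊗ F₅ ≈ F₁ ⊗ F₁₀ ⊗ F₁₀ ⊗ F₁₀
theta₃₇⊗theta₁₉ = begin
  F₁₀ ⊗ (p 3 ⊗ p 7) ⊗ (F₁₀ ⊗ (p 1 ⊗ p 9)) ⊗ F₂ ⊗ F₅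
    ≈⟨ ⊗-cong (⊗-cong ≈-refl (poch-split {2} {2} (s≤s z≤n) (s≤s z≤n) 5 (s≤s z≤n))) (poch-split {5} {5} (s≤s z≤n) (s≤s z≤n) 2 (s≤s z≤n)) ⟩
  F₁₀ ⊗ (p 3 ⊗ p 7) ⊗ (F₁₀ ⊗ (p 1 ⊗ p 9)) ⊗ (constant 1ℤ ⊗ p 2 ⊗ p 4 ⊗ p 6 ⊗ p 8 ⊗ F₁₀) ⊗ (constant 1ℤ ⊗ p 5 ⊗ F₁₀)
    ≈⟨ solve 10 (λ p₁ p₂ p₃ p₄ p₅ p₆ p₇ p₈ p₉ f →
         f :* (p₃ :* p₇) :* (f :* (p₁ :* p₉)) :* (con 1ℤ :* p₂ :* p₄ :* p₆ :* p₈ :* f) :* (con 1ℤ :* p₅ :* f) :=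
         con 1ℤ :* p₁ :* p₂ :* p₃ :* p₄ :* p₅ :* p₆ :* p₇ :* p₈ :* p₉ :* f :* f :* f :* f) ≈-refl
         (p 1) (p 2) (p 3) (p 4) (p 5) (p 6) (p 7) (p 8) (p 9) F₁₀ ⟩
  constant 1ℤ ⊗ p 1 ⊗ p 2 ⊗ p 3 ⊗ p 4 ⊗ p 5 ⊗ p 6 ⊗ p 7 ⊗ p 8 ⊗ p 9 ⊗ F₁₀ ⊗ F₁₀ ⊗ F₁₀ ⊗ F₁₀
    ≈⟨ ⊗-cong (⊗-cong (⊗-cong (poch-split {1} {1} (s≤s z≤n) (s≤s z≤n) 10 (s≤s z≤n)) ≈-refl) ≈-refl) ≈-refl ⟨
  F₁ ⊗ F₁₀ ⊗ F₁₀ ⊗ F₁₀ ∎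
  where
  open ≈-Reasoning
  p : ℕ → PowerSeries
  p = poch 10

module _ {x y : PowerSeries} (x₀ x₁ x₂ x₃ x₄ y₀ y₁ y₂ y₃ y₄ : PowerSeries)
  (x-dissection : x ≈ assemble x₀ x₁ x₂ x₃ x₄) (y-dissection : y ≈ assemble y₀ y₁ y₂ y₃ y₄) where

  private
    z₀ z₁ z₂ z₃ z₄ : PowerSeries
    z₀ = x₀ ⊗ y₀ ⊕ q ⊗ (x₁ ⊗ y₄ ⊕ x₂ ⊗ y₃ ⊕ x₃ ⊗ y₂ ⊕ x₄ ⊗ y₁)
    z₁ = x₀ ⊗ y₁ ⊕ x₁ ⊗ y₀ ⊕ q ⊗ (x₂ ⊗ y₄ ⊕ x₃ ⊗ y₃ ⊕ x₄ ⊗ y₂)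
    z₂ = x₀ ⊗ y₂ ⊕ x₁ ⊗ y₁ ⊕ x₂ ⊗ y₀ ⊕ q ⊗ (x₃ ⊗ y₄ ⊕ x₄ ⊗ y₃)
    z₃ = x₀ ⊗ y₃ ⊕ x₁ ⊗ y₂ ⊕ x₂ ⊗ y₁ ⊕ x₃ ⊗ y₀ ⊕ q ⊗ (x₄ ⊗ y₄)
    z₄ = x₀ ⊗ y₄ ⊕ x₁ ⊗ y₃ ⊕ x₂ ⊗ y₂ ⊕ x₃ ⊗ y₁ ⊕ x₄ ⊗ y₀

    product : x ⊗ y ≈ assemble z₀ z₁ z₂ z₃ z₄
    product = ≈-trans (⊗-cong x-dissection y-dissection) (assemble-⊗ x₀ x₁ x₂ x₃ x₄ y₀ y₁ y₂ y₃ y₄)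

  section-⊗-0 : section 0 (x ⊗ y) ≈ x₀ ⊗ y₀ ⊕ q ⊗ (x₁ ⊗ y₄ ⊕ x₂ ⊗ y₃ ⊕ x₃ ⊗ y₂ ⊕ x₄ ⊗ y₁)
  section-⊗-0 = ≈-trans (section-cong 0 product) (section-assemble-0 z₀ z₁ z₂ z₃ z₄)

  section-⊗-1 : section 1 (x ⊗ y) ≈ x₀ ⊗ y₁ ⊕ x₁ ⊗ y₀ ⊕ q ⊗ (x₂ ⊗ y₄ ⊕ x₃ ⊗ y₃ ⊕ x₄ ⊗ y₂)
  section-⊗-1 = ≈-trans (section-cong 1 product) (section-assemble-1 z₀ z₁ z₂ z₃ z₄)

  section-⊗-2 : section 2 (x ⊗ y) ≈ x₀ ⊗ y₂ ⊕ x₁ ⊗ y₁ ⊕ x₂ ⊗ y₀ ⊕ q ⊗ (x₃ ⊗ y₄ ⊕ x₄ ⊗ y₃)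
  section-⊗-2 = ≈-trans (section-cong 2 product) (section-assemble-2 z₀ z₁ z₂ z₃ z₄)

  section-⊗-3 : section 3 (x ⊗ y) ≈ x₀ ⊗ y₃ ⊕ x₁ ⊗ y₂ ⊕ x₂ ⊗ y₁ ⊕ x₃ ⊗ y₀ ⊕ q ⊗ (x₄ ⊗ y₄)
  section-⊗-3 = ≈-trans (section-cong 3 product) (section-assemble-3 z₀ z₁ z₂ z₃ z₄)

  section-⊗-4 : section 4 (x ⊗ y) ≈ x₀ ⊗ y₄ ⊕ x₁ ⊗ y₃ ⊕ x₂ ⊗ y₂ ⊕ x₃ ⊗ y₁ ⊕ x₄ ⊗ y₀
  section-⊗-4 = ≈-trans (section-cong 4 product) (section-assemble-4 z₀ z₁ z₂ z₃ z₄)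

F₁²-section : ∀ r → section r (phi ⊗ F₂) ≈ section r (F₁ ⊗ F₁)
F₁²-section r = section-cong r phi⊗F₂

module _ where
  0ₛ : PowerSeries
  0ₛ = constant 0ℤ
  open ≈-Reasoning

  -- Since 1/f₁₀ = a/f₅², dividing the sections of f₁² by f₁₀ produces expressions in a, y and y⁻¹.
  a⊗G₅⊗G₅ : a ⊗ (G₅ ⊗ G₅) ≈ G₁₀
  a⊗G₅⊗G₅ = begin
    a ⊗ (G₅ ⊗ G₅)
      ≈⟨ solve 2 (λ a g → a :* (g :* g) := a :* con 1ℤ :* (g :* g)) ≈-refl a G₅ ⟩
    a ⊗ constant 1ℤ ⊗ (G₅ ⊗ G₅)
      ≈⟨ ⊗-cong (⊗-cong (≈-refl {a}) (≈-sym FG₁₀)) ≈-refl ⟩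
    a ⊗ (F₁₀ ⊗ G₁₀) ⊗ (G₅ ⊗ G₅)
      ≈⟨ solve 4 (λ a f g h → a :* (f :* g) :* (h :* h) := a :* f :* (h :* h) :* g) ≈-refl a F₁₀ G₁₀ G₅ ⟩
    a ⊗ F₁₀ ⊗ (G₅ ⊗ G₅) ⊗ G₁₀
      ≈⟨ ⊗-cong (⊗-cong a⊗F₁₀ ≈-refl) ≈-refl ⟩
    F₅ ⊗ F₅ ⊗ (G₅ ⊗ G₅) ⊗ G₁₀
      ≈⟨ solve 3 (λ f g h → f :* f :* (g :* g) :* h := f :* g :* (f :* g) :* h) ≈-refl F₅ G₅ G₁₀ ⟩
    F₅ ⊗ G₅ ⊗ (F₅ ⊗ G₅) ⊗ G₁₀
      ≈⟨ ⊗-cong (⊗-cong FG₅ FG₅) ≈-refl ⟩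
    constant 1ℤ ⊗ constant 1ℤ ⊗ G₁₀
      ≈⟨ solve 1 (λ g → con 1ℤ :* con 1ℤ :* g := g) ≈-refl G₁₀ ⟩
    G₁₀ ∎

  a⊗G₅ : a ⊗ G₅ ≈ F₅ ⊗ G₁₀
  a⊗G₅ = begin
    a ⊗ G₅
      ≈⟨ solve 2 (λ a g → a :* g := a :* con 1ℤ :* g) ≈-refl a G₅ ⟩
    a ⊗ constant 1ℤ ⊗ G₅
      ≈⟨ ⊗-cong (⊗-cong (≈-refl {a}) (≈-sym FG₅)) ≈-refl ⟩
    a ⊗ (F₅ ⊗ G₅) ⊗ G₅
      ≈⟨ solve 3 (λ a f g → a :* (f :* g) :* g := f :* (a :* (g :* g))) ≈-refl a F₅ G₅ ⟩
    F₅ ⊗ (a ⊗ (G₅ ⊗ G₅))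
      ≈⟨ ⊗-cong ≈-refl a⊗G₅⊗G₅ ⟩
    F₅ ⊗ G₁₀ ∎

  A⊗C : A ⊗ C ≈ ⊖ (F₅ ⊗ F₅)
  A⊗C = constant-cancelˡ (+ 2) (begin
    constant (+ 2) ⊗ (A ⊗ C)
      ≈⟨ solve 4 (λ A f C Q → con (+ 2) :* (A :* C) :=
           A :* C :+ (:- f) :* (:- f) :+ C :* A :+ Q :* (con 0ℤ :* con 0ℤ :+ con 0ℤ :* con 0ℤ) :+ :- (f :* f)) ≈-refl A F₅ C q ⟩
    A ⊗ C ⊕ B ⊗ B ⊕ C ⊗ A ⊕ q ⊗ (0ₛ ⊗ 0ₛ ⊕ 0ₛ ⊗ 0ₛ) ⊕ ⊖ (F₅ ⊗ F₅)
      ≈⟨ ⊕-cong (≈-trans (≈-sym (section-⊗-2 A B C 0ₛ 0ₛ A B C 0ₛ 0ₛ F₁-dissection F₁-dissection)) (≈-trans (≈-sym (F₁²-section 2))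
           (section-⊗-2 a b 0ₛ 0ₛ c α 0ₛ β 0ₛ γ phi-dissection F₂-dissection))) ≈-refl ⟩
    a ⊗ β ⊕ b ⊗ 0ₛ ⊕ 0ₛ ⊗ α ⊕ q ⊗ (0ₛ ⊗ γ ⊕ c ⊗ 0ₛ) ⊕ ⊖ (F₅ ⊗ F₅)
      ≈⟨ solve 8 (λ a b c α γ f g Q → a :* (:- g) :+ b :* con 0ℤ :+ con 0ℤ :* α :+ Q :* (con 0ℤ :* γ :+ c :* con 0ℤ) :+ :- (f :* f) :=
           :- (a :* g) :+ :- (f :* f)) ≈-refl a b c α γ F₅ F₁₀ q ⟩
    ⊖ (a ⊗ F₁₀) ⊕ ⊖ (F₅ ⊗ F₅)
      ≈⟨ ⊕-cong (⊖-cong a⊗F₁₀) ≈-refl ⟩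
    ⊖ (F₅ ⊗ F₅) ⊕ ⊖ (F₅ ⊗ F₅)
      ≈⟨ solve 1 (λ f → :- (f :* f) :+ :- (f :* f) := con (+ 2) :* :- (f :* f)) ≈-refl F₅ ⟩
    constant (+ 2) ⊗ ⊖ (F₅ ⊗ F₅) ∎)

  α⊗γ : α ⊗ γ ≈ ⊖ (F₁₀ ⊗ F₁₀)
  α⊗γ = begin
    dilate 2 A ⊗ dilate 2 C           ≈⟨ dilate-⊗ 2 A C ⟨
    dilate 2 (A ⊗ C)                  ≈⟨ dilate-cong 2 A⊗C ⟩
    dilate 2 (⊖ (F₅ ⊗ F₅))            ≈⟨ dilate-⊖ 2 (F₅ ⊗ F₅) ⟩
    ⊖ dilate 2 (F₅ ⊗ F₅)              ≈⟨ ⊖-cong (dilate-⊗ 2 F₅ F₅) ⟩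
    ⊖ (dilate 2 F₅ ⊗ dilate 2 F₅)     ≈⟨ ⊖-cong (⊗-cong F₁₀-dilate F₁₀-dilate) ⟩
    ⊖ (F₁₀ ⊗ F₁₀)                     ∎
    where
    F₁₀-dilate : dilate 2 F₅ ≈ F₁₀
    F₁₀-dilate = dilate-poch 2 {5} {5} (s≤s z≤n) (s≤s z≤n)

  x x⁻¹ y y⁻¹ : PowerSeries
  x   = α ⊗ G₁₀
  x⁻¹ = ⊖ γ ⊗ G₁₀
  y   = ⊖ A ⊗ G₅
  y⁻¹ = C ⊗ G₅

  x-inverse : x ⊗ x⁻¹ ≈ constant 1ℤ
  x-inverse = begin
    α ⊗ G₁₀ ⊗ (⊖ γ ⊗ G₁₀)
      ≈⟨ solve 3 (λ α γ g → α :* g :* ((:- γ) :* g) := :- (α :* γ) :* (g :* g)) ≈-refl α γ G₁₀ ⟩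
    ⊖ (α ⊗ γ) ⊗ (G₁₀ ⊗ G₁₀)
      ≈⟨ ⊗-cong (⊖-cong α⊗γ) ≈-refl ⟩
    ⊖ (⊖ (F₁₀ ⊗ F₁₀)) ⊗ (G₁₀ ⊗ G₁₀)
      ≈⟨ solve 2 (λ f g → :- (:- (f :* f)) :* (g :* g) := f :* g :* (f :* g)) ≈-refl F₁₀ G₁₀ ⟩
    F₁₀ ⊗ G₁₀ ⊗ (F₁₀ ⊗ G₁₀)
      ≈⟨ ⊗-cong FG₁₀ FG₁₀ ⟩
    constant 1ℤ ⊗ constant 1ℤ
      ≈⟨ solve 0 (con 1ℤ :* con 1ℤ := con 1ℤ) ≈-refl ⟩
    constant 1ℤ ∎

  y-inverse : y ⊗ y⁻¹ ≈ constant 1ℤ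
  y-inverse = begin
    ⊖ A ⊗ G₅ ⊗ (C ⊗ G₅)
      ≈⟨ solve 3 (λ A C g → (:- A) :* g :* (C :* g) := :- (A :* C) :* (g :* g)) ≈-refl A C G₅ ⟩
    ⊖ (A ⊗ C) ⊗ (G₅ ⊗ G₅)
      ≈⟨ ⊗-cong (⊖-cong A⊗C) ≈-refl ⟩
    ⊖ (⊖ (F₅ ⊗ F₅)) ⊗ (G₅ ⊗ G₅)
      ≈⟨ solve 2 (λ f g → :- (:- (f :* f)) :* (g :* g) := f :* g :* (f :* g)) ≈-refl F₅ G₅ ⟩
    F₅ ⊗ G₅ ⊗ (F₅ ⊗ G₅)
      ≈⟨ ⊗-cong FG₅ FG₅ ⟩
    constant 1ℤ ⊗ constant 1ℤ
      ≈⟨ solve 0 (con 1ℤ :* con 1ℤ := con 1ℤ) ≈-refl ⟩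
    constant 1ℤ ∎

  g₀ : a ⊗ x ⊕ ⊖ (q ⊗ b ⊗ x⁻¹) ≈ a ⊗ y ⊗ y
  g₀ = begin
    a ⊗ (α ⊗ G₁₀) ⊕ ⊖ (q ⊗ b ⊗ (⊖ γ ⊗ G₁₀))
      -- The products with vanishing sections are restored, to give the expression the shape of
      -- `section-⊗-0`.
      ≈⟨ solve 8 (λ a b c α γ f g Q → a :* (α :* g) :+ :- (Q :* b :* ((:- γ) :* g)) :=
           (a :* α :+ Q :* (b :* γ :+ con 0ℤ :* con 0ℤ :+ con 0ℤ :* (:- f) :+ c :* con 0ℤ)) :* g) ≈-refl a b c α γ F₁₀ G₁₀ q ⟩
    (a ⊗ α ⊕ q ⊗ (b ⊗ γ ⊕ 0ₛ ⊗ 0ₛ ⊕ 0ₛ ⊗ β ⊕ c ⊗ 0ₛ)) ⊗ G₁₀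
      ≈⟨ ⊗-cong (≈-trans (≈-sym (section-⊗-0 a b 0ₛ 0ₛ c α 0ₛ β 0ₛ γ phi-dissection F₂-dissection)) (≈-trans (F₁²-section 0)
           (section-⊗-0 A B C 0ₛ 0ₛ A B C 0ₛ 0ₛ F₁-dissection F₁-dissection))) (≈-sym a⊗G₅⊗G₅) ⟩
    (A ⊗ A ⊕ q ⊗ (B ⊗ 0ₛ ⊕ C ⊗ 0ₛ ⊕ 0ₛ ⊗ C ⊕ 0ₛ ⊗ B)) ⊗ (a ⊗ (G₅ ⊗ G₅))
      ≈⟨ solve 6 (λ a A B C g Q → (A :* A :+ Q :* (B :* con 0ℤ :+ C :* con 0ℤ :+ con 0ℤ :* C :+ con 0ℤ :* B)) :* (a :* (g :* g)) :=
           a :* ((:- A) :* g) :* ((:- A) :* g)) ≈-refl a A B C G₅ q ⟩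
    a ⊗ (⊖ A ⊗ G₅) ⊗ (⊖ A ⊗ G₅) ∎

  g₁ : b ⊗ x ⊕ ⊖ (q ⊗ c) ≈ constant (+ 2) ⊗ a ⊗ y
  g₁ = begin
    b ⊗ (α ⊗ G₁₀) ⊕ ⊖ (q ⊗ c)
      ≈⟨ solve 5 (λ b c α g Q → b :* (α :* g) :+ :- (Q :* c) := b :* (α :* g) :+ :- (Q :* c) :* con 1ℤ) ≈-refl b c α G₁₀ q ⟩
    b ⊗ (α ⊗ G₁₀) ⊕ ⊖ (q ⊗ c) ⊗ constant 1ℤ
      ≈⟨ ⊕-cong ≈-refl (⊗-cong ≈-refl (≈-sym FG₁₀)) ⟩
    b ⊗ (α ⊗ G₁₀) ⊕ ⊖ (q ⊗ c) ⊗ (F₁₀ ⊗ G₁₀)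
      ≈⟨ solve 8 (λ a b c α γ f g Q → b :* (α :* g) :+ :- (Q :* c) :* (f :* g) :=
           (a :* con 0ℤ :+ b :* α :+ Q :* (con 0ℤ :* γ :+ con 0ℤ :* con 0ℤ :+ c :* (:- f))) :* g) ≈-refl a b c α γ F₁₀ G₁₀ q ⟩
    (a ⊗ 0ₛ ⊕ b ⊗ α ⊕ q ⊗ (0ₛ ⊗ γ ⊕ 0ₛ ⊗ 0ₛ ⊕ c ⊗ β)) ⊗ G₁₀
      ≈⟨ ⊗-cong (≈-trans (≈-sym (section-⊗-1 a b 0ₛ 0ₛ c α 0ₛ β 0ₛ γ phi-dissection F₂-dissection)) (≈-trans (F₁²-section 1)
           (section-⊗-1 A B C 0ₛ 0ₛ A B C 0ₛ 0ₛ F₁-dissection F₁-dissection))) ≈-refl ⟩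
    (A ⊗ B ⊕ B ⊗ A ⊕ q ⊗ (C ⊗ 0ₛ ⊕ 0ₛ ⊗ 0ₛ ⊕ 0ₛ ⊗ C)) ⊗ G₁₀
      ≈⟨ solve 5 (λ A f C g Q → (A :* (:- f) :+ (:- f) :* A :+ Q :* (C :* con 0ℤ :+ con 0ℤ :* con 0ℤ :+ con 0ℤ :* C)) :* g :=
           :- (con (+ 2) :* A :* (f :* g))) ≈-refl A F₅ C G₁₀ q ⟩
    ⊖ (constant (+ 2) ⊗ A ⊗ (F₅ ⊗ G₁₀))
      ≈⟨ ⊖-cong (⊗-cong ≈-refl (≈-sym a⊗G₅)) ⟩
    ⊖ (constant (+ 2) ⊗ A ⊗ (a ⊗ G₅))
      ≈⟨ solve 3 (λ A a g → :- (con (+ 2) :* A :* (a :* g)) := con (+ 2) :* a :* ((:- A) :* g)) ≈-refl A a G₅ ⟩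
    constant (+ 2) ⊗ a ⊗ (⊖ A ⊗ G₅) ∎

  g₃ : b ⊕ q ⊗ c ⊗ x⁻¹ ≈ constant (+ 2) ⊗ a ⊗ y⁻¹
  g₃ = begin
    b ⊕ q ⊗ c ⊗ (⊖ γ ⊗ G₁₀)
      ≈⟨ solve 2 (λ b z → b :+ z := b :* con 1ℤ :+ z) ≈-refl b (q ⊗ c ⊗ (⊖ γ ⊗ G₁₀)) ⟩
    b ⊗ constant 1ℤ ⊕ q ⊗ c ⊗ (⊖ γ ⊗ G₁₀)
      ≈⟨ ⊕-cong (⊗-cong ≈-refl (≈-sym FG₁₀)) ≈-refl ⟩
    b ⊗ (F₁₀ ⊗ G₁₀) ⊕ q ⊗ c ⊗ (⊖ γ ⊗ G₁₀)
      ≈⟨ solve 8 (λ a b c α γ f g Q → b :* (f :* g) :+ Q :* c :* ((:- γ) :* g) :=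
           :- ((a :* con 0ℤ :+ b :* (:- f) :+ con 0ℤ :* con 0ℤ :+ con 0ℤ :* α :+ Q :* (c :* γ)) :* g)) ≈-refl a b c α γ F₁₀ G₁₀ q ⟩
    ⊖ ((a ⊗ 0ₛ ⊕ b ⊗ β ⊕ 0ₛ ⊗ 0ₛ ⊕ 0ₛ ⊗ α ⊕ q ⊗ (c ⊗ γ)) ⊗ G₁₀)
      ≈⟨ ⊖-cong (⊗-cong (≈-trans (≈-sym (section-⊗-3 a b 0ₛ 0ₛ c α 0ₛ β 0ₛ γ phi-dissection F₂-dissection)) (≈-trans (F₁²-section 3)
           (section-⊗-3 A B C 0ₛ 0ₛ A B C 0ₛ 0ₛ F₁-dissection F₁-dissection))) ≈-refl) ⟩
    ⊖ ((A ⊗ 0ₛ ⊕ B ⊗ C ⊕ C ⊗ B ⊕ 0ₛ ⊗ A ⊕ q ⊗ (0ₛ ⊗ 0ₛ)) ⊗ G₁₀)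
      ≈⟨ solve 5 (λ A f C g Q → :- ((A :* con 0ℤ :+ (:- f) :* C :+ C :* (:- f) :+ con 0ℤ :* A :+ Q :* (con 0ℤ :* con 0ℤ)) :* g) :=
           con (+ 2) :* C :* (f :* g)) ≈-refl A F₅ C G₁₀ q ⟩
    constant (+ 2) ⊗ C ⊗ (F₅ ⊗ G₁₀)
      ≈⟨ ⊗-cong ≈-refl (≈-sym a⊗G₅) ⟩
    constant (+ 2) ⊗ C ⊗ (a ⊗ G₅)
      ≈⟨ solve 3 (λ C a g → con (+ 2) :* C :* (a :* g) := con (+ 2) :* a :* (C :* g)) ≈-refl C a G₅ ⟩
    constant (+ 2) ⊗ a ⊗ (C ⊗ G₅) ∎

  g₄ : c ⊗ x ⊕ ⊖ (a ⊗ x⁻¹) ≈ a ⊗ y⁻¹ ⊗ y⁻¹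
  g₄ = begin
    c ⊗ (α ⊗ G₁₀) ⊕ ⊖ (a ⊗ (⊖ γ ⊗ G₁₀))
      ≈⟨ solve 7 (λ a b c α γ f g → c :* (α :* g) :+ :- (a :* ((:- γ) :* g)) :=
           (a :* γ :+ b :* con 0ℤ :+ con 0ℤ :* (:- f) :+ con 0ℤ :* con 0ℤ :+ c :* α) :* g) ≈-refl a b c α γ F₁₀ G₁₀ ⟩
    (a ⊗ γ ⊕ b ⊗ 0ₛ ⊕ 0ₛ ⊗ β ⊕ 0ₛ ⊗ 0ₛ ⊕ c ⊗ α) ⊗ G₁₀
      ≈⟨ ⊗-cong (≈-trans (≈-sym (section-⊗-4 a b 0ₛ 0ₛ c α 0ₛ β 0ₛ γ phi-dissection F₂-dissection)) (≈-trans (F₁²-section 4)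
           (section-⊗-4 A B C 0ₛ 0ₛ A B C 0ₛ 0ₛ F₁-dissection F₁-dissection))) (≈-sym a⊗G₅⊗G₅) ⟩
    (A ⊗ 0ₛ ⊕ B ⊗ 0ₛ ⊕ C ⊗ C ⊕ 0ₛ ⊗ B ⊕ 0ₛ ⊗ A) ⊗ (a ⊗ (G₅ ⊗ G₅))
      ≈⟨ solve 5 (λ a A B C g → (A :* con 0ℤ :+ B :* con 0ℤ :+ C :* C :+ con 0ℤ :* B :+ con 0ℤ :* A) :* (a :* (g :* g)) :=
           a :* (C :* g) :* (C :* g)) ≈-refl a A B C G₅ ⟩
    a ⊗ (C ⊗ G₅) ⊗ (C ⊗ G₅) ∎

  H₀ H₁ H₂ H₃ H₄ : PowerSeries
  H₀ = section 0 H
  H₁ = section 1 H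
  H₂ = section 2 H
  H₃ = section 3 H
  H₄ = section 4 H

  H-dissection : H ≈ assemble H₀ H₁ H₂ H₃ H₄
  H-dissection = ≈-sym (assemble-sections H)

  phi-unit : phi ⊗ (F₂ ⊗ (G₁ ⊗ G₁)) ≈ constant 1ℤ
  phi-unit = begin
    phi ⊗ (F₂ ⊗ (G₁ ⊗ G₁))
      ≈⟨ ⊗-assoc phi F₂ (G₁ ⊗ G₁) ⟨
    phi ⊗ F₂ ⊗ (G₁ ⊗ G₁)
      ≈⟨ ⊗-cong phi⊗F₂ ≈-refl ⟩
    F₁ ⊗ F₁ ⊗ (G₁ ⊗ G₁)
      ≈⟨ solve 2 (λ f g → f :* f :* (g :* g) := f :* g :* (f :* g)) ≈-refl F₁ G₁ ⟩
    F₁ ⊗ G₁ ⊗ (F₁ ⊗ G₁)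
      ≈⟨ ⊗-cong FG₁ FG₁ ⟩
    constant 1ℤ ⊗ constant 1ℤ
      ≈⟨ solve 0 (con 1ℤ :* con 1ℤ := con 1ℤ) ≈-refl ⟩
    constant 1ℤ ∎

  phi⊗H : phi ⊗ H ≈ F₂
  phi⊗H = begin
    phi ⊗ (F₂ ⊗ F₂ ⊗ (G₁ ⊗ G₁))
      ≈⟨ solve 3 (λ p f g → p :* (f :* f :* g) := p :* (f :* g) :* f) ≈-refl phi F₂ (G₁ ⊗ G₁) ⟩
    phi ⊗ (F₂ ⊗ (G₁ ⊗ G₁)) ⊗ F₂
      ≈⟨ ⊗-cong phi-unit ≈-refl ⟩
    constant 1ℤ ⊗ F₂
      ≈⟨ solve 1 (λ f → con 1ℤ :* f := f) ≈-refl F₂ ⟩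
    F₂ ∎

  phi⊗H-section : ∀ r {z} → section r (phi ⊗ H) ≈ z → ∀ {w} → section r (assemble α 0ₛ β 0ₛ γ) ≈ w → z ⊗ G₁₀ ≈ w ⊗ G₁₀
  phi⊗H-section r p s = ⊗-cong (≈-trans (≈-sym p) (≈-trans (section-cong r (≈-trans phi⊗H F₂-dissection)) s)) ≈-refl

  e₀ : a ⊗ (H₀ ⊗ G₁₀) ⊕ q ⊗ b ⊗ (H₄ ⊗ G₁₀) ⊕ q ⊗ c ⊗ (H₁ ⊗ G₁₀) ≈ x
  e₀ = ≈-trans
    (solve 10 (λ a b c h₀ h₁ h₂ h₃ h₄ g Q → a :* (h₀ :* g) :+ Q :* b :* (h₄ :* g) :+ Q :* c :* (h₁ :* g) :=
      (a :* h₀ :+ Q :* (b :* h₄ :+ con 0ℤ :* h₃ :+ con 0ℤ :* h₂ :+ c :* h₁)) :* g) ≈-refl a b c H₀ H₁ H₂ H₃ H₄ G₁₀ q)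
    (phi⊗H-section 0 (section-⊗-0 a b 0ₛ 0ₛ c H₀ H₁ H₂ H₃ H₄ phi-dissection H-dissection) (section-assemble-0 α 0ₛ β 0ₛ γ))

  e₁ : a ⊗ (H₁ ⊗ G₁₀) ⊕ b ⊗ (H₀ ⊗ G₁₀) ⊕ q ⊗ c ⊗ (H₂ ⊗ G₁₀) ≈ constant 0ℤ
  e₁ = ≈-trans
    (solve 10 (λ a b c h₀ h₁ h₂ h₃ h₄ g Q → a :* (h₁ :* g) :+ b :* (h₀ :* g) :+ Q :* c :* (h₂ :* g) :=
      (a :* h₁ :+ b :* h₀ :+ Q :* (con 0ℤ :* h₄ :+ con 0ℤ :* h₃ :+ c :* h₂)) :* g) ≈-refl a b c H₀ H₁ H₂ H₃ H₄ G₁₀ q)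
    (≈-trans (phi⊗H-section 1 (section-⊗-1 a b 0ₛ 0ₛ c H₀ H₁ H₂ H₃ H₄ phi-dissection H-dissection) (section-assemble-1 α 0ₛ β 0ₛ γ))
      (solve 1 (λ g → con 0ℤ :* g := con 0ℤ) ≈-refl G₁₀))

  e₂ : a ⊗ (H₂ ⊗ G₁₀) ⊕ b ⊗ (H₁ ⊗ G₁₀) ⊕ q ⊗ c ⊗ (H₃ ⊗ G₁₀) ≈ ⊖ constant 1ℤ
  e₂ = ≈-trans
    (solve 10 (λ a b c h₀ h₁ h₂ h₃ h₄ g Q → a :* (h₂ :* g) :+ b :* (h₁ :* g) :+ Q :* c :* (h₃ :* g) :=
      (a :* h₂ :+ b :* h₁ :+ con 0ℤ :* h₀ :+ Q :* (con 0ℤ :* h₄ :+ c :* h₃)) :* g) ≈-refl a b c H₀ H₁ H₂ H₃ H₄ G₁₀ q)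
    (≈-trans (phi⊗H-section 2 (section-⊗-2 a b 0ₛ 0ₛ c H₀ H₁ H₂ H₃ H₄ phi-dissection H-dissection) (section-assemble-2 α 0ₛ β 0ₛ γ))
      (≈-trans (solve 2 (λ f g → (:- f) :* g := :- (f :* g)) ≈-refl F₁₀ G₁₀) (⊖-cong FG₁₀)))

  e₃ : a ⊗ (H₃ ⊗ G₁₀) ⊕ b ⊗ (H₂ ⊗ G₁₀) ⊕ q ⊗ c ⊗ (H₄ ⊗ G₁₀) ≈ constant 0ℤ
  e₃ = ≈-trans
    (solve 10 (λ a b c h₀ h₁ h₂ h₃ h₄ g Q → a :* (h₃ :* g) :+ b :* (h₂ :* g) :+ Q :* c :* (h₄ :* g) :=
      (a :* h₃ :+ b :* h₂ :+ con 0ℤ :* h₁ :+ con 0ℤ :* h₀ :+ Q :* (c :* h₄)) :* g) ≈-refl a b c H₀ H₁ H₂ H₃ H₄ G₁₀ q)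
    (≈-trans (phi⊗H-section 3 (section-⊗-3 a b 0ₛ 0ₛ c H₀ H₁ H₂ H₃ H₄ phi-dissection H-dissection) (section-assemble-3 α 0ₛ β 0ₛ γ))
      (solve 1 (λ g → con 0ℤ :* g := con 0ℤ) ≈-refl G₁₀))

  e₄ : a ⊗ (H₄ ⊗ G₁₀) ⊕ b ⊗ (H₃ ⊗ G₁₀) ⊕ c ⊗ (H₀ ⊗ G₁₀) ≈ ⊖ x⁻¹
  e₄ = ≈-trans
    (solve 10 (λ a b c h₀ h₁ h₂ h₃ h₄ g Q → a :* (h₄ :* g) :+ b :* (h₃ :* g) :+ c :* (h₀ :* g) :=
      (a :* h₄ :+ b :* h₃ :+ con 0ℤ :* h₂ :+ con 0ℤ :* h₁ :+ c :* h₀) :* g) ≈-refl a b c H₀ H₁ H₂ H₃ H₄ G₁₀ q)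
    (≈-trans (phi⊗H-section 4 (section-⊗-4 a b 0ₛ 0ₛ c H₀ H₁ H₂ H₃ H₄ phi-dissection H-dissection) (section-assemble-4 α 0ₛ β 0ₛ γ))
      (solve 2 (λ c g → c :* g := :- ((:- c) :* g)) ≈-refl γ G₁₀))

  X : PowerSeries
  X = theta₃₇ ⊗ theta₁₉

  phi²≈a²+t : phi ⊗ phi ≈ a ⊗ a ⊕ q ⊗ b ⊗ c
  phi²≈a²+t = ≈-trans phi-square (solve 4 (λ a s t Q → a :* a :+ :- (con (+ 4) :* Q :* s :* t) :=
    a :* a :+ Q :* (:- (con (+ 2) :* s)) :* (con (+ 2) :* t)) ≈-refl a theta₃₇ theta₁₉ q)

  phi⁴⊗H₂ : phi ⊗ phi ⊗ (phi ⊗ phi) ⊗ (H₂ ⊗ G₁₀) ≈ a ⊗ (constant (+ 3) ⊗ a ⊗ a ⊕ constant (+ 8) ⊗ q ⊗ X)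
  phi⁴⊗H₂ = begin
    phi ⊗ phi ⊗ (phi ⊗ phi) ⊗ (H₂ ⊗ G₁₀)
      ≈⟨ ⊗-cong (⊗-cong phi²≈a²+t phi²≈a²+t) ≈-refl ⟩
    (a ⊗ a ⊕ q ⊗ b ⊗ c) ⊗ (a ⊗ a ⊕ q ⊗ b ⊗ c) ⊗ (H₂ ⊗ G₁₀)
      ≈⟨ Quintisection.middle-section x-inverse y-inverse g₀ g₁ g₃ g₄ e₀ e₁ e₂ e₃ e₄ {u ⊗ u} u-inverse ⟩
    a ⊗ (constant (+ 3) ⊗ a ⊗ a ⊕ ⊖ (constant (+ 2) ⊗ (q ⊗ b ⊗ c)))
      -- Inserting b = - 2 f(-q³,-q⁷) and c = 2 f(-q,-q⁹) turns - 2 q b c into 8 q X.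
      ≈⟨ solve 4 (λ a s t Q → a :* (con (+ 3) :* a :* a :+ :- (con (+ 2) :* (Q :* (:- (con (+ 2) :* s)) :* (con (+ 2) :* t)))) :=
           a :* (con (+ 3) :* a :* a :+ con (+ 8) :* Q :* (s :* t))) ≈-refl a theta₃₇ theta₁₉ q ⟩
    a ⊗ (constant (+ 3) ⊗ a ⊗ a ⊕ constant (+ 8) ⊗ q ⊗ X) ∎
    where
    u : PowerSeries
    u = F₂ ⊗ (G₁ ⊗ G₁)
    u-inverse : u ⊗ u ⊗ (a ⊗ a ⊕ q ⊗ b ⊗ c) ≈ constant 1ℤ
    u-inverse = ≈-trans (⊗-cong ≈-refl (≈-sym phi²≈a²+t)) (≈-trans
      (solve 2 (λ u p → u :* u :* (p :* p) := p :* u :* (p :* u)) ≈-refl u phi)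
      (≈-trans (⊗-cong phi-unit phi-unit) (solve 0 (con 1ℤ :* con 1ℤ := con 1ℤ) ≈-refl)))

-- Translation into the powers, multiples and quotients of the statement

pow : PowerSeries → ℕ → PowerSeries
pow x zero    = constant 1ℤ
pow x (suc n) = x ⊗ pow x n

opaque
  unfolding _⊕_

  *-⊗ : ∀ {x y x′ y′} → x ≈ x′ → y ≈ y′ → x * y ≈ x′ ⊗ y′
  *-⊗ = ⊗-cong

  +-⊕ : ∀ {x y x′ y′} → x ≈ x′ → y ≈ y′ → x + y ≈ x′ ⊕ y′
  +-⊕ = ⊕-cong

^-pow : ∀ n {x x′} → x ≈ x′ → x ^ n ≈ pow x′ n
^-pow zero    p = 1#≈constant
^-pow (suc n) {x} {x′} p = *-⊗ {x} {x ^ n} {x′} {pow x′ n} p (^-pow n p)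

×-constant : ∀ n x → n × x ≈ constant (+ n) ⊗ x
×-constant zero    x = ≈-trans 0#≈constant (solve 1 (λ x → con 0ℤ := con 0ℤ :* x) ≈-refl x)
×-constant (suc n) x = ≈-trans (+-⊕ (≈-refl {x}) (×-constant n x))
  (≈-trans (solve 2 (λ x y → x :+ y :* x := (con 1ℤ :+ y) :* x) ≈-refl x (constant (+ n))) (⊗-cong constant-suc ≈-refl))
  where
  constant-suc : constant 1ℤ ⊕ constant (+ n) ≈ constant (+ suc n)
  constant-suc zero    = ⊕-coeff (constant 1ℤ) (constant (+ n)) 0
  constant-suc (suc m) = ⊕-coeff (constant 1ℤ) (constant (+ n)) (suc m)

quotient : ∀ x y {x′ y′} → y 0 ≡ 1ℤ → x ≈ x′ → y ≈ y′ → y′ ⊗ (x / y) ≈ x′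
quotient x y {x′} {y′} y₀≡1 p r = begin
  y′ ⊗ (x / y)          ≈⟨ ⊗-cong (≈-sym r) (*-⊗ (≈-refl {x}) (≈-refl {y ⁻¹})) ⟩
  y ⊗ (x ⊗ y ⁻¹)        ≈⟨ solve 3 (λ x y z → y :* (x :* z) := x :* (y :* z)) ≈-refl x y (y ⁻¹) ⟩
  x ⊗ (y ⊗ y ⁻¹)        ≈⟨ ⊗-cong p (⊗-inverse y y₀≡1) ⟩
  x′ ⊗ constant 1ℤ      ≈⟨ solve 1 (λ x → x :* con 1ℤ := x) ≈-refl x′ ⟩
  x′                    ∎
  where open ≈-Reasoning

pow-constant-term : ∀ {x} n → x 0 ≡ 1ℤ → pow x n 0 ≡ 1ℤ
pow-constant-term zero    p = refl
pow-constant-term {x} (suc n) p = trans (⊗-coeff-0 x (pow x n)) (cong₂ ℤ._*_ p (pow-constant-term n p))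

D : PowerSeries
D = pow F₁ 8 ⊗ pow F₁₀ 2

-- From f₁⁸ = φ⁴ f₂⁴ and `phi⁴⊗H₂`; each a is then absorbed by a f₁₀ = f₅² and X by its product
-- formula. The second denominator f₁⁷ lacks a factor f₁ f₁₀² of D, which is the extra factor in the
-- second term.
D⊗H₂ : D ⊗ H₂ ≈ constant (+ 3) ⊗ (pow F₂ 4 ⊗ pow F₅ 6) ⊕ constant (+ 8) ⊗ q ⊗ F₁ ⊗ F₁₀ ⊗ F₁₀ ⊗ (pow F₂ 3 ⊗ F₅ ⊗ pow F₁₀ 3)
D⊗H₂ = begin
  pow F₁ 8 ⊗ pow F₁₀ 2 ⊗ H₂
    -- The nested products ending in 1 are `pow` unfolded, so that the solver sees monomials.
    ≈⟨ solve 3 (λ f g h → f :* (f :* (f :* (f :* (f :* (f :* (f :* (f :* con 1ℤ))))))) :* (g :* (g :* con 1ℤ)) :* h :=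
         f :* f :* (f :* f) :* (f :* f :* (f :* f)) :* (g :* g) :* h :* con 1ℤ) ≈-refl F₁ F₁₀ H₂ ⟩
  F₁ ⊗ F₁ ⊗ (F₁ ⊗ F₁) ⊗ (F₁ ⊗ F₁ ⊗ (F₁ ⊗ F₁)) ⊗ (F₁₀ ⊗ F₁₀) ⊗ H₂ ⊗ constant 1ℤ
    ≈⟨ ⊗-cong (⊗-cong (⊗-cong (⊗-cong (⊗-cong F₁² F₁²) (⊗-cong F₁² F₁²)) (≈-refl {F₁₀ ⊗ F₁₀})) (≈-refl {H₂})) (≈-sym FG₁₀) ⟩
  phi ⊗ F₂ ⊗ (phi ⊗ F₂) ⊗ (phi ⊗ F₂ ⊗ (phi ⊗ F₂)) ⊗ (F₁₀ ⊗ F₁₀) ⊗ H₂ ⊗ (F₁₀ ⊗ G₁₀)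
    ≈⟨ solve 5 (λ p f g h i → p :* f :* (p :* f) :* (p :* f :* (p :* f)) :* (g :* g) :* h :* (g :* i) :=
         p :* p :* (p :* p) :* (h :* i) :* (f :* f :* f :* f :* g :* g :* g)) ≈-refl phi F₂ F₁₀ H₂ G₁₀ ⟩
  phi ⊗ phi ⊗ (phi ⊗ phi) ⊗ (H₂ ⊗ G₁₀) ⊗ (F₂ ⊗ F₂ ⊗ F₂ ⊗ F₂ ⊗ F₁₀ ⊗ F₁₀ ⊗ F₁₀)
    ≈⟨ ⊗-cong phi⁴⊗H₂ ≈-refl ⟩
  a ⊗ (constant (+ 3) ⊗ a ⊗ a ⊕ constant (+ 8) ⊗ q ⊗ X) ⊗ (F₂ ⊗ F₂ ⊗ F₂ ⊗ F₂ ⊗ F₁₀ ⊗ F₁₀ ⊗ F₁₀)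
    ≈⟨ solve 5 (λ a x f g Q → a :* (con (+ 3) :* a :* a :+ con (+ 8) :* Q :* x) :* (f :* f :* f :* f :* g :* g :* g) :=
         con (+ 3) :* (a :* g :* (a :* g) :* (a :* g)) :* (f :* f :* f :* f) :+ con (+ 8) :* Q :* (a :* g) :* x :* (f :* f :* f :* f :* g :* g))
         ≈-refl a X F₂ F₁₀ q ⟩
  constant (+ 3) ⊗ (a ⊗ F₁₀ ⊗ (a ⊗ F₁₀) ⊗ (a ⊗ F₁₀)) ⊗ (F₂ ⊗ F₂ ⊗ F₂ ⊗ F₂) ⊕ constant (+ 8) ⊗ q ⊗ (a ⊗ F₁₀) ⊗ X ⊗ (F₂ ⊗ F₂ ⊗ F₂ ⊗ F₂ ⊗ F₁₀ ⊗ F₁₀)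
    ≈⟨ ⊕-cong (⊗-cong (⊗-cong (≈-refl {constant (+ 3)}) (⊗-cong (⊗-cong a⊗F₁₀ a⊗F₁₀) a⊗F₁₀)) ≈-refl) (⊗-cong (⊗-cong (⊗-cong (≈-refl {constant (+ 8) ⊗ q}) a⊗F₁₀) (≈-refl {X})) ≈-refl) ⟩
  constant (+ 3) ⊗ (F₅ ⊗ F₅ ⊗ (F₅ ⊗ F₅) ⊗ (F₅ ⊗ F₅)) ⊗ (F₂ ⊗ F₂ ⊗ F₂ ⊗ F₂) ⊕ constant (+ 8) ⊗ q ⊗ (F₅ ⊗ F₅) ⊗ X ⊗ (F₂ ⊗ F₂ ⊗ F₂ ⊗ F₂ ⊗ F₁₀ ⊗ F₁₀)
    ≈⟨ solve 6 (λ x f g h Q w → w :+ con (+ 8) :* Q :* (h :* h) :* x :* (f :* f :* f :* f :* g :* g) :=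
         w :+ con (+ 8) :* Q :* h :* (x :* f :* h) :* (f :* f :* f :* g :* g)) ≈-refl X F₂ F₁₀ F₅ q _ ⟩
  constant (+ 3) ⊗ (F₅ ⊗ F₅ ⊗ (F₅ ⊗ F₅) ⊗ (F₅ ⊗ F₅)) ⊗ (F₂ ⊗ F₂ ⊗ F₂ ⊗ F₂) ⊕ constant (+ 8) ⊗ q ⊗ F₅ ⊗ (X ⊗ F₂ ⊗ F₅) ⊗ (F₂ ⊗ F₂ ⊗ F₂ ⊗ F₁₀ ⊗ F₁₀)
    ≈⟨ ⊕-cong ≈-refl (⊗-cong (⊗-cong (≈-refl {constant (+ 8) ⊗ q ⊗ F₅}) theta₃₇⊗theta₁₉) ≈-refl) ⟩
  constant (+ 3) ⊗ (F₅ ⊗ F₅ ⊗ (F₅ ⊗ F₅) ⊗ (F₅ ⊗ F₅)) ⊗ (F₂ ⊗ F₂ ⊗ F₂ ⊗ F₂) ⊕ constant (+ 8) ⊗ q ⊗ F₅ ⊗ (F₁ ⊗ F₁₀ ⊗ F₁₀ ⊗ F₁₀) ⊗ (F₂ ⊗ F₂ ⊗ F₂ ⊗ F₁₀ ⊗ F₁₀)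
    ≈⟨ solve 5 (λ e f g h Q →
         con (+ 3) :* (h :* h :* (h :* h) :* (h :* h)) :* (f :* f :* f :* f) :+ con (+ 8) :* Q :* h :* (e :* g :* g :* g) :* (f :* f :* f :* g :* g) :=
         con (+ 3) :* (f :* (f :* (f :* (f :* con 1ℤ))) :* (h :* (h :* (h :* (h :* (h :* (h :* con 1ℤ)))))))
         :+ con (+ 8) :* Q :* e :* g :* g :* (f :* (f :* (f :* con 1ℤ)) :* h :* (g :* (g :* (g :* con 1ℤ))))) ≈-refl F₁ F₂ F₁₀ F₅ q ⟩
  constant (+ 3) ⊗ (pow F₂ 4 ⊗ pow F₅ 6) ⊕ constant (+ 8) ⊗ q ⊗ F₁ ⊗ F₁₀ ⊗ F₁₀ ⊗ (pow F₂ 3 ⊗ F₅ ⊗ pow F₁₀ 3) ∎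
  where
  open ≈-Reasoning
  F₁² : F₁ ⊗ F₁ ≈ phi ⊗ F₂
  F₁² = ≈-sym phi⊗F₂

-- A quotient is accessible through multiplication by its denominator: both sides times f₂² give
-- f₄², the right one because f₁² H = f₂² at q².
EOᵤ-dilate : EOᵤ ≈ dilate 2 H
EOᵤ-dilate = unit-cancelˡ {u = G₂ ⊗ G₂} {a = F₂ ⊗ F₂}
  (≈-trans (solve 2 (λ f g → f :* f :* (g :* g) := f :* g :* (f :* g)) ≈-refl F₂ G₂)
    (≈-trans (⊗-cong FG₂ FG₂) (solve 0 (con 1ℤ :* con 1ℤ := con 1ℤ) ≈-refl)))
  (begin
    F₂ ⊗ F₂ ⊗ EOᵤ
      ≈⟨ ⊗-cong (solve 1 (λ f → f :* f := f :* (f :* con 1ℤ)) ≈-refl F₂) ≈-refl ⟩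
    pow F₂ 2 ⊗ EOᵤ
      ≈⟨ quotient (f 4 ^ 2) (f 2 ^ 2) (^-constant (f 2) 2 refl) (^-pow 2 (f≈poch 4)) (^-pow 2 (f≈poch 2)) ⟩
    pow (poch 4 4) 2
      ≈⟨ solve 1 (λ f → f :* (f :* con 1ℤ) := f :* f) ≈-refl (poch 4 4) ⟩
    poch 4 4 ⊗ poch 4 4
      ≈⟨ ⊗-cong F₂-dilate F₂-dilate ⟨
    dilate 2 F₂ ⊗ dilate 2 F₂
      ≈⟨ dilate-⊗ 2 F₂ F₂ ⟨
    dilate 2 (F₂ ⊗ F₂)
      ≈⟨ dilate-cong 2 F₁⊗F₁⊗H ⟨
    dilate 2 (F₁ ⊗ F₁ ⊗ H)
      ≈⟨ ≈-trans (dilate-⊗ 2 (F₁ ⊗ F₁) H) (⊗-cong (≈-trans (dilate-⊗ 2 F₁ F₁) (⊗-cong F₁-dilate F₁-dilate)) ≈-refl) ⟩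
    F₂ ⊗ F₂ ⊗ dilate 2 H ∎)
  where
  open ≈-Reasoning
  F₁-dilate : dilate 2 F₁ ≈ F₂
  F₁-dilate = dilate-poch 2 {1} {1} (s≤s z≤n) (s≤s z≤n)
  F₂-dilate : dilate 2 F₂ ≈ poch 4 4
  F₂-dilate = dilate-poch 2 {2} {2} (s≤s z≤n) (s≤s z≤n)
  F₁⊗F₁⊗H : F₁ ⊗ F₁ ⊗ H ≈ F₂ ⊗ F₂
  F₁⊗F₁⊗H = ≈-trans (solve 3 (λ f g e → f :* f :* (e :* e :* (g :* g)) := f :* g :* (f :* g) :* (e :* e)) ≈-refl F₁ G₁ F₂)
    (≈-trans (⊗-cong (⊗-cong FG₁ FG₁) ≈-refl) (solve 1 (λ e → con 1ℤ :* con 1ℤ :* (e :* e) := e :* e) ≈-refl F₂))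

-- The eta products enter as variables known only up to `≈`, which keeps their defining products
-- from being unfolded in the comparison of quotients.
module _ (f₁ f₂ f₅ f₁₀ : PowerSeries) (f₁≈F₁ : f₁ ≈ F₁) (f₂≈F₂ : f₂ ≈ F₂) (f₅≈F₅ : f₅ ≈ F₅) (f₁₀≈F₁₀ : f₁₀ ≈ F₁₀) where

  private
    Y₁ Y₂ : PowerSeries
    Y₁ = f₂ ^ 4 * f₅ ^ 6 / (f₁ ^ 8 * f₁₀ ^ 2)
    Y₂ = f₂ ^ 3 * f₅ * f₁₀ ^ 3 / f₁ ^ 7

    D₀≡1 : D 0 ≡ 1ℤ
    D₀≡1 = trans (⊗-coeff-0 (pow F₁ 8) (pow F₁₀ 2)) (cong₂ ℤ._*_ (pow-constant-term {F₁} 8 refl) (pow-constant-term {F₁₀} 2 refl))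

    D⊗Y₁ : D ⊗ Y₁ ≈ pow F₂ 4 ⊗ pow F₅ 6
    D⊗Y₁ = quotient (f₂ ^ 4 * f₅ ^ 6) (f₁ ^ 8 * f₁₀ ^ 2) {pow F₂ 4 ⊗ pow F₅ 6} {D}
      (*-constant (f₁ ^ 8) (f₁₀ ^ 2) (^-constant f₁ 8 (f₁≈F₁ 0)) (^-constant f₁₀ 2 (f₁₀≈F₁₀ 0)))
      (*-⊗ {f₂ ^ 4} {f₅ ^ 6} {pow F₂ 4} {pow F₅ 6} (^-pow 4 {f₂} {F₂} f₂≈F₂) (^-pow 6 {f₅} {F₅} f₅≈F₅))
      (*-⊗ {f₁ ^ 8} {f₁₀ ^ 2} {pow F₁ 8} {pow F₁₀ 2} (^-pow 8 {f₁} {F₁} f₁≈F₁) (^-pow 2 {f₁₀} {F₁₀} f₁₀≈F₁₀))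

    F₁⁷⊗Y₂ : pow F₁ 7 ⊗ Y₂ ≈ pow F₂ 3 ⊗ F₅ ⊗ pow F₁₀ 3
    F₁⁷⊗Y₂ = quotient (f₂ ^ 3 * f₅ * f₁₀ ^ 3) (f₁ ^ 7) {pow F₂ 3 ⊗ F₅ ⊗ pow F₁₀ 3} {pow F₁ 7} (^-constant f₁ 7 (f₁≈F₁ 0))
      (*-⊗ {f₂ ^ 3 * f₅} {f₁₀ ^ 3} {pow F₂ 3 ⊗ F₅} {pow F₁₀ 3}
        (*-⊗ {f₂ ^ 3} {f₅} {pow F₂ 3} {F₅} (^-pow 3 {f₂} {F₂} f₂≈F₂) f₅≈F₅) (^-pow 3 {f₁₀} {F₁₀} f₁₀≈F₁₀))
      (^-pow 7 {f₁} {F₁} f₁≈F₁)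

    combination : ∀ x y → constant (+ 3) ⊗ x ⊕ constant (+ 8) ⊗ q ⊗ y ≈ 3 × x + 8 × q * y
    combination x y = ≈-sym (+-⊕ {3 × x} {8 × q * y} {constant (+ 3) ⊗ x} {constant (+ 8) ⊗ q ⊗ y} (×-constant 3 x)
      (*-⊗ {8 × q} {y} {constant (+ 8) ⊗ q} {y} (×-constant 8 q) (≈-refl {y})))

  H₂-quotients : H₂ ≈ 3 × (f₂ ^ 4 * f₅ ^ 6 / (f₁ ^ 8 * f₁₀ ^ 2)) + 8 × q * (f₂ ^ 3 * f₅ * f₁₀ ^ 3 / f₁ ^ 7)
  H₂-quotients = ≈-trans (unit-cancelˡ {u = D ⁻¹} {a = D} (⊗-inverse D D₀≡1) (begin
    D ⊗ H₂
      ≈⟨ D⊗H₂ ⟩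
    constant (+ 3) ⊗ (pow F₂ 4 ⊗ pow F₅ 6) ⊕ constant (+ 8) ⊗ q ⊗ F₁ ⊗ F₁₀ ⊗ F₁₀ ⊗ (pow F₂ 3 ⊗ F₅ ⊗ pow F₁₀ 3)
      ≈⟨ ⊕-cong (⊗-cong ≈-refl D⊗Y₁) (⊗-cong ≈-refl F₁⁷⊗Y₂) ⟨
    constant (+ 3) ⊗ (D ⊗ Y₁) ⊕ constant (+ 8) ⊗ q ⊗ F₁ ⊗ F₁₀ ⊗ F₁₀ ⊗ (pow F₁ 7 ⊗ Y₂)
      ≈⟨ solve 6 (λ p e g y z Q →
           con (+ 3) :* (e :* p :* (g :* (g :* con 1ℤ)) :* y) :+ con (+ 8) :* Q :* e :* g :* g :* (p :* z) :=
           (e :* p :* (g :* (g :* con 1ℤ))) :* (con (+ 3) :* y :+ con (+ 8) :* Q :* z)) ≈-refl (pow F₁ 7) F₁ F₁₀ Y₁ Y₂ q ⟩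
    D ⊗ (constant (+ 3) ⊗ Y₁ ⊕ constant (+ 8) ⊗ q ⊗ Y₂) ∎)) (combination Y₁ Y₂)
    where open ≈-Reasoning

EOᵤ-section : (λ n → EOᵤ (10 ℕ.* n ℕ.+ 4)) ≈ H₂
EOᵤ-section n = trans (EOᵤ-dilate (10 ℕ.* n ℕ.+ 4)) (trans (cong (dilate 2 H) (index n)) (dilate-multiple 2 H (2 ℕ.+ n ℕ.* 5)))
  where
  open ℕ-Solver.+-*-Solver using () renaming (solve to ℕsolve; _:=_ to _:=ⁿ_; _:+_ to _:+ⁿ_; _:*_ to _:*ⁿ_; con to conⁿ)
  index : ∀ n → 10 ℕ.* n ℕ.+ 4 ≡ (2 ℕ.+ n ℕ.* 5) ℕ.* 2
  index = ℕsolve 1 (λ n → conⁿ 10 :*ⁿ n :+ⁿ conⁿ 4 :=ⁿ (conⁿ 2 :+ⁿ n :*ⁿ conⁿ 5) :*ⁿ conⁿ 2) refl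

theorem3p4 : (λ n → EOᵤ (10 ℕ.* n ℕ.+ 4)) ≈ 3 × (f 2 ^ 4 * f 5 ^ 6 / (f 1 ^ 8 * f 10 ^ 2)) + 8 × q * (f 2 ^ 3 * f 5 * f 10 ^ 3 / f 1 ^ 7)
theorem3p4 n = trans (EOᵤ-section n) (H₂-quotients (f 1) (f 2) (f 5) (f 10) (f≈poch 1) (f≈poch 2) (f≈poch 5) (f≈poch 10) n)
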